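{- For every integer $n\geq 2$, $$\lfloor e^{w(n)}\rfloor -2\leq K_n\leq \lfloor e^{w(n)}\rfloor +1.$$
   Context: $S(n,k)$ denotes the Stirling number of the second kind (the number of partitions of $\{1,\ldots,n\}$ into $k$ nonempty blocks), with $S(n,k)=0$ for $k=0$ (when $n\geq1$) and for $k>n$. For $n\geq 1$ the sequence $S(n,1),\ldots,S(n,n)$ is strictly log-concave, so there is a unique integer $K_n$ with $1\leq K_n\leq n$ such that $S(n,K_n-1)<S(n,K_n)\geq S(n,K_n+1)$. $w(n)$ denotes Lambert's W function, i.e. the unique real $w>0$ with $n=we^{w}$ (for $n>0$). $\lfloor x\rfloor$ is the integer part of $x$. -}

module Defs where

open import Data.Bool.Base using (true; false)
open import Data.Fin.Properties using (all?)
open import Data.Fin.Subset using (Subset; _∈_; _∩_; Nonempty; Empty)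
open import Data.Fin.Subset.Properties using (nonempty?; _∈?_)
open import Data.Integer.Base as ℤ using (ℤ; +_; -[1+_]; +≤+; -≤+)
import Data.Integer.Properties as ℤ
open import Data.List.Base using (List; []; _∷_; [_]; _++_; map; filter; length)
open import Data.List.Relation.Unary.All using (All)
import Data.List.Relation.Unary.All as All
open import Data.List.Relation.Unary.AllPairs using (AllPairs; allPairs?)
open import Data.List.Relation.Unary.Any using (Any)
import Data.List.Relation.Unary.Any as Any
open import Data.Nat.Base as ℕ using (ℕ; zero; suc)
import Data.Nat.Coprimality as Coprime
import Data.Nat.Properties as ℕ
open import Data.Product.Base using (∃-syntax; _×_; _,_; proj₁; proj₂)
open import Data.Rational.Base as ℚ using
  (ℚ; mkℚ; 0ℚ; 1ℚ; ½; _/_; _+_; _-_; -_; ∣_∣; *≤*; positive; nonNegative)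
  renaming (_*_ to _·_)
open import Data.Rational.Properties as ℚ using ()
import Data.Rational.Solver as ℚ-Solver
import Data.Rational.Unnormalised.Base as ℚᵘ
import Data.Rational.Unnormalised.Properties as ℚᵘ
open import Data.Vec.Base as Vec using ()
open import Relation.Binary.PropositionalEquality
  using (_≡_; refl; sym; trans; cong; cong₂; subst; subst₂)
open import Relation.Nullary.Decidable using (Dec; _×-dec_; ¬?)
open import Relation.Nullary.Negation using (¬_)

sublists : ∀ {A : Set} → List A → List (List A)
sublists []       = [ [] ]
sublists (x ∷ xs) = sublists xs ++ map (x ∷_) (sublists xs)

subsets : ∀ n → List (Subset n)
subsets zero    = [ Vec.[] ]
subsets (suc n) = map (false Vec.∷_) (subsets n) ++ map (true Vec.∷_) (subsets n)

-- `subsets n` has no repetitions, so every set of subsets of Fin n occurs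
-- here exactly once, as a list without repetitions.
families : ∀ n → List (List (Subset n))
families n = sublists (subsets n)

Disjoint : ∀ {n} → Subset n → Subset n → Set
Disjoint p q = Empty (p ∩ q)

IsPartition : ∀ {n} → List (Subset n) → Set
IsPartition P = All Nonempty P × AllPairs Disjoint P × (∀ i → Any (i ∈_) P)

isPartition? : ∀ {n} (P : List (Subset n)) → Dec (IsPartition P)
isPartition? P =
  All.all? nonempty? P
    ×-dec allPairs? (λ p q → ¬? (nonempty? (p ∩ q))) P
    ×-dec all? (λ i → Any.any? (i ∈?_) P)

S : ℕ → ℕ → ℕ
S n k = length (filter (λ P → isPartition? P ×-dec length P ℕ.≟ k) (families n))

-- The defining property of K = K_n.  The truncated subtraction is harmless because 1 ≤ K.
IsK : ℕ → ℕ → Set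
IsK n K =
  1 ℕ.≤ K × K ℕ.≤ n × S n (K ℕ.∸ 1) ℕ.< S n K × S n (K ℕ.+ 1) ℕ.≤ S n K

IsCauchy : (ℕ → ℚ) → Set
IsCauchy x =
  ∀ ε → 0ℚ ℚ.< ε → ∃[ N ] ∀ m n → N ℕ.≤ m → N ℕ.≤ n → ∣ x m - x n ∣ ℚ.≤ ε

-- Two reals are equal when they are related by _≈_ below.
record ℝ : Set where
  constructor mkℝ
  field
    seq    : ℕ → ℚ
    cauchy : IsCauchy seq

open ℝ public

infix 4 _≈_ _<_ _≤_

_≈_ : ℝ → ℝ → Set
x ≈ y = ∀ ε → 0ℚ ℚ.< ε → ∃[ N ] ∀ n → N ℕ.≤ n → ∣ seq x n - seq y n ∣ ℚ.≤ ε

_<_ : ℝ → ℝ → Set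
x < y = ∃[ ε ] 0ℚ ℚ.< ε × ∃[ N ] ∀ n → N ℕ.≤ n → seq x n + ε ℚ.≤ seq y n

_≤_ : ℝ → ℝ → Set
x ≤ y = ¬ (y < x)

private
  open ℚ-Solver.+-*-Solver using (solve; _:+_; _:*_; _:-_; _:=_; con)
  module ≤R = ℚ.≤-Reasoning

ι : ℕ → ℚ
ι n = mkℚ (+ n) 0 (Coprime.sym (Coprime.1-coprimeTo n))

ι-suc : ∀ n → ι (suc n) ≡ 1ℚ + ι n
ι-suc n = ℚ.toℚᵘ-injective (ℚᵘ.≃-trans
  (ℚᵘ.*≡* (cong (λ i → (+ 1 ℤ.+ i) ℤ.* + 1) (sym (ℤ.*-identityʳ (+ n)))))
  (ℚᵘ.≃-sym (ℚ.toℚᵘ-homo-+ 1ℚ (ι n))))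

recip : ℕ → ℚ
recip k = + 1 / suc k

recip-inverse : ∀ k → recip k · ι (suc k) ≡ 1ℚ
recip-inverse k = subst (λ r → r · ι (suc k) ≡ 1ℚ)
  (sym (ℚ.normalize-coprime (Coprime.1-coprimeTo (suc k))))
  (ℚ.*-inverseˡ (ι (suc k)))

≤-ι : ∀ p → ∃[ n ] p ℚ.≤ ι n
≤-ι (mkℚ (+ n) d c) = n , *≤* (ℤ.*-monoˡ-≤-nonNeg (+ n) (+≤+ (ℕ.s≤s ℕ.z≤n)))
≤-ι (mkℚ -[1+ n ] d c) = 0 , *≤* -≤+

0≤ι : ∀ n → 0ℚ ℚ.≤ ι n
0≤ι n = ℚ.nonNegative⁻¹ (ι n)

0<recip : ∀ k → 0ℚ ℚ.< recip k
0<recip k = ℚ.positive⁻¹ (recip k) {{ℚ.normalize-pos 1 (suc k)}}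

0≤recip : ∀ k → 0ℚ ℚ.≤ recip k
0≤recip k = ℚ.<⇒≤ (0<recip k)

·-mono-≤ : ∀ {a b c d} → 0ℚ ℚ.≤ a → a ℚ.≤ b → 0ℚ ℚ.≤ c → c ℚ.≤ d → a · c ℚ.≤ b · d
·-mono-≤ {a} {b} {c} {d} 0≤a a≤b 0≤c c≤d = ℚ.≤-trans
  (ℚ.*-monoʳ-≤-nonNeg c {{nonNegative 0≤c}} a≤b)
  (ℚ.*-monoˡ-≤-nonNeg b {{nonNegative (ℚ.≤-trans 0≤a a≤b)}} c≤d)

0≤· : ∀ {a b} → 0ℚ ℚ.≤ a → 0ℚ ℚ.≤ b → 0ℚ ℚ.≤ a · b
0≤· {a} {b} 0≤a 0≤b =
  subst (ℚ._≤ a · b) (ℚ.*-zeroˡ 0ℚ) (·-mono-≤ ℚ.≤-refl 0≤a ℚ.≤-refl 0≤b)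

0<· : ∀ {a b} → 0ℚ ℚ.< a → 0ℚ ℚ.< b → 0ℚ ℚ.< a · b
0<· {a} {b} 0<a 0<b =
  ℚ.positive⁻¹ (a · b) {{ℚ.pos*pos⇒pos a {{positive 0<a}} b {{positive 0<b}}}}

≤-step : ∀ {p q} → 0ℚ ℚ.≤ q → p ℚ.≤ p + q
≤-step {p} {q} 0≤q = subst (ℚ._≤ p + q) (ℚ.+-identityʳ p) (ℚ.+-monoʳ-≤ p 0≤q)

∣p-q∣≡∣q-p∣ : ∀ p q → ∣ p - q ∣ ≡ ∣ q - p ∣
∣p-q∣≡∣q-p∣ p q =
  trans (cong ∣_∣ (solve 2 (λ p q → p :- q := con 0ℚ :- (q :- p)) refl p q))
    (trans (cong ∣_∣ (ℚ.+-identityˡ (- (q - p)))) (ℚ.∣-p∣≡∣p∣ (q - p)))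

∣-∣-triangle : ∀ p q r → ∣ p - r ∣ ℚ.≤ ∣ p - q ∣ + ∣ q - r ∣
∣-∣-triangle p q r = subst (λ s → ∣ s ∣ ℚ.≤ ∣ p - q ∣ + ∣ q - r ∣)
  (solve 3 (λ p q r → (p :- q) :+ (q :- r) := p :- r) refl p q r)
  (ℚ.∣p+q∣≤∣p∣+∣q∣ (p - q) (q - r))

half+half : ∀ p → p · ½ + p · ½ ≡ p
half+half p = solve 1 (λ p → p :* con ½ :+ p :* con ½ := p) refl p

0<half : ∀ {p} → 0ℚ ℚ.< p → 0ℚ ℚ.< p · ½
0<half 0<p = 0<· 0<p (ℚ.positive⁻¹ ½)

shrink : ∀ C ε → 0ℚ ℚ.< ε → ∃[ k ] C · recip k ℚ.≤ ε
shrink C ε 0<ε = k , (begin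
  C · recip k                       ≡⟨ cong (_· recip k) (sym C≡) ⟩
  (C · ε⁻¹) · ε · recip k           ≤⟨ ℚ.*-monoʳ-≤-nonNeg (recip k) {{nonNegative (0≤recip k)}}
                                         (ℚ.*-monoʳ-≤-nonNeg ε {{nonNegative (ℚ.<⇒≤ 0<ε)}} C/ε≤) ⟩
  ι (suc k) · ε · recip k           ≡⟨ solve 3 (λ a b c → a :* b :* c := b :* (c :* a)) refl (ι (suc k)) ε (recip k) ⟩
  ε · (recip k · ι (suc k))         ≡⟨ cong (ε ·_) (recip-inverse k) ⟩
  ε · 1ℚ                            ≡⟨ ℚ.*-identityʳ ε ⟩
  ε                                 ∎)
  where
  open ≤R
  instance
    ε-pos : ℚ.Positive ε
    ε-pos = positive 0<ε
    ε-nz : ℚ.NonZero ε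
    ε-nz = ℚ.pos⇒nonZero ε
  ε⁻¹ = ℚ.1/ ε
  k = proj₁ (≤-ι (C · ε⁻¹))
  C≡ : C · ε⁻¹ · ε ≡ C
  C≡ = trans (ℚ.*-assoc C ε⁻¹ ε) (trans (cong (C ·_) (ℚ.*-inverseˡ ε)) (ℚ.*-identityʳ C))
  C/ε≤ : C · ε⁻¹ ℚ.≤ ι (suc k)
  C/ε≤ = ℚ.≤-trans (proj₂ (≤-ι (C · ε⁻¹)))
    (subst (ι k ℚ.≤_) (trans (ℚ.+-comm (ι k) 1ℚ) (sym (ι-suc k))) (≤-step (ℚ.nonNegative⁻¹ 1ℚ)))

cauchy-from : ∀ {x : ℕ → ℚ} →
  (∀ ε → 0ℚ ℚ.< ε → ∃[ N ] ∀ n → N ℕ.≤ n → ∣ x n - x N ∣ ℚ.≤ ε) → IsCauchy x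
cauchy-from {x} h ε 0<ε with h (ε · ½) (0<half 0<ε)
... | N , close = N , λ m n N≤m N≤n → begin
  ∣ x m - x n ∣                  ≤⟨ ∣-∣-triangle (x m) (x N) (x n) ⟩
  ∣ x m - x N ∣ + ∣ x N - x n ∣  ≡⟨ cong (λ d → ∣ x m - x N ∣ + d) (∣p-q∣≡∣q-p∣ (x N) (x n)) ⟩
  ∣ x m - x N ∣ + ∣ x n - x N ∣  ≤⟨ ℚ.+-mono-≤ (close m N≤m) (close n N≤n) ⟩
  ε · ½ + ε · ½                  ≡⟨ half+half ε ⟩
  ε                              ∎
  where open ≤R

bounded : ∀ (x : ℝ) → ∃[ B ] 0ℚ ℚ.≤ B × ∃[ N ] ∀ n → N ℕ.≤ n → ∣ seq x n ∣ ℚ.≤ B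
bounded x with cauchy x 1ℚ (ℚ.positive⁻¹ 1ℚ)
... | N , close = 1ℚ + ∣ seq x N ∣
    , ℚ.≤-trans (ℚ.nonNegative⁻¹ 1ℚ) (≤-step (ℚ.0≤∣p∣ (seq x N))) , N , λ n N≤n → begin
  ∣ seq x n ∣                              ≡⟨ cong ∣_∣ (solve 2 (λ a b → a := (a :- b) :+ b) refl (seq x n) (seq x N)) ⟩
  ∣ (seq x n - seq x N) + seq x N ∣        ≤⟨ ℚ.∣p+q∣≤∣p∣+∣q∣ (seq x n - seq x N) (seq x N) ⟩
  ∣ seq x n - seq x N ∣ + ∣ seq x N ∣      ≤⟨ ℚ.+-monoˡ-≤ ∣ seq x N ∣ (close n N N≤n ℕ.≤-refl) ⟩
  1ℚ + ∣ seq x N ∣                         ∎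
  where open ≤R

fromℤ : ℤ → ℝ
fromℤ i = mkℝ (λ _ → i / 1) λ ε 0<ε → 0 , λ _ _ _ _ →
  subst (ℚ._≤ ε) (cong ∣_∣ (sym (ℚ.+-inverseʳ (i / 1)))) (ℚ.<⇒≤ 0<ε)

∣ab-cd∣≤ : ∀ a b c d → ∣ a · b - c · d ∣ ℚ.≤ ∣ a ∣ · ∣ b - d ∣ + ∣ a - c ∣ · ∣ d ∣
∣ab-cd∣≤ a b c d = begin
  ∣ a · b - c · d ∣                       ≡⟨ cong ∣_∣ (solve 4 (λ a b c d → a :* b :- c :* d := a :* (b :- d) :+ (a :- c) :* d) refl a b c d) ⟩
  ∣ a · (b - d) + (a - c) · d ∣           ≤⟨ ℚ.∣p+q∣≤∣p∣+∣q∣ (a · (b - d)) ((a - c) · d) ⟩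
  ∣ a · (b - d) ∣ + ∣ (a - c) · d ∣       ≡⟨ cong₂ _+_ (ℚ.∣p*q∣≡∣p∣*∣q∣ a (b - d)) (ℚ.∣p*q∣≡∣p∣*∣q∣ (a - c) d) ⟩
  ∣ a ∣ · ∣ b - d ∣ + ∣ a - c ∣ · ∣ d ∣   ∎
  where open ≤R

infixl 7 _*_

_*_ : ℝ → ℝ → ℝ
x * y = mkℝ (λ n → seq x n · seq y n) λ ε 0<ε →
  let A , 0≤A , M₁ , x≤A = bounded x
      B , 0≤B , M₂ , y≤B = bounded y
      k , small          = shrink (A + B) ε 0<ε
      N₁ , xc            = cauchy x (recip k) (0<recip k)
      N₂ , yc            = cauchy y (recip k) (0<recip k)
  in (M₁ ℕ.+ M₂) ℕ.+ (N₁ ℕ.+ N₂) , λ m n ≤m ≤n →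
    let M≤ = ℕ.m≤m+n (M₁ ℕ.+ M₂) (N₁ ℕ.+ N₂)
        N≤ = ℕ.m≤n+m (N₁ ℕ.+ N₂) (M₁ ℕ.+ M₂)
        M₁≤m = ℕ.≤-trans (ℕ.m≤m+n M₁ M₂) (ℕ.≤-trans M≤ ≤m)
        M₂≤n = ℕ.≤-trans (ℕ.m≤n+m M₂ M₁) (ℕ.≤-trans M≤ ≤n)
        N₁≤  = ℕ.≤-trans (ℕ.m≤m+n N₁ N₂) N≤
        N₂≤  = ℕ.≤-trans (ℕ.m≤n+m N₂ N₁) N≤
    in begin
    ∣ seq x m · seq y m - seq x n · seq y n ∣
      ≤⟨ ∣ab-cd∣≤ (seq x m) (seq y m) (seq x n) (seq y n) ⟩
    ∣ seq x m ∣ · ∣ seq y m - seq y n ∣ + ∣ seq x m - seq x n ∣ · ∣ seq y n ∣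
      ≤⟨ ℚ.+-mono-≤
           (·-mono-≤ (ℚ.0≤∣p∣ (seq x m)) (x≤A m M₁≤m) (ℚ.0≤∣p∣ (seq y m - seq y n))
             (yc m n (ℕ.≤-trans N₂≤ ≤m) (ℕ.≤-trans N₂≤ ≤n)))
           (·-mono-≤ (ℚ.0≤∣p∣ (seq x m - seq x n))
             (xc m n (ℕ.≤-trans N₁≤ ≤m) (ℕ.≤-trans N₁≤ ≤n)) (ℚ.0≤∣p∣ (seq y n)) (y≤B n M₂≤n)) ⟩
    A · recip k + recip k · B
      ≡⟨ solve 3 (λ a b r → a :* r :+ r :* b := (a :+ b) :* r) refl A B (recip k) ⟩
    (A + B) · recip k
      ≤⟨ small ⟩
    ε ∎
  where open ≤R

-- expTerm q k = q ^ k / k !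
expTerm : ℚ → ℕ → ℚ
expTerm q zero    = 1ℚ
expTerm q (suc k) = expTerm q k · (q · (+ 1 / suc k))

expSum : ℚ → ℕ → ℚ
expSum q zero    = expTerm q zero
expSum q (suc n) = expSum q n + expTerm q (suc n)

expTerm-nonNeg : ∀ {B} → 0ℚ ℚ.≤ B → ∀ k → 0ℚ ℚ.≤ expTerm B k
expTerm-nonNeg 0≤B zero    = ℚ.nonNegative⁻¹ 1ℚ
expTerm-nonNeg 0≤B (suc k) = 0≤· (expTerm-nonNeg 0≤B k) (0≤· 0≤B (0≤recip k))

∣expTerm∣≤ : ∀ {q B} → ∣ q ∣ ℚ.≤ B → ∀ k → ∣ expTerm q k ∣ ℚ.≤ expTerm B k
∣expTerm∣≤ q≤B zero = ℚ.≤-refl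
∣expTerm∣≤ {q} {B} q≤B (suc k) = begin
  ∣ expTerm q k · (q · recip k) ∣          ≡⟨ ℚ.∣p*q∣≡∣p∣*∣q∣ (expTerm q k) (q · recip k) ⟩
  ∣ expTerm q k ∣ · ∣ q · recip k ∣        ≡⟨ cong (∣ expTerm q k ∣ ·_) (ℚ.∣p*q∣≡∣p∣*∣q∣ q (recip k)) ⟩
  ∣ expTerm q k ∣ · (∣ q ∣ · ∣ recip k ∣)  ≡⟨ cong (λ r → ∣ expTerm q k ∣ · (∣ q ∣ · r)) (ℚ.0≤p⇒∣p∣≡p (0≤recip k)) ⟩
  ∣ expTerm q k ∣ · (∣ q ∣ · recip k)      ≤⟨ ·-mono-≤ (ℚ.0≤∣p∣ (expTerm q k)) (∣expTerm∣≤ q≤B k)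
                                                (0≤· (ℚ.0≤∣p∣ q) (0≤recip k))
                                                (·-mono-≤ (ℚ.0≤∣p∣ q) q≤B (0≤recip k) ℚ.≤-refl) ⟩
  expTerm B k · (B · recip k)              ∎
  where open ≤R

expTerm-lipschitz : ∀ {p q B} → ∣ p ∣ ℚ.≤ B → ∣ q ∣ ℚ.≤ B → ∀ k →
  ∣ expTerm p (suc k) - expTerm q (suc k) ∣ ℚ.≤ ∣ p - q ∣ · expTerm B k
expTerm-lipschitz {p} {q} p≤B q≤B zero = ℚ.≤-reflexive (trans
  (cong ∣_∣ (solve 2 (λ p q → con 1ℚ :* (p :* con 1ℚ) :- con 1ℚ :* (q :* con 1ℚ) := p :- q) refl p q))
  (sym (ℚ.*-identityʳ ∣ p - q ∣)))
expTerm-lipschitz {p} {q} {B} p≤B q≤B (suc k) = begin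
  ∣ P · (p · r′) - Q · (q · r′) ∣
    ≡⟨ cong ∣_∣ (solve 5 (λ P Q p q r → P :* (p :* r) :- Q :* (q :* r) := (P :* p :- Q :* q) :* r) refl P Q p q r′) ⟩
  ∣ (P · p - Q · q) · r′ ∣
    ≡⟨ trans (ℚ.∣p*q∣≡∣p∣*∣q∣ (P · p - Q · q) r′) (cong (∣ P · p - Q · q ∣ ·_) (ℚ.0≤p⇒∣p∣≡p (0≤recip (suc k)))) ⟩
  ∣ P · p - Q · q ∣ · r′
    ≤⟨ ℚ.*-monoʳ-≤-nonNeg r′ {{nonNegative (0≤recip (suc k))}} (ℚ.≤-trans (∣ab-cd∣≤ P p Q q)
         (ℚ.+-mono-≤
           (ℚ.*-monoʳ-≤-nonNeg δ {{nonNegative (ℚ.0≤∣p∣ (p - q))}} (∣expTerm∣≤ p≤B (suc k)))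
           (·-mono-≤ (ℚ.0≤∣p∣ (P - Q)) (expTerm-lipschitz p≤B q≤B k) (ℚ.0≤∣p∣ q) q≤B))) ⟩
  (T · (B · r) · δ + δ · T · B) · r′
    ≡⟨ cong (λ s → (T · (B · r) · δ + s) · r′) (sym (ℚ.*-identityʳ (δ · T · B))) ⟩
  (T · (B · r) · δ + δ · T · B · 1ℚ) · r′
    ≡⟨ cong (λ s → (T · (B · r) · δ + δ · T · B · s) · r′) (sym (recip-inverse k)) ⟩
  (T · (B · r) · δ + δ · T · B · (r · ι (suc k))) · r′
    ≡⟨ solve 6 (λ T B r δ j r′ → (T :* (B :* r) :* δ :+ δ :* T :* B :* (r :* j)) :* r′
         := δ :* (T :* (B :* r)) :* (r′ :* (con 1ℚ :+ j))) refl T B r δ (ι (suc k)) r′ ⟩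
  δ · (T · (B · r)) · (r′ · (1ℚ + ι (suc k)))
    ≡⟨ cong (δ · (T · (B · r)) ·_) (trans (cong (r′ ·_) (sym (ι-suc (suc k)))) (recip-inverse (suc k))) ⟩
  δ · (T · (B · r)) · 1ℚ
    ≡⟨ ℚ.*-identityʳ _ ⟩
  δ · (T · (B · r)) ∎
  where
  open ≤R
  P = expTerm p (suc k)
  Q = expTerm q (suc k)
  T = expTerm B k
  r = recip k
  r′ = recip (suc k)
  δ = ∣ p - q ∣

expSum-lipschitz : ∀ {p q B} → ∣ p ∣ ℚ.≤ B → ∣ q ∣ ℚ.≤ B → ∀ n →
  ∣ expSum p (suc n) - expSum q (suc n) ∣ ℚ.≤ ∣ p - q ∣ · expSum B n
expSum-lipschitz {p} {q} p≤B q≤B zero = ℚ.≤-trans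
  (ℚ.≤-reflexive (cong ∣_∣ (solve 2 (λ a b → (con 1ℚ :+ a) :- (con 1ℚ :+ b) := a :- b) refl
    (expTerm p 1) (expTerm q 1))))
  (expTerm-lipschitz p≤B q≤B zero)
expSum-lipschitz {p} {q} {B} p≤B q≤B (suc n) = begin
  ∣ (E + P) - (F + Q) ∣
    ≡⟨ cong ∣_∣ (solve 4 (λ E P F Q → (E :+ P) :- (F :+ Q) := (E :- F) :+ (P :- Q)) refl E P F Q) ⟩
  ∣ (E - F) + (P - Q) ∣
    ≤⟨ ℚ.∣p+q∣≤∣p∣+∣q∣ (E - F) (P - Q) ⟩
  ∣ E - F ∣ + ∣ P - Q ∣
    ≤⟨ ℚ.+-mono-≤ (expSum-lipschitz p≤B q≤B n) (expTerm-lipschitz p≤B q≤B (suc n)) ⟩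
  ∣ p - q ∣ · expSum B n + ∣ p - q ∣ · expTerm B (suc n)
    ≡⟨ sym (ℚ.*-distribˡ-+ ∣ p - q ∣ (expSum B n) (expTerm B (suc n))) ⟩
  ∣ p - q ∣ · expSum B (suc n) ∎
  where
  open ≤R
  E = expSum p (suc n)
  F = expSum q (suc n)
  P = expTerm p (suc (suc n))
  Q = expTerm q (suc (suc n))

-- Past the index M, terms at least halve.
module Tail (B : ℚ) (0≤B : 0ℚ ℚ.≤ B) where

  private
    T = expTerm B

  M : ℕ
  M = proj₁ (≤-ι (B + B))

  expTerm-halves : ∀ j → T (suc (j ℕ.+ M)) + T (suc (j ℕ.+ M)) ℚ.≤ T (j ℕ.+ M)
  expTerm-halves j = begin
    t · (B · r) + t · (B · r)   ≡⟨ solve 3 (λ t B r → t :* (B :* r) :+ t :* (B :* r) := t :* (r :* (B :+ B))) refl t B r ⟩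
    t · (r · (B + B))           ≤⟨ ℚ.*-monoˡ-≤-nonNeg t {{nonNegative (expTerm-nonNeg 0≤B k)}}
                                     (ℚ.*-monoˡ-≤-nonNeg r {{nonNegative (0≤recip k)}} 2B≤) ⟩
    t · (r · ι (suc k))         ≡⟨ cong (t ·_) (recip-inverse k) ⟩
    t · 1ℚ                      ≡⟨ ℚ.*-identityʳ t ⟩
    t                           ∎
    where
    open ≤R
    k = j ℕ.+ M
    t = T k
    r = recip k
    ι-mono : ∀ i → ι M ℚ.≤ ι (i ℕ.+ M)
    ι-mono zero = ℚ.≤-refl
    ι-mono (suc i) = ℚ.≤-trans (ι-mono i)
      (subst (ι (i ℕ.+ M) ℚ.≤_) (trans (ℚ.+-comm (ι (i ℕ.+ M)) 1ℚ) (sym (ι-suc (i ℕ.+ M)))) (≤-step (ℚ.nonNegative⁻¹ 1ℚ)))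
    2B≤ : B + B ℚ.≤ ι (suc k)
    2B≤ = ℚ.≤-trans (proj₂ (≤-ι (B + B))) (ι-mono (suc j))

  expTerm-decay : ∀ j → T (j ℕ.+ M) · ι (suc j) ℚ.≤ T M
  expTerm-decay zero = ℚ.≤-reflexive (ℚ.*-identityʳ (T M))
  expTerm-decay (suc j) = begin
    t′ · ι (suc (suc j))                  ≡⟨ cong (t′ ·_) (ι-suc (suc j)) ⟩
    t′ · (1ℚ + ι (suc j))                 ≤⟨ ℚ.*-monoˡ-≤-nonNeg t′ {{nonNegative (expTerm-nonNeg 0≤B (suc (j ℕ.+ M)))}}
                                               (ℚ.+-monoˡ-≤ (ι (suc j)) 1≤) ⟩
    t′ · (ι (suc j) + ι (suc j))          ≡⟨ solve 2 (λ t i → t :* (i :+ i) := (t :+ t) :* i) refl t′ (ι (suc j)) ⟩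
    (t′ + t′) · ι (suc j)                 ≤⟨ ℚ.*-monoʳ-≤-nonNeg (ι (suc j)) (expTerm-halves j) ⟩
    T (j ℕ.+ M) · ι (suc j)               ≤⟨ expTerm-decay j ⟩
    T M                                   ∎
    where
    open ≤R
    t′ = T (suc (j ℕ.+ M))
    1≤ : 1ℚ ℚ.≤ ι (suc j)
    1≤ = subst (1ℚ ℚ.≤_) (sym (ι-suc j)) (≤-step (0≤ι j))

  expTerm-small : ∀ k j → k ℕ.≤ j → T (j ℕ.+ M) ℚ.≤ T M · recip k
  expTerm-small k j k≤j = begin
    t                           ≡⟨ sym (ℚ.*-identityʳ t) ⟩
    t · 1ℚ                      ≡⟨ cong (t ·_) (sym (recip-inverse k)) ⟩
    t · (recip k · ι (suc k))   ≡⟨ solve 3 (λ t r i → t :* (r :* i) := (t :* i) :* r) refl t (recip k) (ι (suc k)) ⟩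
    (t · ι (suc k)) · recip k   ≤⟨ ℚ.*-monoʳ-≤-nonNeg (recip k) {{nonNegative (0≤recip k)}}
                                     (ℚ.≤-trans (ℚ.*-monoˡ-≤-nonNeg t {{nonNegative (expTerm-nonNeg 0≤B (j ℕ.+ M))}} ι≤)
                                       (expTerm-decay j)) ⟩
    T M · recip k               ∎
    where
    open ≤R
    t = T (j ℕ.+ M)
    ι≤ : ι (suc k) ℚ.≤ ι (suc j)
    ι≤ = *≤* (ℤ.*-monoʳ-≤-nonNeg (+ 1) (+≤+ (ℕ.s≤s k≤j)))

  expSum-tail : ∀ i j → expSum B (i ℕ.+ (j ℕ.+ M)) + T (i ℕ.+ (j ℕ.+ M)) ℚ.≤ expSum B (j ℕ.+ M) + T (j ℕ.+ M)
  expSum-tail zero j = ℚ.≤-refl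
  expSum-tail (suc i) j = begin
    (E + t′) + t′   ≡⟨ ℚ.+-assoc E t′ t′ ⟩
    E + (t′ + t′)   ≤⟨ ℚ.+-monoʳ-≤ E halves ⟩
    E + T k         ≤⟨ expSum-tail i j ⟩
    expSum B (j ℕ.+ M) + T (j ℕ.+ M) ∎
    where
    open ≤R
    k = i ℕ.+ (j ℕ.+ M)
    E = expSum B k
    t′ = T (suc k)
    halves : t′ + t′ ℚ.≤ T k
    halves = subst (λ l → T (suc l) + T (suc l) ℚ.≤ T l) (ℕ.+-assoc i j M) (expTerm-halves (i ℕ.+ j))

  ∣expSum-tail∣ : ∀ {q} → ∣ q ∣ ℚ.≤ B → ∀ i k →
    ∣ expSum q (i ℕ.+ k) - expSum q k ∣ ℚ.≤ expSum B (i ℕ.+ k) - expSum B k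
  ∣expSum-tail∣ {q} q≤B zero k = ℚ.≤-reflexive
    (trans (cong ∣_∣ (ℚ.+-inverseʳ (expSum q k))) (sym (ℚ.+-inverseʳ (expSum B k))))
  ∣expSum-tail∣ {q} q≤B (suc i) k = begin
    ∣ (E + t) - F ∣         ≡⟨ cong ∣_∣ (solve 3 (λ E t F → (E :+ t) :- F := (E :- F) :+ t) refl E t F) ⟩
    ∣ (E - F) + t ∣         ≤⟨ ℚ.∣p+q∣≤∣p∣+∣q∣ (E - F) t ⟩
    ∣ E - F ∣ + ∣ t ∣       ≤⟨ ℚ.+-mono-≤ (∣expSum-tail∣ q≤B i k) (∣expTerm∣≤ q≤B (suc (i ℕ.+ k))) ⟩
    (G - H) + T (suc (i ℕ.+ k)) ≡⟨ solve 3 (λ G H t → (G :- H) :+ t := (G :+ t) :- H) refl G H (T (suc (i ℕ.+ k))) ⟩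
    (G + T (suc (i ℕ.+ k))) - H ∎
    where
    open ≤R
    E = expSum q (i ℕ.+ k)
    F = expSum q k
    t = expTerm q (suc (i ℕ.+ k))
    G = expSum B (i ℕ.+ k)
    H = expSum B k

  expSum-close : ∀ {q} → ∣ q ∣ ℚ.≤ B → ∀ i j →
    ∣ expSum q (i ℕ.+ (j ℕ.+ M)) - expSum q (j ℕ.+ M) ∣ ℚ.≤ T (j ℕ.+ M)
  expSum-close {q} q≤B i j = begin
    ∣ expSum q (i ℕ.+ k) - expSum q k ∣    ≤⟨ ∣expSum-tail∣ q≤B i k ⟩
    G - H                                  ≤⟨ ≤-step (expTerm-nonNeg 0≤B (i ℕ.+ k)) ⟩
    (G - H) + T (i ℕ.+ k)                  ≡⟨ solve 3 (λ G H t → (G :- H) :+ t := (G :+ t) :- H) refl G H (T (i ℕ.+ k)) ⟩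
    (G + T (i ℕ.+ k)) - H                  ≤⟨ ℚ.+-monoˡ-≤ (- H) (expSum-tail i j) ⟩
    (H + T k) - H                          ≡⟨ solve 2 (λ H t → (H :+ t) :- H := t) refl H (T k) ⟩
    T k                                    ∎
    where
    open ≤R
    k = j ℕ.+ M
    G = expSum B (i ℕ.+ k)
    H = expSum B k

  bound : ℚ
  bound = expSum B M + T M

  expSum-nonNeg : ∀ k → 0ℚ ℚ.≤ expSum B k
  expSum-nonNeg zero    = expTerm-nonNeg 0≤B zero
  expSum-nonNeg (suc k) = ℚ.≤-trans (expSum-nonNeg k) (≤-step (expTerm-nonNeg 0≤B (suc k)))

  bound-nonNeg : 0ℚ ℚ.≤ bound
  bound-nonNeg = ℚ.≤-trans (expSum-nonNeg M) (≤-step (expTerm-nonNeg 0≤B M))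

  expSum-bound : ∀ j → expSum B (j ℕ.+ M) ℚ.≤ bound
  expSum-bound j = ℚ.≤-trans (≤-step (expTerm-nonNeg 0≤B (j ℕ.+ M))) (expSum-tail j 0)

exp : ℝ → ℝ
exp x = mkℝ (λ n → expSum (seq x n) n) (cauchy-from {λ n → expSum (seq x n) n} λ ε 0<ε →
  let B , 0≤B , M′ , x≤B = bounded x
      open Tail B 0≤B
      k₁ , small₁ = shrink (expTerm B M) (ε · ½) (0<half 0<ε)
      k₂ , small₂ = shrink bound (ε · ½) (0<half 0<ε)
      N′ , xc = cauchy x (recip k₂) (0<recip k₂)
      j = (k₁ ℕ.+ M′) ℕ.+ N′
      N = suc j ℕ.+ M
      j≤N = ℕ.≤-trans (ℕ.n≤1+n j) (ℕ.m≤m+n (suc j) M)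
      k₁≤j = ℕ.≤-trans (ℕ.m≤m+n k₁ M′) (ℕ.m≤m+n (k₁ ℕ.+ M′) N′)
      M′≤N = ℕ.≤-trans (ℕ.≤-trans (ℕ.m≤n+m M′ k₁) (ℕ.m≤m+n (k₁ ℕ.+ M′) N′)) j≤N
      N′≤N = ℕ.≤-trans (ℕ.m≤n+m N′ (k₁ ℕ.+ M′)) j≤N
  in N , λ n N≤n →
    let p = seq x n
        q = seq x N
        p≤B = x≤B n (ℕ.≤-trans M′≤N N≤n)
        q≤B = x≤B N M′≤N
    in begin
    ∣ expSum p n - expSum q N ∣
      ≤⟨ ∣-∣-triangle (expSum p n) (expSum p N) (expSum q N) ⟩
    ∣ expSum p n - expSum p N ∣ + ∣ expSum p N - expSum q N ∣
      ≤⟨ ℚ.+-mono-≤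
           (ℚ.≤-trans
             (subst (λ l → ∣ expSum p l - expSum p N ∣ ℚ.≤ expTerm B N)
               (ℕ.m∸n+n≡m N≤n) (expSum-close p≤B (n ℕ.∸ N) (suc j)))
             (ℚ.≤-trans (expTerm-small k₁ (suc j) (ℕ.≤-trans k₁≤j (ℕ.n≤1+n j))) small₁))
           (ℚ.≤-trans (expSum-lipschitz p≤B q≤B (j ℕ.+ M))
             (ℚ.≤-trans
               (ℚ.≤-trans
                 (ℚ.*-monoˡ-≤-nonNeg ∣ p - q ∣ {{nonNegative (ℚ.0≤∣p∣ (p - q))}} (expSum-bound j))
                 (ℚ.*-monoʳ-≤-nonNeg bound {{nonNegative bound-nonNeg}}
                   (xc n N (ℕ.≤-trans N′≤N N≤n) N′≤N)))
               (ℚ.≤-trans (ℚ.≤-reflexive (ℚ.*-comm (recip k₂) bound)) small₂))) ⟩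
    ε · ½ + ε · ½
      ≡⟨ half+half ε ⟩
    ε ∎)
  where open ≤R

-- The defining property of w = w(n), the unique positive root of w e^w = n.
IsLambertW : ℕ → ℝ → Set
IsLambertW n w = fromℤ (+ 0) < w × w * exp w ≈ fromℤ (+ n)

-- m = ⌊ x ⌋; a relation because ⌊_⌋ is not computable on ℝ.
IsFloor : ℝ → ℤ → Set
IsFloor x m = fromℤ m ≤ x × x < fromℤ (m ℤ.+ + 1)

{-# OPTIONS --safe #-}

-- Put a k = S(n, k) and c j = jⁿ / j !.  Since c j = Σₖ a k / (j − k)!, the sequence c is the
-- convolution of a with the Poisson weights 1 / i !, and its mode is M or M + 1 for x = e^w, M = ⌊x⌋.
--
-- Upper bound: a is log-concave, hence increasing up to K, hence so is c; thus c (M + 1) ≤ c (M + 2)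
-- if M + 2 ≤ K, while x < M + 1 and (1 + 1/x)ⁿ ≤ e^w = x give c (M + 2) < c (M + 1).
--
-- Lower bound: x ≥ r + 2 and x (1 − 1/x)ⁿ ≤ 1 give c (r + 1) ≤ c (r + 2), and this is shown to imply
-- a (r − 1) < a r by induction on r.  Write d and δ for the differences of a and c.  As
-- e^t (1 − t + t²/2 − t³/6) = 1 − Σ_{i ≥ 4} C(i − 1, 3) tⁱ / i !, the inequalities d k ≥ 0 for k < r yield
--     d r ≥ δ r − δ (r − 1) + δ (r − 2) / 2 − δ (r − 3) / 6.
-- The right-hand side need only be shown positive for the least n with c (r + 1) ≤ c (r + 2), since
-- a (r − 1) < a r persists as n grows.  For r ≥ 85 this follows from 1 − q (j − 1) / q j, where
-- q j = c (j − 1) / c j, being almost constant near j = r, and for r < 85 from a computation.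
module Submission where

open import Defs hiding (_*_; _≤_; _<_; _≈_)
open import Data.Integer.Base as ℤ using (ℤ)
import Data.Integer.Properties as ℤ
open import Data.Nat.Base as ℕ using (ℕ; zero; suc)
import Data.Nat.Properties as ℕ
open import Data.Product.Base using (_×_; _,_)
open import Relation.Binary.PropositionalEquality using (_≡_; refl; sym; trans; cong; cong₂; subst; subst₂; module ≡-Reasoning)

-- Why e^(-t) is cut at degree 3: truncations of even degree give weights of the wrong sign. Suppose
-- q (r + 2) = 1 and all gaps 1 - q (j - 1) / q j equal a small x, so that q (r - i) is about 1 - (2
-- + i) x. The truncation 1 - t then bounds d r by c r (1 - 2 q r + q r q (r - 1)), about -x c r,
-- which is useless. Degree 3 gives, for six times the bound, 6 - 12 (1 - 2x) + 9 (1 - 5x) - 4 (1 -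
-- 9x) + (1 - 14x) = x, hence is the first that works. The margin is thin: the gaps may differ only
-- by factors such as 21/20 and 11/10, and this fixes the range left to computation, which is finite
-- because each r involves a single n. Factorials are cleared throughout, so that the convolution is
-- an identity between integers with falling factorials in place of 1 / (j - k)!. There e^(p + x) =
-- e^p e^x fails, and a tangent inequality takes its place.

module Counting where
  open import Data.Bool.Base using (true; false; if_then_else_)
  import Data.Fin.Base as Fin
  open import Data.Fin.Subset using (Subset; _∈_; Nonempty; Empty)
  open import Data.Fin.Subset.Properties using (nonempty?; drop-there; ∩-comm; x∈p∩q⁺)
  open import Data.List.Base using (List; []; _∷_; [_]; _++_; map; filter; length)
  import Data.List.Properties as List
  open import Data.List.Relation.Binary.Permutation.Propositional as Perm using (_↭_; ↭-sym; ↭⇒↭ₛ)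
  open import Data.List.Relation.Binary.Permutation.Propositional.Properties using (All-resp-↭; Any-resp-↭; ↭-length; ∷↭∷ʳ)
  open import Data.List.Relation.Binary.Permutation.Setoid.Properties using (AllPairs-resp-↭)
  open import Data.List.Relation.Unary.All as All using (All; []; _∷_)
  import Data.List.Relation.Unary.All.Properties as All
  open import Data.List.Relation.Unary.AllPairs as AllPairs using (AllPairs; []; _∷_)
  import Data.List.Relation.Unary.AllPairs.Properties as AllPairs
  open import Data.List.Relation.Unary.Any as Any using (Any; here; there)
  import Data.List.Relation.Unary.Any.Properties as Any
  open import Data.Nat.Base using (_+_; _*_)
  open import Data.Nat.ListAction using (sum)
  open import Data.Nat.ListAction.Properties using (sum-++)
  open import Data.Nat.Properties using (_≟_; +-comm; +-identityʳ; *-identityʳ; *-zeroʳ; *-distribˡ-+; suc-injective)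
  open import Data.Nat.Tactic.RingSolver using (solve-∀)
  open import Data.Product.Base using (proj₁)
  open import Data.Vec.Base as Vec using ()
  open Vec using (here; there)
  open import Function.Base using (_∘_)
  open import Function.Bundles using (_⇔_; mk⇔; Equivalence)
  open import Relation.Binary.PropositionalEquality using (setoid)
  open import Relation.Nullary.Decidable using (Dec; yes; no; does; _×-dec_; ¬?; dec-false; does-⇔)
  open import Relation.Nullary.Negation using (¬_)
  open ≡-Reasoning

  private variable
    A B : Set

  -- Sums over lists and over their sublists

  ∑ : List A → (A → ℕ) → ℕ
  ∑ xs f = sum (map f xs)

  ∑-++ : ∀ (f : A → ℕ) xs ys → ∑ (xs ++ ys) f ≡ ∑ xs f + ∑ ys f
  ∑-++ f xs ys = trans (cong sum (List.map-++ f xs ys)) (sum-++ (map f xs) (map f ys))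

  ∑-map : ∀ (g : B → A) (f : A → ℕ) xs → ∑ (map g xs) f ≡ ∑ xs (f ∘ g)
  ∑-map g f xs = cong sum (sym (List.map-∘ xs))

  ∑-cong : ∀ {f g : A → ℕ} → (∀ x → f x ≡ g x) → ∀ xs → ∑ xs f ≡ ∑ xs g
  ∑-cong f≗g xs = cong sum (List.map-cong f≗g xs)

  ∑-+ : ∀ (f g : A → ℕ) xs → ∑ xs (λ x → f x + g x) ≡ ∑ xs f + ∑ xs g
  ∑-+ f g []       = refl
  ∑-+ f g (x ∷ xs) = begin
    f x + g x + ∑ xs (λ x → f x + g x) ≡⟨ cong (f x + g x +_) (∑-+ f g xs) ⟩
    f x + g x + (∑ xs f + ∑ xs g)      ≡⟨ lemma (f x) (g x) (∑ xs f) (∑ xs g) ⟩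
    f x + ∑ xs f + (g x + ∑ xs g)      ∎
    where
    lemma : ∀ a b c d → a + b + (c + d) ≡ a + c + (b + d)
    lemma = solve-∀

  ∑-*ʳ : ∀ (f : A → ℕ) c xs → ∑ xs (λ x → c * f x) ≡ c * ∑ xs f
  ∑-*ʳ f c []       = sym (*-zeroʳ c)
  ∑-*ʳ f c (x ∷ xs) = trans (cong (c * f x +_) (∑-*ʳ f c xs)) (sym (*-distribˡ-+ c (f x) (∑ xs f)))

  ∑-zero : ∀ {f : A → ℕ} → (∀ x → f x ≡ 0) → ∀ xs → ∑ xs f ≡ 0
  ∑-zero f≗0 []       = refl
  ∑-zero f≗0 (x ∷ xs) = cong₂ _+_ (f≗0 x) (∑-zero f≗0 xs)

  ∑-swap : ∀ (f : A → B → ℕ) xs ys → ∑ xs (λ x → ∑ ys (f x)) ≡ ∑ ys (λ y → ∑ xs (λ x → f x y))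
  ∑-swap f []       ys = sym (∑-zero (λ _ → refl) ys)
  ∑-swap f (x ∷ xs) ys = trans (cong (∑ ys (f x) +_) (∑-swap f xs ys))
    (sym (∑-+ (f x) (λ y → ∑ xs (λ x → f x y)) ys))

  ∑-sublists-∷ : ∀ (f : List A → ℕ) x xs →
    ∑ (sublists (x ∷ xs)) f ≡ ∑ (sublists xs) f + ∑ (sublists xs) (f ∘ (x ∷_))
  ∑-sublists-∷ f x xs = trans (∑-++ f (sublists xs) _)
    (cong (∑ (sublists xs) f +_) (∑-map (x ∷_) f (sublists xs)))

  ∑-sublists-++ : ∀ (f : List A → ℕ) xs ys →
    ∑ (sublists (xs ++ ys)) f ≡ ∑ (sublists xs) (λ as → ∑ (sublists ys) (λ bs → f (as ++ bs)))
  ∑-sublists-++ f []       ys = sym (+-identityʳ _)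
  ∑-sublists-++ f (x ∷ xs) ys = begin
    ∑ (sublists (x ∷ xs ++ ys)) f
      ≡⟨ ∑-sublists-∷ f x (xs ++ ys) ⟩
    ∑ (sublists (xs ++ ys)) f + ∑ (sublists (xs ++ ys)) (f ∘ (x ∷_))
      ≡⟨ cong₂ _+_ (∑-sublists-++ f xs ys) (∑-sublists-++ (f ∘ (x ∷_)) xs ys) ⟩
    _ ≡⟨ sym (∑-sublists-∷ (λ as → ∑ (sublists ys) (λ bs → f (as ++ bs))) x xs) ⟩
    ∑ (sublists (x ∷ xs)) (λ as → ∑ (sublists ys) (λ bs → f (as ++ bs))) ∎

  sublists-map : ∀ (g : B → A) xs → sublists (map g xs) ≡ map (map g) (sublists xs)
  sublists-map g []       = refl
  sublists-map g (x ∷ xs) = begin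
    sublists (map g xs) ++ map (g x ∷_) (sublists (map g xs))
      ≡⟨ cong (λ l → l ++ map (g x ∷_) l) (sublists-map g xs) ⟩
    map (map g) (sublists xs) ++ map (g x ∷_) (map (map g) (sublists xs))
      ≡⟨ cong (map (map g) (sublists xs) ++_) (trans (sym (List.map-∘ (sublists xs))) (List.map-∘ (sublists xs))) ⟩
    map (map g) (sublists xs) ++ map (map g) (map (x ∷_) (sublists xs))
      ≡⟨ sym (List.map-++ (map g) (sublists xs) _) ⟩
    map (map g) (sublists xs ++ map (x ∷_) (sublists xs)) ∎

  ∑-sublists-[] : ∀ (f : List A → ℕ) → (∀ x as → f (x ∷ as) ≡ 0) → ∀ xs → ∑ (sublists xs) f ≡ f []
  ∑-sublists-[] f f∷≡0 []       = +-identityʳ (f [])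
  ∑-sublists-[] f f∷≡0 (x ∷ xs) = begin
    ∑ (sublists (x ∷ xs)) f                                 ≡⟨ ∑-sublists-∷ f x xs ⟩
    ∑ (sublists xs) f + ∑ (sublists xs) (f ∘ (x ∷_))        ≡⟨ cong₂ _+_ (∑-sublists-[] f f∷≡0 xs) (∑-zero (f∷≡0 x) (sublists xs)) ⟩
    f [] + 0                                                ≡⟨ +-identityʳ (f []) ⟩
    f []                                                    ∎

  -- Applied to the blocks that contain the point 0: a partition has exactly one, so only
  -- one-element choices contribute.
  ∑-sublists-[-] : ∀ (f : List A → ℕ) → f [] ≡ 0 → (∀ x y as → f (x ∷ y ∷ as) ≡ 0) →
    ∀ xs → ∑ (sublists xs) f ≡ ∑ xs (f ∘ [_])
  ∑-sublists-[-] f f[]≡0 f∷∷≡0 []       = trans (+-identityʳ (f [])) f[]≡0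
  ∑-sublists-[-] f f[]≡0 f∷∷≡0 (x ∷ xs) = begin
    ∑ (sublists (x ∷ xs)) f                           ≡⟨ ∑-sublists-∷ f x xs ⟩
    ∑ (sublists xs) f + ∑ (sublists xs) (f ∘ (x ∷_))  ≡⟨ cong₂ _+_ (∑-sublists-[-] f f[]≡0 f∷∷≡0 xs) (∑-sublists-[] (f ∘ (x ∷_)) (f∷∷≡0 x) xs) ⟩
    ∑ xs (f ∘ [_]) + f [ x ]                          ≡⟨ +-comm (∑ xs (f ∘ [_])) (f [ x ]) ⟩
    f [ x ] + ∑ xs (f ∘ [_])                          ∎

  -- Marking an element of a family P is the same as choosing the element q and the family P ∖ q.
  ∑-pointed : ∀ (f : List A → ℕ) → (∀ {as bs} → as ↭ bs → f as ≡ f bs) → (∀ q as → f (q ∷ q ∷ as) ≡ 0) →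
    ∀ xs → ∑ xs (λ q → ∑ (sublists xs) (λ as → f (q ∷ as))) ≡ ∑ (sublists xs) (λ as → length as * f as)
  ∑-pointed f f-↭ f-dup []       = refl
  ∑-pointed f f-↭ f-dup (x ∷ xs) = begin
    ∑ Tx (f ∘ (x ∷_)) + ∑ xs (λ q → ∑ Tx (λ as → f (q ∷ as)))
      ≡⟨ cong₂ _+_ (∑-sublists-∷ (f ∘ (x ∷_)) x xs)
           (trans (∑-cong (λ q → ∑-sublists-∷ (f ∘ (q ∷_)) x xs) xs)
             (∑-+ (λ q → ∑ T (f ∘ (q ∷_))) (λ q → ∑ T (λ as → f (q ∷ x ∷ as))) xs)) ⟩
    (X + ∑ T (λ as → f (x ∷ x ∷ as))) + (∑ xs (λ q → ∑ T (f ∘ (q ∷_))) + ∑ xs (λ q → ∑ T (λ as → f (q ∷ x ∷ as))))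
      ≡⟨ cong₂ _+_ (cong (X +_) (∑-zero (f-dup x) T))
           (cong₂ _+_ (∑-pointed f f-↭ f-dup xs)
             (trans (∑-cong (λ q → ∑-cong (λ as → f-↭ (Perm.swap q x Perm.refl)) T) xs)
               (∑-pointed (f ∘ (x ∷_)) (f-↭ ∘ Perm.prep x)
                 (λ q as → trans (f-↭ (Perm.trans (Perm.swap x q Perm.refl) (Perm.prep q (Perm.swap x q Perm.refl))))
                   (f-dup q (x ∷ as))) xs))) ⟩
    (X + 0) + (∑ T (λ as → length as * f as) + ∑ T (λ as → length as * f (x ∷ as)))
      ≡⟨ lemma X (∑ T (λ as → length as * f as)) _ ⟩
    ∑ T (λ as → length as * f as) + (X + ∑ T (λ as → length as * f (x ∷ as)))
      ≡⟨ cong (∑ T (λ as → length as * f as) +_) (sym (∑-+ (f ∘ (x ∷_)) _ T)) ⟩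
    ∑ T (λ as → length as * f as) + ∑ T (λ as → suc (length as) * f (x ∷ as))
      ≡⟨ sym (∑-sublists-∷ (λ as → length as * f as) x xs) ⟩
    ∑ Tx (λ as → length as * f as) ∎
    where
    T  = sublists xs
    Tx = sublists (x ∷ xs)
    X  = ∑ T (f ∘ (x ∷_))
    lemma : ∀ a b c → (a + 0) + (b + c) ≡ b + (a + c)
    lemma = solve-∀

  indicator : ∀ {P : Set} → Dec P → ℕ
  indicator P? = if does P? then 1 else 0

  indicator-no : ∀ {P : Set} (P? : Dec P) → ¬ P → indicator P? ≡ 0
  indicator-no P? ¬p = cong (if_then 1 else 0) (dec-false P? ¬p)

  indicator-⇔ : ∀ {P Q : Set} → P ⇔ Q → (P? : Dec P) (Q? : Dec Q) → indicator P? ≡ indicator Q?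
  indicator-⇔ P⇔Q P? Q? = cong (if_then 1 else 0) (does-⇔ P⇔Q P? Q?)

  length-filter : ∀ {P : A → Set} (P? : ∀ x → Dec (P x)) xs → length (filter P? xs) ≡ ∑ xs (λ x → indicator (P? x))
  length-filter P? []       = refl
  length-filter P? (x ∷ xs) with does (P? x)
  ... | true  = cong suc (length-filter P? xs)
  ... | false = length-filter P? xs

  private variable
    n : ℕ

  -- The recurrence of the Stirling numbers, by removing the point 0

  IsPartitionInto : ℕ → List (Subset n) → Set
  IsPartitionInto k P = IsPartition P × length P ≡ k

  weight : ℕ → List (Subset n) → ℕ
  weight k P = indicator (isPartition? P ×-dec length P ≟ k)

  S-weight : ∀ n k → S n k ≡ ∑ (families n) (weight k)
  S-weight n k = length-filter (λ P → isPartition? P ×-dec length P ≟ k) (families n)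

  weight-⇔ : ∀ {m n} k l {P : List (Subset m)} {Q : List (Subset n)} →
    IsPartitionInto k P ⇔ IsPartitionInto l Q → weight k P ≡ weight l Q
  weight-⇔ k l {P} {Q} P⇔Q = indicator-⇔ P⇔Q (isPartition? P ×-dec length P ≟ k) (isPartition? Q ×-dec length Q ≟ l)

  weight-no : ∀ k (P : List (Subset n)) → ¬ IsPartition P → weight k P ≡ 0
  weight-no k P ¬p = indicator-no (isPartition? P ×-dec length P ≟ k) (¬p ∘ proj₁)

  Disjoint-sym : ∀ {p q : Subset n} → Disjoint p q → Disjoint q p
  Disjoint-sym {p = p} {q} = subst Empty (∩-comm p q)

  IsPartition-↭ : ∀ {P Q : List (Subset n)} → P ↭ Q → IsPartition P → IsPartition Q
  IsPartition-↭ P↭Q (nonempty , disjoint , covers) =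
    All-resp-↭ P↭Q nonempty ,
    AllPairs-resp-↭ (setoid _) Disjoint-sym ((λ { refl d → d }) , λ { refl d → d }) (↭⇒↭ₛ P↭Q) disjoint ,
    λ i → Any-resp-↭ P↭Q (covers i)

  weight-↭ : ∀ k {P Q : List (Subset n)} → P ↭ Q → weight k P ≡ weight k Q
  weight-↭ k P↭Q = weight-⇔ k k (mk⇔
    (λ (p , l) → IsPartition-↭ P↭Q p , trans (sym (↭-length P↭Q)) l)
    (λ (p , l) → IsPartition-↭ (↭-sym P↭Q) p , trans (↭-length P↭Q) l))

  -- A nonempty block is not disjoint from itself. This is the vanishing condition that `∑-pointed`
  -- asks for.
  weight-dup : ∀ k (q : Subset n) P → weight k (q ∷ q ∷ P) ≡ 0
  weight-dup k q P = weight-no k (q ∷ q ∷ P) λ where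
    ((i , i∈q) ∷ _ , (q∩q=∅ ∷ _) ∷ _ , _) → q∩q=∅ (i , x∈p∩q⁺ (i∈q , i∈q))

  weight-suc-[] : ∀ k {P : List (Subset n)} → weight (suc k) (map (false Vec.∷_) P ++ []) ≡ 0
  weight-suc-[] k {P} = weight-no (suc k) (map (false Vec.∷_) P ++ []) λ (_ , _ , covers) → absurd P (covers Fin.zero)
    where
    absurd : ∀ P → ¬ Any (Fin.zero {n = n} ∈_) (map (false Vec.∷_) P ++ [])
    absurd (_ ∷ P) (there a) = absurd P a

  -- The two blocks share the point 0.
  weight-two : ∀ k {P : List (Subset n)} p q Q →
    weight k (map (false Vec.∷_) P ++ (true Vec.∷ p) ∷ (true Vec.∷ q) ∷ Q) ≡ 0
  weight-two k {P} p q Q = weight-no k _ λ (_ , disjoint , _) → absurd P disjoint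
    where
    absurd : ∀ P → ¬ AllPairs Disjoint (map (false Vec.∷_) P ++ (true Vec.∷ p) ∷ (true Vec.∷ q) ∷ Q)
    absurd []      ((d ∷ _) ∷ _) = d (_ , here)
    absurd (_ ∷ P) (_ ∷ ds)      = absurd P ds

  -- q, possibly empty, is what remains of the block of 0 when 0 is removed.
  IsPartitionWith : Subset n → List (Subset n) → Set
  IsPartitionWith q P = All Nonempty P × AllPairs Disjoint (q ∷ P) × (∀ i → Any (i ∈_) (q ∷ P))

  extend-⇔ : ∀ {q : Subset n} {P} →
    IsPartition ((true Vec.∷ q) ∷ map (false Vec.∷_) P) ⇔ IsPartitionWith q P
  extend-⇔ {n} {q} {P} = mk⇔
    (λ { (_ ∷ nonempty , d ∷ disjoint , covers) →
      All.map shrink-nonempty (All.map⁻ nonempty) ,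
      All.map (shrink-disjoint true) (All.map⁻ d) ∷ AllPairs.map (shrink-disjoint false) (AllPairs.map⁻ disjoint) ,
      λ i → shrink-cover (covers (Fin.suc i)) })
    (λ { (nonempty , d ∷ disjoint , covers) →
      (_ , here) ∷ All.map⁺ (All.map (λ (i , i∈p) → Fin.suc i , there i∈p) nonempty) ,
      All.map⁺ (All.map (extend-disjoint true) d) ∷ AllPairs.map⁺ (AllPairs.map (extend-disjoint false) disjoint) ,
      λ { Fin.zero → here here ; (Fin.suc i) → extend-cover (covers i) } })
    where
    shrink-nonempty : ∀ {p : Subset n} → Nonempty (false Vec.∷ p) → Nonempty p
    shrink-nonempty (Fin.suc i , there i∈p) = i , i∈p
    shrink-disjoint : ∀ s {p p′ : Subset n} → Disjoint (s Vec.∷ p) (false Vec.∷ p′) → Disjoint p p′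
    shrink-disjoint _ d (i , i∈) = d (Fin.suc i , there i∈)
    extend-disjoint : ∀ s {p p′ : Subset n} → Disjoint p p′ → Disjoint (s Vec.∷ p) (false Vec.∷ p′)
    extend-disjoint false d (Fin.suc i , there i∈) = d (i , i∈)
    extend-disjoint true  d (Fin.suc i , there i∈) = d (i , i∈)
    shrink-cover : ∀ {i} → Any (Fin.suc i ∈_) ((true Vec.∷ q) ∷ map (false Vec.∷_) P) → Any (i ∈_) (q ∷ P)
    shrink-cover (here i∈)  = here (drop-there i∈)
    shrink-cover (there i∈) = there (Any.map drop-there (Any.map⁻ i∈))
    extend-cover : ∀ {i} → Any (i ∈_) (q ∷ P) → Any (Fin.suc i ∈_) ((true Vec.∷ q) ∷ map (false Vec.∷_) P)
    extend-cover (here i∈)  = here (there i∈)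
    extend-cover (there i∈) = there (Any.map⁺ (Any.map there i∈))

  -- If q is empty, 0 was a singleton block and P splits the other points into k blocks, while q ∷ P
  -- has an empty member and weight 0. If q is nonempty, it joins P as one of `suc k` blocks. These
  -- cases become the two terms of the recurrence.
  weight-extend : ∀ k (q : Subset n) P →
    weight (suc k) (map (false Vec.∷_) P ++ [ true Vec.∷ q ]) ≡
    indicator (¬? (nonempty? q)) * weight k P + weight (suc k) (q ∷ P)
  weight-extend k q P =
    trans (weight-↭ (suc k) (↭-sym (∷↭∷ʳ (true Vec.∷ q) (map (false Vec.∷_) P)))) (lemma (nonempty? q))
    where
    len : ∀ {b} → suc (length (map (b Vec.∷_) P)) ≡ suc (length P)
    len {b} = cong suc (List.length-map (b Vec.∷_) P)
    lemma : (q? : Dec (Nonempty q)) → weight (suc k) ((true Vec.∷ q) ∷ map (false Vec.∷_) P) ≡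
      indicator (¬? q?) * weight k P + weight (suc k) (q ∷ P)
    lemma (yes ne) = weight-⇔ (suc k) (suc k) (mk⇔
      (λ (p , l) → let (a , b , c) = Equivalence.to extend-⇔ p in (ne ∷ a , b , c) , trans (sym len) l)
      (λ { ((_ ∷ a , b , c) , l) → Equivalence.from extend-⇔ (a , b , c) , trans len l }))
    lemma (no empty) = begin
      weight (suc k) ((true Vec.∷ q) ∷ map (false Vec.∷_) P)
        ≡⟨ weight-⇔ (suc k) k (mk⇔
             (λ (p , l) → let (a , b , c) = Equivalence.to extend-⇔ p in
               (a , AllPairs.tail b , λ i → Any.tail (λ i∈q → empty (i , i∈q)) (c i)) , suc-injective (trans (sym len) l))
             (λ ((a , b , c) , l) → Equivalence.from extend-⇔
               (a , All.universal (λ p (i , i∈) → empty (i , proj₁ (x∈p∩q⁻ q p i∈))) P ∷ b , λ i → there (c i)) ,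
               trans len (cong suc l))) ⟩
      weight k P
        ≡⟨ sym (trans (cong₂ _+_ (+-identityʳ (weight k P)) (weight-no (suc k) (q ∷ P) λ { (ne ∷ _ , _) → empty ne })) (+-identityʳ (weight k P))) ⟩
      1 * weight k P + weight (suc k) (q ∷ P) ∎
      where open import Data.Fin.Subset.Properties using (x∈p∩q⁻)

  ∑-empty : ∀ n → ∑ (subsets n) (λ q → indicator (¬? (nonempty? q))) ≡ 1
  ∑-empty zero    = refl
  ∑-empty (suc n) = begin
    ∑ (subsets (suc n)) empty
      ≡⟨ ∑-++ empty (map (false Vec.∷_) (subsets n)) _ ⟩
    ∑ (map (false Vec.∷_) (subsets n)) empty + ∑ (map (true Vec.∷_) (subsets n)) empty
      ≡⟨ cong₂ _+_ (∑-map (false Vec.∷_) empty (subsets n)) (∑-map (true Vec.∷_) empty (subsets n)) ⟩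
    ∑ (subsets n) (empty ∘ (false Vec.∷_)) + ∑ (subsets n) (empty ∘ (true Vec.∷_))
      ≡⟨ cong₂ _+_
           (trans (∑-cong (λ q → indicator-⇔ (mk⇔ (λ e (i , i∈) → e (Fin.suc i , there i∈))
                (λ { e (Fin.suc i , there i∈) → e (i , i∈) })) (¬? (nonempty? (false Vec.∷ q))) (¬? (nonempty? q))) (subsets n)) (∑-empty n))
           (∑-zero (λ q → indicator-no (¬? (nonempty? (true Vec.∷ q))) (λ e → e (_ , here))) (subsets n)) ⟩
    1 ∎
    where
    empty : ∀ {n} → Subset n → ℕ
    empty q = indicator (¬? (nonempty? q))

  S-zero-suc : ∀ k → S 0 (suc k) ≡ 0
  S-zero-suc k = refl

  S-suc-zero : ∀ n → S (suc n) 0 ≡ 0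
  S-suc-zero n = trans (S-weight (suc n) 0) (∑-zero absurd (families (suc n)))
    where
    absurd : ∀ P → weight 0 P ≡ 0
    absurd P = indicator-no (isPartition? P ×-dec length P ≟ 0) (λ { ((_ , _ , covers) , l) → lemma P l (covers Fin.zero) })
      where
      lemma : ∀ P → length P ≡ 0 → ¬ Any (Fin.zero {n} ∈_) P
      lemma [] _ ()

  -- Group families by the blocks avoiding 0 and the remainder q of the block of 0. Empty q
  -- contributes S n k. Nonempty q is a marked block of a partition of the other points, and by
  -- `∑-pointed` each partition into `suc k` blocks is counted `suc k` times.
  S-suc-suc : ∀ n k → S (suc n) (suc k) ≡ suc k * S n (suc k) + S n k
  S-suc-suc n k = begin
    S (suc n) (suc k)
      ≡⟨ S-weight (suc n) (suc k) ⟩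
    ∑ (sublists (map (false Vec.∷_) X ++ map (true Vec.∷_) X)) w
      ≡⟨ ∑-sublists-++ w (map (false Vec.∷_) X) (map (true Vec.∷_) X) ⟩
    ∑ (sublists (map (false Vec.∷_) X)) (λ as → ∑ (sublists (map (true Vec.∷_) X)) (λ bs → w (as ++ bs)))
      ≡⟨ cong (λ l → ∑ l (λ as → ∑ (sublists (map (true Vec.∷_) X)) (λ bs → w (as ++ bs)))) (sublists-map (false Vec.∷_) X) ⟩
    ∑ (map (map (false Vec.∷_)) (families n)) (λ as → ∑ (sublists (map (true Vec.∷_) X)) (λ bs → w (as ++ bs)))
      ≡⟨ ∑-map (map (false Vec.∷_)) _ (families n) ⟩
    ∑ (families n) (λ P → ∑ (sublists (map (true Vec.∷_) X)) (λ bs → w (map (false Vec.∷_) P ++ bs)))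
      ≡⟨ ∑-cong inner (families n) ⟩
    ∑ (families n) (λ P → ∑ X (λ q → empty q * weight k P + w (q ∷ P)))
      ≡⟨ ∑-cong (λ P → trans (∑-+ (λ q → empty q * weight k P) (λ q → w (q ∷ P)) X)
           (cong (_+ ∑ X (λ q → w (q ∷ P))) (empties P))) (families n) ⟩
    ∑ (families n) (λ P → weight k P + ∑ X (λ q → w (q ∷ P)))
      ≡⟨ ∑-+ (weight k) (λ P → ∑ X (λ q → w (q ∷ P))) (families n) ⟩
    ∑ (families n) (weight k) + ∑ (families n) (λ P → ∑ X (λ q → w (q ∷ P)))
      ≡⟨ cong₂ _+_ (sym (S-weight n k)) (trans (∑-swap (λ P q → w (q ∷ P)) (families n) X)
           (trans (∑-pointed w (weight-↭ (suc k)) (weight-dup (suc k)) X)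
             (trans (∑-cong count (families n)) (trans (∑-*ʳ w (suc k) (families n)) (cong (suc k *_) (sym (S-weight n (suc k)))))))) ⟩
    S n k + suc k * S n (suc k)
      ≡⟨ +-comm (S n k) _ ⟩
    suc k * S n (suc k) + S n k ∎
    where
    X = subsets n
    w : ∀ {n} → List (Subset n) → ℕ
    w = weight (suc k)
    empty : Subset n → ℕ
    empty q = indicator (¬? (nonempty? q))
    inner : ∀ P → ∑ (sublists (map (true Vec.∷_) X)) (λ bs → w (map (false Vec.∷_) P ++ bs)) ≡
      ∑ X (λ q → empty q * weight k P + w (q ∷ P))
    inner P = begin
      ∑ (sublists (map (true Vec.∷_) X)) f                   ≡⟨ cong (λ l → ∑ l f) (sublists-map (true Vec.∷_) X) ⟩
      ∑ (map (map (true Vec.∷_)) (sublists X)) f             ≡⟨ ∑-map (map (true Vec.∷_)) f (sublists X) ⟩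
      ∑ (sublists X) (f ∘ map (true Vec.∷_))                 ≡⟨ ∑-sublists-[-] (f ∘ map (true Vec.∷_)) (weight-suc-[] k {P})
                                                                  (λ p q Q → weight-two (suc k) {P} p q (map (true Vec.∷_) Q)) X ⟩
      ∑ X (λ q → w (map (false Vec.∷_) P ++ [ true Vec.∷ q ])) ≡⟨ ∑-cong (λ q → weight-extend k q P) X ⟩
      ∑ X (λ q → empty q * weight k P + w (q ∷ P))           ∎
      where
      f : List (Subset (suc n)) → ℕ
      f bs = w (map (false Vec.∷_) P ++ bs)
    empties : ∀ P → ∑ X (λ q → empty q * weight k P) ≡ weight k P
    empties P = begin
      ∑ X (λ q → empty q * weight k P)  ≡⟨ ∑-cong (λ q → *-comm (empty q) (weight k P)) X ⟩
      ∑ X (λ q → weight k P * empty q)  ≡⟨ ∑-*ʳ empty (weight k P) X ⟩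
      weight k P * ∑ X empty            ≡⟨ cong (weight k P *_) (∑-empty n) ⟩
      weight k P * 1                    ≡⟨ *-identityʳ (weight k P) ⟩
      weight k P                        ∎
      where open import Data.Nat.Properties using (*-comm)
    count : ∀ P → length P * w P ≡ suc k * w P
    count P = lemma (isPartition? P ×-dec length P ≟ suc k)
      where
      lemma : (P? : Dec (IsPartitionInto (suc k) P)) → length P * indicator P? ≡ suc k * indicator P?
      lemma (yes (_ , l)) = cong (_* 1) l
      lemma (no _)        = trans (*-zeroʳ (length P)) (sym (*-zeroʳ (suc k)))

-- Falling factorials and finite sums of integers

module FallingFactorial where
  open import Data.Integer.Base using (ℤ; +_; 0ℤ; _+_; _*_; _≤_; _<_)
  open import Data.Integer.Properties
  open import Data.Integer.Tactic.RingSolver using (solve-∀)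
  open import Data.Nat.Base using (_∸_)
  open import Relation.Nullary.Decidable using (yes; no)

  -- Stands for j ! / (j - k)!, with the value 0 for k > j, so that sums over k may run up to any r
  -- ≥ j.
  _↓_ : ℕ → ℕ → ℕ
  j     ↓ zero  = 1
  zero  ↓ suc k = 0
  suc j ↓ suc k = suc j ℕ.* (j ↓ k)

  ↓-suc : ∀ i k → (i ℕ.+ k) ↓ suc k ≡ i ℕ.* ((i ℕ.+ k) ↓ k)
  ↓-suc zero    zero    = refl
  ↓-suc (suc i) zero    = cong (λ m → suc m ℕ.* 1) (ℕ.+-identityʳ i)
  ↓-suc i       (suc k) rewrite ℕ.+-suc i k = begin
    suc (i ℕ.+ k) ℕ.* ((i ℕ.+ k) ↓ suc k)          ≡⟨ cong (suc (i ℕ.+ k) ℕ.*_) (↓-suc i k) ⟩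
    suc (i ℕ.+ k) ℕ.* (i ℕ.* ((i ℕ.+ k) ↓ k))      ≡⟨ lemma (suc (i ℕ.+ k)) i _ ⟩
    i ℕ.* (suc (i ℕ.+ k) ℕ.* ((i ℕ.+ k) ↓ k))      ∎
    where
    open ≡-Reasoning
    lemma : ∀ m i p → m ℕ.* (i ℕ.* p) ≡ i ℕ.* (m ℕ.* p)
    lemma m i p = trans (sym (ℕ.*-assoc m i p)) (trans (cong (ℕ._* p) (ℕ.*-comm m i)) (ℕ.*-assoc i m p))

  ↓-zero : ∀ {j k} → j ℕ.< k → j ↓ k ≡ 0
  ↓-zero {zero}  {suc k} _            = refl
  ↓-zero {suc j} {suc k} (ℕ.s≤s j<k) = trans (cong (suc j ℕ.*_) (↓-zero j<k)) (ℕ.*-zeroʳ (suc j))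

  ↓-+ : ∀ r l k → r ↓ (l ℕ.+ k) ≡ (r ↓ l) ℕ.* ((r ∸ l) ↓ k)
  ↓-+ r       zero    k = sym (ℕ.+-identityʳ (r ↓ k))
  ↓-+ zero    (suc l) k = refl
  ↓-+ (suc r) (suc l) k = trans (cong (suc r ℕ.*_) (↓-+ r l k)) (sym (ℕ.*-assoc (suc r) (r ↓ l) _))

  -- Write j = (j - k) + k; for k > j both sides vanish. This turns multiplication by j into the
  -- recurrence of the Stirling numbers.
  j*↓ : ∀ j k → j ℕ.* (j ↓ k) ≡ (j ↓ suc k) ℕ.+ k ℕ.* (j ↓ k)
  j*↓ j k with k ℕ.≤? j
  ... | no k≰j rewrite ↓-zero (ℕ.≰⇒> k≰j) | ↓-zero (ℕ.m≤n⇒m≤1+n (ℕ.≰⇒> k≰j)) = trans (ℕ.*-zeroʳ j) (sym (ℕ.*-zeroʳ k))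
  ... | yes k≤j with j ∸ k | ℕ.m∸n+n≡m k≤j
  ...   | i | refl = trans (ℕ.*-distribʳ-+ ((i ℕ.+ k) ↓ k) i k) (cong (ℕ._+ k ℕ.* ((i ℕ.+ k) ↓ k)) (sym (↓-suc i k)))

  ∑≤ : ℕ → (ℕ → ℤ) → ℤ
  ∑≤ zero    f = f 0
  ∑≤ (suc r) f = ∑≤ r f + f (suc r)

  ∑≤-cong : ∀ {f g} → (∀ k → f k ≡ g k) → ∀ r → ∑≤ r f ≡ ∑≤ r g
  ∑≤-cong f≗g zero    = f≗g 0
  ∑≤-cong f≗g (suc r) = cong₂ _+_ (∑≤-cong f≗g r) (f≗g (suc r))

  ∑≤-+ : ∀ f g r → ∑≤ r (λ k → f k + g k) ≡ ∑≤ r f + ∑≤ r g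
  ∑≤-+ f g zero    = refl
  ∑≤-+ f g (suc r) = trans (cong (_+ (f (suc r) + g (suc r))) (∑≤-+ f g r)) (lemma (∑≤ r f) (∑≤ r g) (f (suc r)) (g (suc r)))
    where
    lemma : ∀ a b c d → a + b + (c + d) ≡ a + c + (b + d)
    lemma = solve-∀

  ∑≤-* : ∀ c f r → ∑≤ r (λ k → c * f k) ≡ c * ∑≤ r f
  ∑≤-* c f zero    = refl
  ∑≤-* c f (suc r) = trans (cong (_+ c * f (suc r)) (∑≤-* c f r)) (sym (*-distribˡ-+ c (∑≤ r f) (f (suc r))))

  ∑≤-mono : ∀ {f g} r → (∀ {k} → k ℕ.≤ r → f k ≤ g k) → ∑≤ r f ≤ ∑≤ r g
  ∑≤-mono zero    f≤g = f≤g ℕ.z≤n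
  ∑≤-mono (suc r) f≤g = +-mono-≤ (∑≤-mono r (λ k≤r → f≤g (ℕ.m≤n⇒m≤1+n k≤r))) (f≤g ℕ.≤-refl)

  ∑≤-zero : ∀ r → ∑≤ r (λ _ → 0ℤ) ≡ 0ℤ
  ∑≤-zero zero    = refl
  ∑≤-zero (suc r) = trans (+-identityʳ (∑≤ r (λ _ → 0ℤ))) (∑≤-zero r)

  prev : (ℕ → ℤ) → ℕ → ℤ
  prev f zero    = 0ℤ
  prev f (suc k) = f k

  -- Reindexing leaves the single boundary term f r * g (suc r), which the hypothesis annuls; for
  -- falling factorials it contains j ↓ suc r with j ≤ r.
  ∑≤-shift : ∀ (f g : ℕ → ℤ) r → g (suc r) ≡ 0ℤ → ∑≤ r (λ k → f k * g (suc k)) ≡ ∑≤ r (λ k → prev f k * g k)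
  ∑≤-shift f g r g≡0 = trans (lemma r) (trans (cong (λ x → ∑≤ r (λ k → prev f k * g k) + f r * x) g≡0)
    (trans (cong (_+_ (∑≤ r (λ k → prev f k * g k))) (*-zeroʳ (f r))) (+-identityʳ _)))
    where
    lemma : ∀ r → ∑≤ r (λ k → f k * g (suc k)) ≡ ∑≤ r (λ k → prev f k * g k) + f r * g (suc r)
    lemma zero    = sym (trans (cong (_+ f 0 * g 1) (*-zeroˡ (g 0))) (+-identityˡ _))
    lemma (suc r) = cong (_+ f (suc r) * g (suc (suc r))) (lemma r)

-- Rational estimates for the successive ratios of kⁿ / k !

module Rationals where
  open import Algebra.Bundles using (CommutativeRing)
  open import Data.Integer.Base using (+_)
  open import Data.Rational.Base using (ℚ; 0ℚ; 1ℚ; _+_; _*_; _-_; -_; _≤_; _<_; _/_; positive; nonNegative; *≤*)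
  open import Data.Rational.Properties
  open import Algebra.Properties.CommutativeSemiring.Exp (CommutativeRing.commutativeSemiring +-*-commutativeRing) using (_^_; ^-distrib-*)
  open import Data.Rational.Solver using (module +-*-Solver)
  open import Data.Sum.Base using (inj₁; inj₂)
  open import Relation.Nullary.Decidable using (from-yes)
  open +-*-Solver using (solve; con; _:+_; _:*_; _:-_; :-_; _:=_)

  +-nonNeg : ∀ {p q} → 0ℚ ≤ p → 0ℚ ≤ q → 0ℚ ≤ p + q
  +-nonNeg {p} {q} 0≤p 0≤q = ≤-trans 0≤p (≤-step 0≤q)

  ≤⇒0≤- : ∀ {p q} → p ≤ q → 0ℚ ≤ q - p
  ≤⇒0≤- {p} {q} p≤q = subst (_≤ q - p) (+-inverseʳ p) (+-monoˡ-≤ (- p) p≤q)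

  <⇒0<- : ∀ {p q} → p < q → 0ℚ < q - p
  <⇒0<- {p} {q} p<q = subst (_< q - p) (+-inverseʳ p) (+-monoˡ-< (- p) p<q)

  ≤-excess : ∀ {p q r} → 0ℚ ≤ r → q ≡ p + r → p ≤ q
  ≤-excess {p} 0≤r q≡p+r = subst (p ≤_) (sym q≡p+r) (≤-step 0≤r)

  -- For b = a v and d = c u this is 6 − 12 a + 9 a b − 4 a b c + a b c d; the coefficients are those of
  -- (1 − t) (6 − 6 t + 3 t² − t³).  It is positive because it equals
  -- 6 (1 − a)² + a² (v ((3 − c) (1 − c) − c² (1 − u)) − 6 (1 − v)), where the last factor decreases in c.
  quartic : ℚ → ℚ → ℚ → ℚ → ℚ
  quartic a v c u = (+ 6 / 1) - (+ 12 / 1) * a + (+ 9 / 1) * (a * (a * v)) - (+ 4 / 1) * (a * (a * v) * c) + a * (a * v) * c * (c * u)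

  -- As 1 - c is at least about 4x, the last factor is to first order at least 2 · 4x - (11/10) x -
  -- 6 · (21/20) x = (6/10) x. The two constants are allowances over the ideal value 1, for which it
  -- would be x.
  quartic-positive : ∀ {a v c u x} → 0ℚ < x → x ≤ 1ℚ → 0ℚ ≤ a → 0ℚ ≤ v → 0ℚ ≤ c → 0ℚ ≤ u → u ≤ 1ℚ →
    a ≤ (1ℚ - x) * (1ℚ - x) → c ≤ ((1ℚ - x) * (1ℚ - x)) * ((1ℚ - x) * (1ℚ - x)) →
    1ℚ - v ≤ (+ 21 / 20) * x → 1ℚ - u ≤ (+ 11 / 10) * x → 0ℚ < quartic a v c u
  quartic-positive {a} {v} {c} {u} {x} 0<x x≤1 0≤a 0≤v 0≤c 0≤u u≤1 a≤ c≤ v≥ u≥ with ≤-total (+ 3 / 10) x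
  -- First-order estimates are useless here, but a ≤ 49/100 < 1/2 already makes 6 - 12 a positive,
  -- and the remaining terms have a nonnegative sum as c ≤ 1.
  ... | inj₁ 3/10≤x = subst (0ℚ <_)
      (solve 4 (λ a v c u → (con (+ 6 / 1) :- con (+ 12 / 1) :* a) :+ a :* (a :* v) :* ((con (+ 5 / 1) :+ con (+ 4 / 1) :* (con 1ℚ :- c)) :+ c :* (c :* u)) :=
        con (+ 6 / 1) :- con (+ 12 / 1) :* a :+ con (+ 9 / 1) :* (a :* (a :* v)) :- con (+ 4 / 1) :* (a :* (a :* v) :* c) :+ a :* (a :* v) :* c :* (c :* u)) refl a v c u)
      (<-≤-trans 0<6-12a (≤-step (0≤· (0≤· 0≤a (0≤· 0≤a 0≤v))
        (+-nonNeg (+-nonNeg (nonNegative⁻¹ (+ 5 / 1)) (0≤· (nonNegative⁻¹ (+ 4 / 1)) (≤⇒0≤- c≤1))) (0≤· 0≤c (0≤· 0≤c 0≤u))))))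
    where
    0≤1-x = ≤⇒0≤- x≤1
    1-x≤ : ∀ {y} → y ≤ x → 1ℚ - x ≤ 1ℚ - y
    1-x≤ y≤x = +-monoʳ-≤ 1ℚ (neg-antimono-≤ y≤x)
    a≤49/100 : a ≤ (1ℚ - (+ 3 / 10)) * (1ℚ - (+ 3 / 10))
    a≤49/100 = ≤-trans a≤ (·-mono-≤ 0≤1-x (1-x≤ 3/10≤x) 0≤1-x (1-x≤ 3/10≤x))
    0<6-12a : 0ℚ < (+ 6 / 1) - (+ 12 / 1) * a
    0<6-12a = <-≤-trans (from-yes (0ℚ <? (+ 6 / 1) - (+ 12 / 1) * ((1ℚ - (+ 3 / 10)) * (1ℚ - (+ 3 / 10)))))
      (+-monoʳ-≤ (+ 6 / 1) (neg-antimono-≤ (*-monoˡ-≤-nonNeg (+ 12 / 1) a≤49/100)))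
    sq≤1 : (1ℚ - x) * (1ℚ - x) ≤ 1ℚ
    sq≤1 = ·-mono-≤ 0≤1-x (1-x≤ (<⇒≤ 0<x)) 0≤1-x (1-x≤ (<⇒≤ 0<x))
    c≤1 : c ≤ 1ℚ
    c≤1 = ≤-trans c≤ (·-mono-≤ (0≤· 0≤1-x 0≤1-x) sq≤1 (0≤· 0≤1-x 0≤1-x) sq≤1)
  ... | inj₂ x≤3/10 = subst (0ℚ <_)
      (solve 4 (λ a v c u → con (+ 6 / 1) :* ((con 1ℚ :- a) :* (con 1ℚ :- a)) :+ a :* a :* (v :* ((con (+ 3 / 1) :- c) :* (con 1ℚ :- c) :- c :* c :* (con 1ℚ :- u)) :- con (+ 6 / 1) :* (con 1ℚ :- v)) :=
        con (+ 6 / 1) :- con (+ 12 / 1) :* a :+ con (+ 9 / 1) :* (a :* (a :* v)) :- con (+ 4 / 1) :* (a :* (a :* v) :* c) :+ a :* (a :* v) :* c :* (c :* u)) refl a v c u)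
      0<F
    where
    -- Lower bounds in x alone: z ≤ B, where z = 2 (4x - 6x²) - (11/10) x; h ≤ H; and w = 1 - (1 -
    -- x)² ≤ 1 - a.
    B H h z w : ℚ
    B = ((+ 3 / 1) - c) * (1ℚ - c) - c * c * (1ℚ - u)
    H = v * B - (+ 6 / 1) * (1ℚ - v)
    z = (+ 69 / 10) * x - (+ 12 / 1) * (x * x)
    h = (1ℚ - (+ 21 / 20) * x) * z - (+ 63 / 10) * x
    w = (+ 2 / 1) * x - x * x
    0≤x = <⇒≤ 0<x
    0≤1-x = ≤⇒0≤- x≤1
    C≥ : (+ 4 / 1) * x - (+ 6 / 1) * (x * x) ≤ 1ℚ - c
    C≥ = ≤-trans (≤-excess {r = (x * x * x) * ((+ 3 / 1) + (1ℚ - x))} (0≤· (0≤· (0≤· 0≤x 0≤x) 0≤x) (+-nonNeg (nonNegative⁻¹ (+ 3 / 1)) 0≤1-x))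
      (solve 1 (λ x → con 1ℚ :- ((con 1ℚ :- x) :* (con 1ℚ :- x)) :* ((con 1ℚ :- x) :* (con 1ℚ :- x)) :=
        (con (+ 4 / 1) :* x :- con (+ 6 / 1) :* (x :* x)) :+ (x :* x :* x) :* (con (+ 3 / 1) :+ (con 1ℚ :- x))) refl x))
      (+-monoʳ-≤ 1ℚ (neg-antimono-≤ c≤))
    0≤C : 0ℚ ≤ 1ℚ - c
    0≤C = ≤-trans (subst (0ℚ ≤_) (solve 1 (λ x → x :* (con (+ 6 / 1) :* (con (+ 3 / 10) :- x) :+ con (+ 22 / 10)) := con (+ 4 / 1) :* x :- con (+ 6 / 1) :* (x :* x)) refl x)
      (0≤· 0≤x (+-nonNeg (0≤· (nonNegative⁻¹ (+ 6 / 1)) (≤⇒0≤- x≤3/10)) (nonNegative⁻¹ (+ 22 / 10))))) C≥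
    0≤1-u : 0ℚ ≤ 1ℚ - u
    0≤1-u = ≤⇒0≤- u≤1
    c≤1 : c ≤ 1ℚ
    c≤1 = ≤-excess 0≤C (solve 1 (λ c → con 1ℚ := c :+ (con 1ℚ :- c)) refl c)
    0≤z : 0ℚ ≤ z
    0≤z = subst (0ℚ ≤_) (solve 1 (λ x → x :* (con (+ 12 / 1) :* (con (+ 3 / 10) :- x) :+ con (+ 33 / 10)) := con (+ 69 / 10) :* x :- con (+ 12 / 1) :* (x :* x)) refl x)
      (0≤· 0≤x (+-nonNeg (0≤· (nonNegative⁻¹ (+ 12 / 1)) (≤⇒0≤- x≤3/10)) (nonNegative⁻¹ (+ 33 / 10))))
    z≤B : z ≤ B
    z≤B = ≤-excess {r = ((+ 2 / 1) * (1ℚ - c - y) + (1ℚ - c) * (1ℚ - c)) + (((+ 11 / 10) * x - (1ℚ - u)) + (1ℚ - u) * (1ℚ - c * c))}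
      (+-nonNeg (+-nonNeg (0≤· (nonNegative⁻¹ (+ 2 / 1)) (≤⇒0≤- C≥)) (0≤· 0≤C 0≤C))
        (+-nonNeg (≤⇒0≤- u≥) (0≤· 0≤1-u (≤⇒0≤- (·-mono-≤ 0≤c c≤1 0≤c c≤1)))))
      (solve 3 (λ c u x → (con (+ 3 / 1) :- c) :* (con 1ℚ :- c) :- c :* c :* (con 1ℚ :- u) :=
        (con (+ 69 / 10) :* x :- con (+ 12 / 1) :* (x :* x)) :+ ((con (+ 2 / 1) :* (con 1ℚ :- c :- (con (+ 4 / 1) :* x :- con (+ 6 / 1) :* (x :* x))) :+ (con 1ℚ :- c) :* (con 1ℚ :- c)) :+
          ((con (+ 11 / 10) :* x :- (con 1ℚ :- u)) :+ (con 1ℚ :- u) :* (con 1ℚ :- c :* c)))) refl c u x)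
      where
      y : ℚ
      y = (+ 4 / 1) * x - (+ 6 / 1) * (x * x)
    v≥′ : 1ℚ - (+ 21 / 20) * x ≤ v
    v≥′ = ≤-excess (≤⇒0≤- v≥) (solve 2 (λ v x → v := con 1ℚ :- con (+ 21 / 20) :* x :+ (con (+ 21 / 20) :* x :- (con 1ℚ :- v))) refl v x)
    0≤v′ : 0ℚ ≤ 1ℚ - (+ 21 / 20) * x
    0≤v′ = subst (0ℚ ≤_) (solve 1 (λ x → con (+ 21 / 20) :* (con (+ 3 / 10) :- x) :+ con (+ 137 / 200) := con 1ℚ :- con (+ 21 / 20) :* x) refl x)
      (+-nonNeg (0≤· (nonNegative⁻¹ (+ 21 / 20)) (≤⇒0≤- x≤3/10)) (nonNegative⁻¹ (+ 137 / 200)))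
    h≤H : h ≤ H
    h≤H = +-mono-≤ (·-mono-≤ 0≤v′ v≥′ 0≤z z≤B) (neg-antimono-≤
      (≤-trans (*-monoˡ-≤-nonNeg (+ 6 / 1) v≥) (≤-reflexive (solve 1 (λ x → con (+ 6 / 1) :* (con (+ 21 / 20) :* x) := con (+ 63 / 10) :* x) refl x))))
    w≤1-a : w ≤ 1ℚ - a
    w≤1-a = ≤-trans (≤-reflexive (solve 1 (λ x → con (+ 2 / 1) :* x :- x :* x := con 1ℚ :- (con 1ℚ :- x) :* (con 1ℚ :- x)) refl x)) (+-monoʳ-≤ 1ℚ (neg-antimono-≤ a≤))
    0<w : 0ℚ < w
    0<w = subst (0ℚ <_) (solve 1 (λ x → x :* (con 1ℚ :+ (con 1ℚ :- x)) := con (+ 2 / 1) :* x :- x :* x) refl x)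
      (0<· 0<x (<-≤-trans (positive⁻¹ 1ℚ) (≤-step 0≤1-x)))
    a≤1 : a ≤ 1ℚ
    a≤1 = ≤-excess (≤-trans (<⇒≤ 0<w) w≤1-a) (solve 1 (λ c → con 1ℚ := c :+ (con 1ℚ :- c)) refl a)
    6w²≤ : (+ 6 / 1) * (w * w) ≤ (+ 6 / 1) * ((1ℚ - a) * (1ℚ - a))
    6w²≤ = *-monoˡ-≤-nonNeg (+ 6 / 1) (·-mono-≤ (<⇒≤ 0<w) w≤1-a (<⇒≤ 0<w) w≤1-a)
    0<F : 0ℚ < (+ 6 / 1) * ((1ℚ - a) * (1ℚ - a)) + a * a * H
    0<F with ≤-total 0ℚ h
    ... | inj₁ 0≤h = <-≤-trans (<-≤-trans (0<· (positive⁻¹ (+ 6 / 1)) (0<· 0<w 0<w)) 6w²≤)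
      (≤-step (0≤· (0≤· 0≤a 0≤a) (≤-trans 0≤h h≤H)))
    -- As a² ≤ 1 and h ≤ 0, a² H ≥ a² h ≥ h. In 6 w² + h the linear coefficient is 69/10 - 63/10 =
    -- 6/10, and the rest is nonnegative for x ≤ 3/10.
    ... | inj₂ h≤0 = <-≤-trans (subst (0ℚ <_)
        (solve 1 (λ x → x :* (con (+ 6 / 10) :+ (x :* (con (+ 114 / 10) :* (con (+ 3 / 10) :- x) :+ con (+ 1335 / 1000)) :+ con (+ 6 / 1) :* (x :* (x :* x)))) :=
          con (+ 6 / 1) :* ((con (+ 2 / 1) :* x :- x :* x) :* (con (+ 2 / 1) :* x :- x :* x)) :+
          ((con 1ℚ :- con (+ 21 / 20) :* x) :* (con (+ 69 / 10) :* x :- con (+ 12 / 1) :* (x :* x)) :- con (+ 63 / 10) :* x)) refl x)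
        (0<· 0<x (<-≤-trans (positive⁻¹ (+ 6 / 10)) (≤-step (+-nonNeg
          (0≤· 0≤x (+-nonNeg (0≤· (nonNegative⁻¹ (+ 114 / 10)) (≤⇒0≤- x≤3/10)) (nonNegative⁻¹ (+ 1335 / 1000))))
          (0≤· (nonNegative⁻¹ (+ 6 / 1)) (0≤· 0≤x (0≤· 0≤x 0≤x))))))))
      (+-mono-≤ 6w²≤ (≤-trans (≤-excess (0≤· (≤⇒0≤- (·-mono-≤ 0≤a a≤1 0≤a a≤1)) (neg-antimono-≤ h≤0))
          (solve 2 (λ a h → a :* a :* h := h :+ (con 1ℚ :- a :* a) :* (:- h)) refl a h))
        (*-monoˡ-≤-nonNeg (a * a) {{nonNegative (0≤· 0≤a 0≤a)}} h≤H)))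

  ι-+ : ∀ m n → ι (m ℕ.+ n) ≡ ι m + ι n
  ι-+ zero    n = sym (+-identityˡ (ι n))
  ι-+ (suc m) n = begin
    ι (suc (m ℕ.+ n))   ≡⟨ ι-suc (m ℕ.+ n) ⟩
    1ℚ + ι (m ℕ.+ n)    ≡⟨ cong (λ q → 1ℚ + q) (ι-+ m n) ⟩
    1ℚ + (ι m + ι n)    ≡⟨ sym (+-assoc 1ℚ (ι m) (ι n)) ⟩
    1ℚ + ι m + ι n      ≡⟨ cong (λ q → q + ι n) (sym (ι-suc m)) ⟩
    ι (suc m) + ι n     ∎
    where open ≡-Reasoning

  ι-* : ∀ m n → ι (m ℕ.* n) ≡ ι m * ι n
  ι-* zero    n = sym (*-zeroˡ (ι n))
  ι-* (suc m) n = begin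
    ι (n ℕ.+ m ℕ.* n)   ≡⟨ ι-+ n (m ℕ.* n) ⟩
    ι n + ι (m ℕ.* n)   ≡⟨ cong (λ q → ι n + q) (ι-* m n) ⟩
    ι n + ι m * ι n     ≡⟨ solve 2 (λ m n → n :+ m :* n := (con 1ℚ :+ m) :* n) refl (ι m) (ι n) ⟩
    (1ℚ + ι m) * ι n    ≡⟨ cong (λ q → q * ι n) (sym (ι-suc m)) ⟩
    ι (suc m) * ι n     ∎
    where open ≡-Reasoning

  ι-^ : ∀ m n → ι (m ℕ.^ n) ≡ ι m ^ n
  ι-^ m zero    = refl
  ι-^ m (suc n) = trans (ι-* m (m ℕ.^ n)) (cong (λ q → ι m * q) (ι-^ m n))

  ι-mono-≤ : ∀ {m n} → m ℕ.≤ n → ι m ≤ ι n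
  ι-mono-≤ m≤n = *≤* (ℤ.*-monoʳ-≤-nonNeg (+ 1) (ℤ.+≤+ m≤n))

  ι-cancel-< : ∀ {m n} → ι m < ι n → m ℕ.< n
  ι-cancel-< m<n = ℕ.≰⇒> λ n≤m → <-irrefl refl (<-≤-trans m<n (ι-mono-≤ n≤m))

  ι-cancel-≤ : ∀ {m n} → ι m ≤ ι n → m ℕ.≤ n
  ι-cancel-≤ {m} {n} (*≤* m≤n) = ℤ.drop‿+≤+ (subst₂ ℤ._≤_ (ℤ.*-identityʳ (+ m)) (ℤ.*-identityʳ (+ n)) m≤n)

  0<ι : ∀ n → 0ℚ < ι (suc n)
  0<ι n = positive⁻¹ (ι (suc n))

  ^-nonNeg : ∀ {x} → 0ℚ ≤ x → ∀ n → 0ℚ ≤ x ^ n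
  ^-nonNeg 0≤x zero    = nonNegative⁻¹ 1ℚ
  ^-nonNeg 0≤x (suc n) = 0≤· 0≤x (^-nonNeg 0≤x n)

  ^-pos : ∀ {x} → 0ℚ < x → ∀ n → 0ℚ < x ^ n
  ^-pos 0<x zero    = positive⁻¹ 1ℚ
  ^-pos 0<x (suc n) = 0<· 0<x (^-pos 0<x n)

  ^-mono : ∀ {x y} → 0ℚ ≤ x → x ≤ y → ∀ n → x ^ n ≤ y ^ n
  ^-mono 0≤x x≤y zero    = ≤-refl
  ^-mono 0≤x x≤y (suc n) = ·-mono-≤ 0≤x x≤y (^-nonNeg 0≤x n) (^-mono 0≤x x≤y n)

  ^-≤1 : ∀ {x} → 0ℚ ≤ x → x ≤ 1ℚ → ∀ n → x ^ n ≤ 1ℚ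
  ^-≤1 0≤x x≤1 zero    = ≤-refl
  ^-≤1 0≤x x≤1 (suc n) = ·-mono-≤ 0≤x x≤1 (^-nonNeg 0≤x n) (^-≤1 0≤x x≤1 n)

  -- (1 − gⁿ) / (1 − g) = 1 + g + ⋯ + gⁿ⁻¹ is increasing in g.
  geometric-mono : ∀ {g h} → 0ℚ ≤ g → g ≤ h → h ≤ 1ℚ → ∀ n → (1ℚ - g ^ n) * (1ℚ - h) ≤ (1ℚ - g) * (1ℚ - h ^ n)
  geometric-mono {g} {h} 0≤g g≤h h≤1 zero =
    ≤-reflexive (solve 2 (λ g h → (con 1ℚ :- con 1ℚ) :* (con 1ℚ :- h) := (con 1ℚ :- g) :* (con 1ℚ :- con 1ℚ)) refl g h)
  geometric-mono {g} {h} 0≤g g≤h h≤1 (suc n) = begin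
    (1ℚ - g * g ^ n) * (1ℚ - h)
      ≡⟨ solve 3 (λ g h p → (con 1ℚ :- g :* p) :* (con 1ℚ :- h) := (con 1ℚ :- p) :* (con 1ℚ :- h) :+ p :* ((con 1ℚ :- g) :* (con 1ℚ :- h))) refl g h (g ^ n) ⟩
    (1ℚ - g ^ n) * (1ℚ - h) + g ^ n * ((1ℚ - g) * (1ℚ - h))
      ≤⟨ +-mono-≤ (geometric-mono 0≤g g≤h h≤1 n)
           (*-monoʳ-≤-nonNeg ((1ℚ - g) * (1ℚ - h)) {{nonNegative (0≤· (≤⇒0≤- (≤-trans g≤h h≤1)) (≤⇒0≤- h≤1))}} (^-mono 0≤g g≤h n)) ⟩
    (1ℚ - g) * (1ℚ - h ^ n) + h ^ n * ((1ℚ - g) * (1ℚ - h))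
      ≡⟨ solve 3 (λ g h p → (con 1ℚ :- g) :* (con 1ℚ :- p) :+ p :* ((con 1ℚ :- g) :* (con 1ℚ :- h)) := (con 1ℚ :- g) :* (con 1ℚ :- h :* p)) refl g h (h ^ n) ⟩
    (1ℚ - g) * (1ℚ - h * h ^ n) ∎
    where open ≤-Reasoning

  recip-step : ∀ i → recip i ≡ recip (suc i) + recip i * recip (suc i)
  recip-step i = begin
    recip i                                                            ≡⟨ sym (*-identityʳ (recip i)) ⟩
    recip i * 1ℚ                                                       ≡⟨ cong (λ q → recip i * q) (sym (recip-inverse (suc i))) ⟩
    recip i * (recip (suc i) * ι (suc (suc i)))                        ≡⟨ cong (λ q → recip i * (recip (suc i) * q)) (ι-suc (suc i)) ⟩
    recip i * (recip (suc i) * (1ℚ + ι (suc i)))                       ≡⟨ solve 3 (λ r s j → r :* (s :* (con 1ℚ :+ j)) := s :* (r :* j) :+ r :* s) refl (recip i) (recip (suc i)) (ι (suc i)) ⟩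
    recip (suc i) * (recip i * ι (suc i)) + recip i * recip (suc i)    ≡⟨ cong (λ q → recip (suc i) * q + recip i * recip (suc i)) (recip-inverse i) ⟩
    recip (suc i) * 1ℚ + recip i * recip (suc i)                       ≡⟨ cong (λ q → q + recip i * recip (suc i)) (*-identityʳ (recip (suc i))) ⟩
    recip (suc i) + recip i * recip (suc i)                            ∎
    where open ≡-Reasoning

  recip-antitone : ∀ i → recip (suc i) ≤ recip i
  recip-antitone i = ≤-excess (0≤· (0≤recip i) (0≤recip (suc i))) (recip-step i)

  recip≤1 : ∀ i → recip i ≤ 1ℚ
  recip≤1 zero    = ≤-refl
  recip≤1 (suc i) = ≤-trans (recip-antitone i) (recip≤1 i)

  -- With q j = ((j − 1)ⁿ / (j − 1)!) / (jⁿ / j !) = j (1 − 1/j)ⁿ, these are T i = i / (i + 1),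
  -- G i = T i / T (i + 1), Q n i = q (i + 1) and σ n i = q (i + 1) / q (i + 2).
  T G : ℕ → ℚ
  T i = 1ℚ - recip i
  G i = 1ℚ - recip i * recip i

  Q σ : ℕ → ℕ → ℚ
  Q n i = ι (suc i) * T i ^ n
  σ n i = T (suc i) * G i ^ n

  0≤T : ∀ i → 0ℚ ≤ T i
  0≤T i = ≤⇒0≤- (recip≤1 i)

  T≤1 : ∀ i → T i ≤ 1ℚ
  T≤1 i = ≤-excess (0≤recip i) (solve 1 (λ r → con 1ℚ := (con 1ℚ :- r) :+ r) refl (recip i))

  T<1 : ∀ i → T i < 1ℚ
  T<1 i = subst (T i <_) (solve 1 (λ r → (con 1ℚ :- r) :+ r := con 1ℚ) refl (recip i))
    (subst (_< T i + recip i) (+-identityʳ (T i)) (+-monoʳ-< (T i) (0<recip i)))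

  T-mono : ∀ i → T i ≤ T (suc i)
  T-mono i = +-monoʳ-≤ 1ℚ (neg-antimono-≤ (recip-antitone i))

  0≤G : ∀ i → 0ℚ ≤ G i
  0≤G i = ≤⇒0≤- (·-mono-≤ (0≤recip i) (recip≤1 i) (0≤recip i) (recip≤1 i))

  G≤1 : ∀ i → G i ≤ 1ℚ
  G≤1 i = ≤-excess (0≤· (0≤recip i) (0≤recip i)) (solve 1 (λ r → con 1ℚ := (con 1ℚ :- r :* r) :+ r :* r) refl (recip i))

  G-mono : ∀ i → G i ≤ G (suc i)
  G-mono i = +-monoʳ-≤ 1ℚ (neg-antimono-≤ (·-mono-≤ (0≤recip (suc i)) (recip-antitone i) (0≤recip (suc i)) (recip-antitone i)))

  ι*T : ∀ i → ι (suc i) * T i ≡ ι i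
  ι*T i = begin
    ι (suc i) * (1ℚ - recip i)             ≡⟨ solve 2 (λ j r → j :* (con 1ℚ :- r) := j :- r :* j) refl (ι (suc i)) (recip i) ⟩
    ι (suc i) - recip i * ι (suc i)        ≡⟨ cong₂ _-_ (ι-suc i) (recip-inverse i) ⟩
    1ℚ + ι i - 1ℚ                          ≡⟨ solve 1 (λ j → con 1ℚ :+ j :- con 1ℚ := j) refl (ι i) ⟩
    ι i                                    ∎
    where open ≡-Reasoning

  T*G : ∀ i → T (suc i) * G i ≡ T i
  T*G i = begin
    (1ℚ - s) * (1ℚ - r * r)                ≡⟨ solve 2 (λ r s → (con 1ℚ :- s) :* (con 1ℚ :- r :* r) := (con 1ℚ :- r) :+ (con 1ℚ :- r) :* (r :- (s :+ r :* s))) refl r s ⟩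
    (1ℚ - r) + (1ℚ - r) * (r - (s + r * s)) ≡⟨ cong (λ q → (1ℚ - r) + (1ℚ - r) * (r - q)) (sym (recip-step i)) ⟩
    (1ℚ - r) + (1ℚ - r) * (r - r)          ≡⟨ solve 1 (λ r → (con 1ℚ :- r) :+ (con 1ℚ :- r) :* (r :- r) := con 1ℚ :- r) refl r ⟩
    1ℚ - r                                 ∎
    where
    open ≡-Reasoning
    r = recip i
    s = recip (suc i)

  Q-step : ∀ n i → Q n i ≡ Q n (suc i) * σ n i
  Q-step n i = begin
    ι (suc i) * T i ^ n                                      ≡⟨ cong₂ (λ p q → p * q ^ n) (sym (ι*T (suc i))) (sym (T*G i)) ⟩
    ι (suc (suc i)) * T (suc i) * (T (suc i) * G i) ^ n      ≡⟨ cong (λ q → ι (suc (suc i)) * T (suc i) * q) (^-distrib-* (T (suc i)) (G i) n) ⟩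
    ι (suc (suc i)) * T (suc i) * (T (suc i) ^ n * G i ^ n)  ≡⟨ solve 4 (λ j t p g → j :* t :* (p :* g) := j :* p :* (t :* g)) refl (ι (suc (suc i))) (T (suc i)) (T (suc i) ^ n) (G i ^ n) ⟩
    Q n (suc i) * σ n i                                      ∎
    where open ≡-Reasoning

  -- Clears the denominator of q (i + 1): the passage between `Q` and powers of natural numbers.
  ι^*Q : ∀ n i → ι (suc i) ^ n * Q n i ≡ ι (suc i) * ι i ^ n
  ι^*Q n i = begin
    ι (suc i) ^ n * (ι (suc i) * T i ^ n)   ≡⟨ solve 3 (λ p j t → p :* (j :* t) := j :* (p :* t)) refl (ι (suc i) ^ n) (ι (suc i)) (T i ^ n) ⟩
    ι (suc i) * (ι (suc i) ^ n * T i ^ n)   ≡⟨ cong (λ q → ι (suc i) * q) (sym (^-distrib-* (ι (suc i)) (T i) n)) ⟩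
    ι (suc i) * (ι (suc i) * T i) ^ n       ≡⟨ cong (λ q → ι (suc i) * q ^ n) (ι*T i) ⟩
    ι (suc i) * ι i ^ n                     ∎
    where open ≡-Reasoning

  0≤Q : ∀ n i → 0ℚ ≤ Q n i
  0≤Q n i = 0≤· (0≤ι (suc i)) (^-nonNeg (0≤T i) n)

  0≤σ : ∀ n i → 0ℚ ≤ σ n i
  0≤σ n i = 0≤· (0≤T (suc i)) (^-nonNeg (0≤G i) n)

  σ≤T : ∀ n i → σ n i ≤ T (suc i)
  σ≤T n i = ≤-trans (*-monoˡ-≤-nonNeg (T (suc i)) {{nonNegative (0≤T (suc i))}} (^-≤1 (0≤G i) (G≤1 i) n)) (≤-reflexive (*-identityʳ (T (suc i))))

  σ-mono : ∀ n i → σ n i ≤ σ n (suc i)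
  σ-mono n i = ·-mono-≤ (0≤T (suc i)) (T-mono (suc i)) (^-nonNeg (0≤G i) n) (^-mono (0≤G i) (G-mono i) n)

  -- With r, s, t the reciprocals of i + 1, i + 2, i + 3, one has 1 - σ n i = s + (1 - s) (1 - p),
  -- and likewise with t and q at suc i. After multiplication by r s, the relations r - r s = s and
  -- s - s t = t reduce the claim to s ≤ r and to `geometric-mono` for G i ≤ G (suc i), since 1 - G
  -- i = r² and 1 - G (suc i) = s².
  σ-gap-recip : ∀ n i → recip (suc (suc i)) * (1ℚ - σ n i) ≤ recip i * (1ℚ - σ n (suc i))
  σ-gap-recip n i = *-cancelˡ-≤-pos (r * s) {{positive (0<· (0<recip i) (0<recip (suc i)))}} (begin
    r * s * (t * (1ℚ - (1ℚ - s) * p))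
      ≡⟨ solve 4 (λ r s t p → r :* s :* (t :* (con 1ℚ :- (con 1ℚ :- s) :* p)) := r :* s :* t :* s :+ s :* t :* (con 1ℚ :- p) :* (r :- r :* s)) refl r s t p ⟩
    r * s * t * s + s * t * (1ℚ - p) * (r - r * s)
      ≡⟨ cong (λ q → r * s * t * s + s * t * (1ℚ - p) * q) (minus r s (recip-step i)) ⟩
    r * s * t * s + s * t * (1ℚ - p) * s
      ≡⟨ solve 4 (λ r s t p → r :* s :* t :* s :+ s :* t :* (con 1ℚ :- p) :* s := r :* s :* t :* s :+ t :* ((con 1ℚ :- p) :* (con 1ℚ :- (con 1ℚ :- s :* s)))) refl r s t p ⟩
    r * s * t * s + t * ((1ℚ - p) * (1ℚ - G (suc i)))
      ≤⟨ +-mono-≤ (*-monoˡ-≤-nonNeg (r * s * t) {{nonNegative (0≤· (0≤· (0≤recip i) (0≤recip (suc i))) (0≤recip (suc (suc i))))}} (recip-antitone i))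
           (*-monoˡ-≤-nonNeg t {{nonNegative (0≤recip (suc (suc i)))}} (geometric-mono (0≤G i) (G-mono i) (G≤1 (suc i)) n)) ⟩
    r * s * t * r + t * ((1ℚ - G i) * (1ℚ - q))
      ≡⟨ solve 4 (λ r s t q → r :* s :* t :* r :+ t :* ((con 1ℚ :- (con 1ℚ :- r :* r)) :* (con 1ℚ :- q)) := r :* s :* t :* r :+ r :* r :* (con 1ℚ :- q) :* t) refl r s t q ⟩
    r * s * t * r + r * r * (1ℚ - q) * t
      ≡⟨ cong (λ w → r * s * t * r + r * r * (1ℚ - q) * w) (sym (minus s t (recip-step (suc i)))) ⟩
    r * s * t * r + r * r * (1ℚ - q) * (s - s * t)
      ≡⟨ solve 4 (λ r s t q → r :* s :* t :* r :+ r :* r :* (con 1ℚ :- q) :* (s :- s :* t) := r :* s :* (r :* (con 1ℚ :- (con 1ℚ :- t) :* q))) refl r s t q ⟩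
    r * s * (r * (1ℚ - (1ℚ - t) * q)) ∎)
    where
    open ≤-Reasoning
    r = recip i
    s = recip (suc i)
    t = recip (suc (suc i))
    p = G i ^ n
    q = G (suc i) ^ n
    minus : ∀ r s → r ≡ s + r * s → r - r * s ≡ s
    minus r s r≡ = trans (cong (λ q → q - r * s) r≡) (solve 2 (λ r s → s :+ r :* s :- r :* s := s) refl r s)

  -- Equivalently j (j − 1) (1 − q (j − 1) / q j) is increasing in j.
  σ-gap : ∀ n i → ι (suc i) * (1ℚ - σ n i) ≤ ι (suc (suc (suc i))) * (1ℚ - σ n (suc i))
  σ-gap n i = begin
    I * x                  ≡⟨ insert I x t J (recip-inverse (suc (suc i))) ⟩
    I * J * (t * x)        ≤⟨ *-monoˡ-≤-nonNeg (I * J) {{nonNegative (0≤· (0≤ι (suc i)) (0≤ι (suc (suc (suc i)))))}} (σ-gap-recip n i) ⟩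
    I * J * (r * y)        ≡⟨ cong (λ q → q * (r * y)) (*-comm I J) ⟩
    J * I * (r * y)        ≡⟨ sym (insert J y r I (recip-inverse i)) ⟩
    J * y                  ∎
    where
    open ≤-Reasoning
    I = ι (suc i)
    J = ι (suc (suc (suc i)))
    r = recip i
    t = recip (suc (suc i))
    x = 1ℚ - σ n i
    y = 1ℚ - σ n (suc i)
    insert : ∀ a b t j → t * j ≡ 1ℚ → a * b ≡ a * j * (t * b)
    insert a b t j tj≡1 = trans (sym (*-identityˡ (a * b))) (trans (cong (λ q → q * (a * b)) (sym tj≡1))
      (solve 4 (λ a b t j → t :* j :* (a :* b) := a :* j :* (t :* b)) refl a b t j))

  σ-gap₂ : ∀ n i → ι (suc i) * ι (suc (suc i)) * (1ℚ - σ n i) ≤ ι (suc (suc (suc i))) * ι (suc (suc (suc (suc i)))) * (1ℚ - σ n (suc (suc i)))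
  σ-gap₂ n i = begin
    A * B * x     ≡⟨ solve 3 (λ A B x → A :* B :* x := B :* (A :* x)) refl A B x ⟩
    B * (A * x)   ≤⟨ *-monoˡ-≤-nonNeg B (σ-gap n i) ⟩
    B * (C * y)   ≡⟨ solve 3 (λ B C y → B :* (C :* y) := C :* (B :* y)) refl B C y ⟩
    C * (B * y)   ≤⟨ *-monoˡ-≤-nonNeg C (σ-gap n (suc i)) ⟩
    C * (D * z)   ≡⟨ sym (*-assoc C D z) ⟩
    C * D * z     ∎
    where
    open ≤-Reasoning
    A = ι (suc i)
    B = ι (suc (suc i))
    C = ι (suc (suc (suc i)))
    D = ι (suc (suc (suc (suc i))))
    x = 1ℚ - σ n i
    y = 1ℚ - σ n (suc i)
    z = 1ℚ - σ n (suc (suc i))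

  cross-multiply : ∀ A B p {x y} → 0ℚ < A → 0ℚ ≤ y → A * x ≤ B * y → B ≤ p * A → x ≤ p * y
  cross-multiply A B p {x} {y} 0<A 0≤y Ax≤By B≤pA = *-cancelˡ-≤-pos A {{positive 0<A}} (begin
    A * x          ≤⟨ Ax≤By ⟩
    B * y          ≤⟨ *-monoʳ-≤-nonNeg y {{nonNegative 0≤y}} B≤pA ⟩
    p * A * y      ≡⟨ solve 3 (λ p A y → p :* A :* y := A :* (p :* y)) refl p A y ⟩
    A * (p * y)    ∎)
    where open ≤-Reasoning

  σ≤1 : ∀ n i → σ n i ≤ 1ℚ
  σ≤1 n i = ≤-trans (σ≤T n i) (T≤1 (suc i))

  0≤1-σ : ∀ n i → 0ℚ ≤ 1ℚ - σ n i
  0≤1-σ n i = ≤⇒0≤- (σ≤1 n i)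

  σ-gap-21/20 : ∀ n k → 81 ℕ.≤ k → 1ℚ - σ n (2 ℕ.+ k) ≤ (+ 21 / 20) * (1ℚ - σ n (4 ℕ.+ k))
  σ-gap-21/20 n k 81≤k =
    cross-multiply (ι (3 ℕ.+ k) * ι (4 ℕ.+ k)) (ι (5 ℕ.+ k) * ι (6 ℕ.+ k)) (+ 21 / 20) (0<· (0<ι (2 ℕ.+ k)) (0<ι (3 ℕ.+ k))) (0≤1-σ n (4 ℕ.+ k)) (σ-gap₂ n (2 ℕ.+ k)) bound
    where
    K = ι k
    bound : ι (5 ℕ.+ k) * ι (6 ℕ.+ k) ≤ (+ 21 / 20) * (ι (3 ℕ.+ k) * ι (4 ℕ.+ k))
    bound = subst₂ _≤_ (cong₂ (λ a b → a * b) (sym (ι-+ 5 k)) (sym (ι-+ 6 k))) (cong₂ (λ a b → (+ 21 / 20) * (a * b)) (sym (ι-+ 3 k)) (sym (ι-+ 4 k)))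
      (≤-excess (+-nonNeg (0≤· (≤⇒0≤- (ι-mono-≤ 81≤k)) (+-nonNeg (0≤· (nonNegative⁻¹ (+ 1 / 20)) (0≤ι k)) (nonNegative⁻¹ (+ 8 / 20)))) (nonNegative⁻¹ (ι 15)))
        (solve 1 (λ K → con (+ 21 / 20) :* ((con (ι 3) :+ K) :* (con (ι 4) :+ K)) :=
          (con (ι 5) :+ K) :* (con (ι 6) :+ K) :+ ((K :- con (ι 81)) :* (con (+ 1 / 20) :* K :+ con (+ 8 / 20)) :+ con (ι 15))) refl K))

  -- 81 is the least k with (5 + k) (6 + k) ≤ (11/10) (1 + k) (2 + k). With r = 4 + k this is the
  -- origin of the bound r ≥ 85.
  σ-gap-11/10 : ∀ n k → 81 ℕ.≤ k → 1ℚ - σ n k ≤ (+ 11 / 10) * (1ℚ - σ n (4 ℕ.+ k))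
  σ-gap-11/10 n k 81≤k =
    cross-multiply (ι (1 ℕ.+ k) * ι (2 ℕ.+ k)) (ι (5 ℕ.+ k) * ι (6 ℕ.+ k)) (+ 11 / 10) (0<· (0<ι k) (0<ι (1 ℕ.+ k))) (0≤1-σ n (4 ℕ.+ k)) (≤-trans (σ-gap₂ n k) (σ-gap₂ n (2 ℕ.+ k))) bound
    where
    K = ι k
    bound : ι (5 ℕ.+ k) * ι (6 ℕ.+ k) ≤ (+ 11 / 10) * (ι (1 ℕ.+ k) * ι (2 ℕ.+ k))
    bound = subst₂ _≤_ (cong₂ (λ a b → a * b) (sym (ι-+ 5 k)) (sym (ι-+ 6 k))) (cong₂ (λ a b → (+ 11 / 10) * (a * b)) (sym (ι-+ 1 k)) (sym (ι-+ 2 k)))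
      (≤-excess (+-nonNeg (0≤· (≤⇒0≤- (ι-mono-≤ 81≤k)) (+-nonNeg (0≤· (nonNegative⁻¹ (+ 1 / 10)) (0≤ι k)) (nonNegative⁻¹ (+ 4 / 10)))) (nonNegative⁻¹ (+ 46 / 10)))
        (solve 1 (λ K → con (+ 11 / 10) :* ((con (ι 1) :+ K) :* (con (ι 2) :+ K)) :=
          (con (ι 5) :+ K) :* (con (ι 6) :+ K) :+ ((K :- con (ι 81)) :* (con (+ 1 / 10) :* K :+ con (+ 4 / 10)) :+ con (+ 46 / 10))) refl K))

  -- Put r = 4 + k. The arguments are q r, q (r - 1) / q r, q (r - 2) and q (r - 3) / q (r - 2), and
  -- x is 1 - q (r + 1) / q (r + 2). As `σ` increases, each step down from q (r + 2) ≤ 1 costs at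
  -- least a factor 1 - x, whence q r ≤ (1 - x)² and q (r - 2) ≤ (1 - x)⁴.
  Q-quartic-positive : ∀ n k → 81 ℕ.≤ k → Q n (5 ℕ.+ k) ≤ 1ℚ →
    0ℚ < quartic (Q n (3 ℕ.+ k)) (σ n (2 ℕ.+ k)) (Q n (1 ℕ.+ k)) (σ n k)
  Q-quartic-positive n k 81≤k Q≤1 = quartic-positive {x = x}
    (<⇒0<- (≤-<-trans (σ≤T n (4 ℕ.+ k)) (T<1 (5 ℕ.+ k)))) x≤1 (0≤Q n (3 ℕ.+ k)) (0≤σ n (2 ℕ.+ k)) (0≤Q n (1 ℕ.+ k)) (0≤σ n k) (σ≤1 n k)
    a≤ c≤ (σ-gap-21/20 n k 81≤k) (σ-gap-11/10 n k 81≤k)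
    where
    open ≤-Reasoning
    s x : ℚ
    s = σ n (4 ℕ.+ k)
    x = 1ℚ - s
    s≡ : s ≡ 1ℚ - x
    s≡ = solve 1 (λ s → s := con 1ℚ :- (con 1ℚ :- s)) refl s
    x≤1 : x ≤ 1ℚ
    x≤1 = ≤-excess (0≤σ n (4 ℕ.+ k)) (solve 1 (λ s → con 1ℚ := (con 1ℚ :- s) :+ s) refl s)
    a≤′ : Q n (3 ℕ.+ k) ≤ s * s
    a≤′ = begin
      Q n (3 ℕ.+ k)                                        ≡⟨ Q-step n (3 ℕ.+ k) ⟩
      Q n (4 ℕ.+ k) * σ n (3 ℕ.+ k)                        ≡⟨ cong (λ q → q * σ n (3 ℕ.+ k)) (Q-step n (4 ℕ.+ k)) ⟩
      Q n (5 ℕ.+ k) * s * σ n (3 ℕ.+ k)                    ≤⟨ ·-mono-≤ (0≤· (0≤Q n (5 ℕ.+ k)) (0≤σ n (4 ℕ.+ k)))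
                                                                (*-monoʳ-≤-nonNeg s {{nonNegative (0≤σ n (4 ℕ.+ k))}} Q≤1) (0≤σ n (3 ℕ.+ k)) (σ-mono n (3 ℕ.+ k)) ⟩
      1ℚ * s * s                                           ≡⟨ cong (λ q → q * s) (*-identityˡ s) ⟩
      s * s                                                ∎
    a≤ : Q n (3 ℕ.+ k) ≤ (1ℚ - x) * (1ℚ - x)
    a≤ = subst (λ q → Q n (3 ℕ.+ k) ≤ q * q) s≡ a≤′
    σ₂≤s : σ n (2 ℕ.+ k) ≤ s
    σ₂≤s = ≤-trans (σ-mono n (2 ℕ.+ k)) (σ-mono n (3 ℕ.+ k))
    c≤ : Q n (1 ℕ.+ k) ≤ ((1ℚ - x) * (1ℚ - x)) * ((1ℚ - x) * (1ℚ - x))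
    c≤ = subst (λ q → Q n (1 ℕ.+ k) ≤ (q * q) * (q * q)) s≡ (begin
      Q n (1 ℕ.+ k)                                        ≡⟨ Q-step n (1 ℕ.+ k) ⟩
      Q n (2 ℕ.+ k) * σ n (1 ℕ.+ k)                        ≡⟨ cong (λ q → q * σ n (1 ℕ.+ k)) (Q-step n (2 ℕ.+ k)) ⟩
      Q n (3 ℕ.+ k) * σ n (2 ℕ.+ k) * σ n (1 ℕ.+ k)        ≡⟨ *-assoc (Q n (3 ℕ.+ k)) _ _ ⟩
      Q n (3 ℕ.+ k) * (σ n (2 ℕ.+ k) * σ n (1 ℕ.+ k))      ≤⟨ ·-mono-≤ (0≤Q n (3 ℕ.+ k)) a≤′ (0≤· (0≤σ n (2 ℕ.+ k)) (0≤σ n (1 ℕ.+ k)))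
                                                                (·-mono-≤ (0≤σ n (2 ℕ.+ k)) σ₂≤s (0≤σ n (1 ℕ.+ k)) (≤-trans (σ-mono n (1 ℕ.+ k)) σ₂≤s)) ⟩
      (s * s) * (s * s)                                    ∎)

  -- This is the quartic multiplied by (4 + k)ⁿ: every product on either side arises from the
  -- preceding one by a factor `Q`, and the hypothesis says Q n (5 + k) ≤ 1.
  alternating-positive : ∀ n k → 81 ℕ.≤ k → (6 ℕ.+ k) ℕ.* (5 ℕ.+ k) ℕ.^ n ℕ.≤ (6 ℕ.+ k) ℕ.^ n →
    12 ℕ.* ((4 ℕ.+ k) ℕ.* (3 ℕ.+ k) ℕ.^ n) ℕ.+ 4 ℕ.* ((4 ℕ.+ k) ℕ.* ((3 ℕ.+ k) ℕ.* ((2 ℕ.+ k) ℕ.* (1 ℕ.+ k) ℕ.^ n))) ℕ.<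
    6 ℕ.* (4 ℕ.+ k) ℕ.^ n ℕ.+ 9 ℕ.* ((4 ℕ.+ k) ℕ.* ((3 ℕ.+ k) ℕ.* (2 ℕ.+ k) ℕ.^ n)) ℕ.+
      (4 ℕ.+ k) ℕ.* ((3 ℕ.+ k) ℕ.* ((2 ℕ.+ k) ℕ.* ((1 ℕ.+ k) ℕ.* k ℕ.^ n)))
  alternating-positive n k 81≤k mode≥r+2 = ι-cancel-< (subst₂ _<_ (sym left′) (sym right′) (0<-⇒< (subst (0ℚ <_) expand
    (0<· (^-pos (0<ι (3 ℕ.+ k)) n) (Q-quartic-positive n k 81≤k Q≤1)))))
    where
    open ≡-Reasoning
    P p a v b c u d : ℚ
    P = ι (4 ℕ.+ k) ^ n
    a = Q n (3 ℕ.+ k)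
    v = σ n (2 ℕ.+ k)
    b = Q n (2 ℕ.+ k)
    c = Q n (1 ℕ.+ k)
    u = σ n k
    d = Q n k
    p = ι (6 ℕ.+ k) ^ n
    0<-⇒< : ∀ {p q} → 0ℚ < q - p → p < q
    0<-⇒< {p} {q} 0<q-p = subst₂ _<_ (+-identityʳ p) (solve 2 (λ p q → p :+ (q :- p) := q) refl p q) (+-monoʳ-< p 0<q-p)
    Q≤1 : Q n (5 ℕ.+ k) ≤ 1ℚ
    Q≤1 = *-cancelˡ-≤-pos p {{positive (^-pos (0<ι (5 ℕ.+ k)) n)}} (subst₂ _≤_
      (trans (ι-* (6 ℕ.+ k) ((5 ℕ.+ k) ℕ.^ n)) (trans (cong (λ q → ι (6 ℕ.+ k) * q) (ι-^ (5 ℕ.+ k) n)) (sym (ι^*Q n (5 ℕ.+ k)))))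
      (trans (ι-^ (6 ℕ.+ k) n) (sym (*-identityʳ p))) (ι-mono-≤ mode≥r+2))
    descend : ∀ i q → ι (suc i ℕ.^ n) ≡ q → ι (suc i ℕ.* i ℕ.^ n) ≡ q * Q n i
    descend i q e = begin
      ι (suc i ℕ.* i ℕ.^ n)         ≡⟨ ι-* (suc i) (i ℕ.^ n) ⟩
      ι (suc i) * ι (i ℕ.^ n)       ≡⟨ cong (λ q → ι (suc i) * q) (ι-^ i n) ⟩
      ι (suc i) * ι i ^ n           ≡⟨ sym (ι^*Q n i) ⟩
      ι (suc i) ^ n * Q n i         ≡⟨ cong (λ q → q * Q n i) (trans (sym (ι-^ (suc i) n)) e) ⟩
      q * Q n i                     ∎
    descend-* : ∀ i m q → ι (m ℕ.* suc i ℕ.^ n) ≡ q → ι (m ℕ.* (suc i ℕ.* i ℕ.^ n)) ≡ q * Q n i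
    descend-* i m q e = begin
      ι (m ℕ.* (suc i ℕ.* i ℕ.^ n))      ≡⟨ ι-* m (suc i ℕ.* i ℕ.^ n) ⟩
      ι m * ι (suc i ℕ.* i ℕ.^ n)        ≡⟨ cong (λ q → ι m * q) (descend i (ι (suc i ℕ.^ n)) refl) ⟩
      ι m * (ι (suc i ℕ.^ n) * Q n i)    ≡⟨ sym (*-assoc (ι m) (ι (suc i ℕ.^ n)) (Q n i)) ⟩
      ι m * ι (suc i ℕ.^ n) * Q n i      ≡⟨ cong (λ q → q * Q n i) (trans (sym (ι-* m (suc i ℕ.^ n))) e) ⟩
      q * Q n i                          ∎
    c₁ : ι ((4 ℕ.+ k) ℕ.* (3 ℕ.+ k) ℕ.^ n) ≡ P * a
    c₁ = descend (3 ℕ.+ k) P (ι-^ (4 ℕ.+ k) n)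
    c₂ : ι ((4 ℕ.+ k) ℕ.* ((3 ℕ.+ k) ℕ.* (2 ℕ.+ k) ℕ.^ n)) ≡ P * a * b
    c₂ = descend-* (2 ℕ.+ k) (4 ℕ.+ k) (P * a) c₁
    c₃ : ι ((4 ℕ.+ k) ℕ.* ((3 ℕ.+ k) ℕ.* ((2 ℕ.+ k) ℕ.* (1 ℕ.+ k) ℕ.^ n))) ≡ P * a * b * c
    c₃ = trans (cong ι (sym (ℕ.*-assoc (4 ℕ.+ k) (3 ℕ.+ k) ((2 ℕ.+ k) ℕ.* (1 ℕ.+ k) ℕ.^ n))))
      (descend-* (1 ℕ.+ k) ((4 ℕ.+ k) ℕ.* (3 ℕ.+ k)) (P * a * b) (trans (cong ι (ℕ.*-assoc (4 ℕ.+ k) (3 ℕ.+ k) ((2 ℕ.+ k) ℕ.^ n))) c₂))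
    c₄ : ι ((4 ℕ.+ k) ℕ.* ((3 ℕ.+ k) ℕ.* ((2 ℕ.+ k) ℕ.* ((1 ℕ.+ k) ℕ.* k ℕ.^ n)))) ≡ P * a * b * c * d
    c₄ = trans (cong ι (sym (assoc₃ ((1 ℕ.+ k) ℕ.* k ℕ.^ n)))) (descend-* k ((4 ℕ.+ k) ℕ.* ((3 ℕ.+ k) ℕ.* (2 ℕ.+ k))) (P * a * b * c) (trans (cong ι (assoc₃ ((1 ℕ.+ k) ℕ.^ n))) c₃))
      where
      assoc₃ : ∀ m → (4 ℕ.+ k) ℕ.* ((3 ℕ.+ k) ℕ.* (2 ℕ.+ k)) ℕ.* m ≡ (4 ℕ.+ k) ℕ.* ((3 ℕ.+ k) ℕ.* ((2 ℕ.+ k) ℕ.* m))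
      assoc₃ m = trans (ℕ.*-assoc (4 ℕ.+ k) ((3 ℕ.+ k) ℕ.* (2 ℕ.+ k)) m) (cong ((4 ℕ.+ k) ℕ.*_) (ℕ.*-assoc (3 ℕ.+ k) (2 ℕ.+ k) m))
    left : ∀ x y → ι (12 ℕ.* x ℕ.+ 4 ℕ.* y) ≡ ι 12 * ι x + ι 4 * ι y
    left x y = trans (ι-+ (12 ℕ.* x) (4 ℕ.* y)) (cong₂ _+_ (ι-* 12 x) (ι-* 4 y))
    right : ∀ x y z → ι (6 ℕ.* x ℕ.+ 9 ℕ.* y ℕ.+ z) ≡ ι 6 * ι x + ι 9 * ι y + ι z
    right x y z = trans (ι-+ (6 ℕ.* x ℕ.+ 9 ℕ.* y) z) (cong (λ q → q + ι z) (trans (ι-+ (6 ℕ.* x) (9 ℕ.* y)) (cong₂ _+_ (ι-* 6 x) (ι-* 9 y))))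
    C₀ C₁ C₂ C₃ C₄ : ℕ
    C₀ = (4 ℕ.+ k) ℕ.^ n
    C₁ = (4 ℕ.+ k) ℕ.* (3 ℕ.+ k) ℕ.^ n
    C₂ = (4 ℕ.+ k) ℕ.* ((3 ℕ.+ k) ℕ.* (2 ℕ.+ k) ℕ.^ n)
    C₃ = (4 ℕ.+ k) ℕ.* ((3 ℕ.+ k) ℕ.* ((2 ℕ.+ k) ℕ.* (1 ℕ.+ k) ℕ.^ n))
    C₄ = (4 ℕ.+ k) ℕ.* ((3 ℕ.+ k) ℕ.* ((2 ℕ.+ k) ℕ.* ((1 ℕ.+ k) ℕ.* k ℕ.^ n)))
    left′ : ι (12 ℕ.* C₁ ℕ.+ 4 ℕ.* C₃) ≡ ι 12 * (P * a) + ι 4 * (P * a * b * c)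
    left′ = trans (left C₁ C₃) (cong₂ (λ x y → ι 12 * x + ι 4 * y) c₁ c₃)
    right′ : ι (6 ℕ.* C₀ ℕ.+ 9 ℕ.* C₂ ℕ.+ C₄) ≡ ι 6 * P + ι 9 * (P * a * b) + P * a * b * c * d
    right′ = trans (right C₀ C₂ C₄) (cong₂ _+_ (cong₂ (λ x y → ι 6 * x + ι 9 * y) (ι-^ (4 ℕ.+ k) n) c₂) c₄)
    expand : P * quartic a v c u ≡ ι 6 * P + ι 9 * (P * a * b) + P * a * b * c * d - (ι 12 * (P * a) + ι 4 * (P * a * b * c))
    expand = begin
      P * quartic a v c u
        ≡⟨ solve 5 (λ P a v c u → P :* (con (+ 6 / 1) :- con (+ 12 / 1) :* a :+ con (+ 9 / 1) :* (a :* (a :* v)) :- con (+ 4 / 1) :* (a :* (a :* v) :* c) :+ a :* (a :* v) :* c :* (c :* u)) :=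
             con (ι 6) :* P :+ con (ι 9) :* (P :* a :* (a :* v)) :+ P :* a :* (a :* v) :* c :* (c :* u) :- (con (ι 12) :* (P :* a) :+ con (ι 4) :* (P :* a :* (a :* v) :* c))) refl P a v c u ⟩
      ι 6 * P + ι 9 * (P * a * (a * v)) + P * a * (a * v) * c * (c * u) - (ι 12 * (P * a) + ι 4 * (P * a * (a * v) * c))
        ≡⟨ cong₂ (λ b d → ι 6 * P + ι 9 * (P * a * b) + P * a * b * c * d - (ι 12 * (P * a) + ι 4 * (P * a * b * c)))
             (sym (Q-step n (2 ℕ.+ k))) (sym (Q-step n k)) ⟩
      ι 6 * P + ι 9 * (P * a * b) + P * a * b * c * d - (ι 12 * (P * a) + ι 4 * (P * a * b * c)) ∎

-- Where kⁿ / k ! increases, and the computation for small r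

module Mode where
  open import Data.Nat.Base
  open import Data.Nat.Properties
  open import Relation.Nullary.Decidable using (Dec; yes; no; _×-dec_; ¬?; from-yes)
  open import Relation.Nullary.Negation using (¬_)
  open import Data.Bool.Base using (if_then_else_)
  open FallingFactorial using (_↓_)

  ^-distribʳ-* : ∀ m n o → (n * o) ^ m ≡ n ^ m * o ^ m
  ^-distribʳ-* zero    n o = refl
  ^-distribʳ-* (suc m) n o = trans (cong (n * o *_) (^-distribʳ-* m n o)) (interchange n o (n ^ m) (o ^ m))
    where open import Algebra.Properties.CommutativeSemigroup *-commutativeSemigroup using (interchange)

  -- n is so large that k ↦ kⁿ / k ! still increases from r + 1 to r + 2.
  Increasing : ℕ → ℕ → Set
  Increasing n r = (2 + r) * (1 + r) ^ n ≤ (2 + r) ^ n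

  increasing? : ∀ n r → Dec (Increasing n r)
  increasing? n r = (2 + r) * (1 + r) ^ n ≤? (2 + r) ^ n

  -- One more unit of n multiplies the right side by 2 + r but the left side only by 1 + r.
  increasing-suc : ∀ n r → Increasing n r → Increasing (suc n) r
  increasing-suc n r inc = begin
    (2 + r) * ((1 + r) * (1 + r) ^ n)  ≡⟨ x∙yz≈y∙xz (2 + r) (1 + r) ((1 + r) ^ n) ⟩
    (1 + r) * ((2 + r) * (1 + r) ^ n)  ≤⟨ *-mono-≤ (n≤1+n (1 + r)) inc ⟩
    (2 + r) * (2 + r) ^ n              ∎
    where
    open ≤-Reasoning
    open import Algebra.Properties.CommutativeSemigroup *-commutativeSemigroup using (x∙yz≈y∙xz)

  increasing-mono : ∀ {m n} r → m ≤ n → Increasing m r → Increasing n r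
  increasing-mono {m} r m≤n inc with k , refl ← m≤n⇒∃[o]m+o≡n m≤n = go k
    where
    go : ∀ k → Increasing (m + k) r
    go zero    rewrite +-identityʳ m = inc
    go (suc k) rewrite +-suc m k = increasing-suc (m + k) r (go k)

  -- Log-concavity of kⁿ / k !, which rests on (3 + r) (1 + r) ≤ (2 + r)².
  increasing-pred : ∀ n r → Increasing n (suc r) → Increasing n r
  increasing-pred n r inc = *-cancelʳ-≤ ((2 + r) * (1 + r) ^ n) ((2 + r) ^ n) ((2 + r) ^ n) {{m^n≢0 (2 + r) n}} (begin
    (2 + r) * (1 + r) ^ n * (2 + r) ^ n    ≤⟨ *-monoˡ-≤ ((2 + r) ^ n) (*-monoˡ-≤ ((1 + r) ^ n) (n≤1+n (2 + r))) ⟩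
    (3 + r) * (1 + r) ^ n * (2 + r) ^ n    ≡⟨ xy∙z≈xz∙y (3 + r) ((1 + r) ^ n) ((2 + r) ^ n) ⟩
    (3 + r) * (2 + r) ^ n * (1 + r) ^ n    ≤⟨ *-monoˡ-≤ ((1 + r) ^ n) inc ⟩
    (3 + r) ^ n * (1 + r) ^ n              ≡⟨ sym (^-distribʳ-* n (3 + r) (1 + r)) ⟩
    ((3 + r) * (1 + r)) ^ n                ≤⟨ ^-monoˡ-≤ n square ⟩
    ((2 + r) * (2 + r)) ^ n                ≡⟨ ^-distribʳ-* n (2 + r) (2 + r) ⟩
    (2 + r) ^ n * (2 + r) ^ n              ∎)
    where
    open ≤-Reasoning
    open import Algebra.Properties.CommutativeSemigroup *-commutativeSemigroup using (xy∙z≈xz∙y)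
    open import Data.Nat.Tactic.RingSolver using (solve-∀)
    lemma : ∀ r → (3 + r) * (1 + r) + 1 ≡ (2 + r) * (2 + r)
    lemma = solve-∀
    square : (3 + r) * (1 + r) ≤ (2 + r) * (2 + r)
    square = subst ((3 + r) * (1 + r) ≤_) (lemma r) (m≤m+n _ 1)

  -- r ! (r − l)ⁿ / (r − l)!
  term : ℕ → ℕ → ℕ → ℕ
  term n r l = (r ↓ l) * (r ∸ l) ^ n

  -- The coefficients are those of (1 - t) (6 - 6 t + 3 t² - t³) = 6 - 12 t + 9 t² - 4 t³ + t⁴, with
  -- `term n r l` for t^l and the negative terms moved to the left. For l > r the factor r ↓ l is 0,
  -- so truncated subtraction does no harm.
  Alternating : ℕ → ℕ → Set
  Alternating n r = 12 * term n r 1 + 4 * term n r 3 < 6 * term n r 0 + 9 * term n r 2 + term n r 4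

  -- Invariant: p = (1 + r)ⁿ and q = (2 + r)ⁿ, carried along so that no power is recomputed.
  search : ℕ → ℕ → ℕ → ℕ → ℕ → ℕ
  search zero       r n p q = n
  search (suc fuel) r n p q = if (2 + r) * p ≤ᵇ q then n else search fuel r (suc n) (p * (1 + r)) (q * (2 + r))

  -- The least n with Increasing n r; the fuel suffices for r ≤ 84.
  threshold : ℕ → ℕ
  threshold r = search 400 r 0 1 1

  -- The first two components certify that `search` found the least n; nothing is proved about
  -- `search` itself.
  Small : ℕ → Set
  Small r = Increasing (threshold r) r × ¬ Increasing (threshold r ∸ 1) r × Alternating (threshold r) r

  small? : ∀ r → Dec (Small r)
  small? r = increasing? (threshold r) r ×-dec ¬? (increasing? (threshold r ∸ 1) r) ×-dec (_ <? _)

  small : ∀ {r} → r < 84 → Small (suc r)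
  small = from-yes (allUpTo? (λ r → small? (suc r)) 84)

  large : ∀ n k → 81 ≤ k → Increasing n (4 + k) → Alternating n (4 + k)
  large n k 81≤k inc = subst₂ _<_ (cong₂ (λ x y → 12 * x + 4 * y) (sym term₁) (sym term₃))
    (cong₂ _+_ (cong₂ (λ x y → 6 * x + 9 * y) (sym term₀) (sym term₂)) (sym term₄))
    (alternating-positive n k 81≤k inc)
    where
    open Rationals using (alternating-positive)
    P : ℕ → ℕ
    P i = (i + k) ^ n
    term₀ : term n (4 + k) 0 ≡ P 4
    term₀ = +-identityʳ (P 4)
    term₁ : term n (4 + k) 1 ≡ (4 + k) * P 3
    term₁ = cong (_* P 3) (*-identityʳ (4 + k))
    term₂ : term n (4 + k) 2 ≡ (4 + k) * ((3 + k) * P 2)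
    term₂ = trans (*-assoc (4 + k) ((3 + k) * 1) (P 2)) (cong (λ x → (4 + k) * (x * P 2)) (*-identityʳ (3 + k)))
    term₃ : term n (4 + k) 3 ≡ (4 + k) * ((3 + k) * ((2 + k) * P 1))
    term₃ = trans (*-assoc (4 + k) ((3 + k) * ((2 + k) * 1)) (P 1)) (cong ((4 + k) *_)
      (trans (*-assoc (3 + k) ((2 + k) * 1) (P 1)) (cong (λ x → (3 + k) * (x * P 1)) (*-identityʳ (2 + k)))))
    term₄ : term n (4 + k) 4 ≡ (4 + k) * ((3 + k) * ((2 + k) * ((1 + k) * P 0)))
    term₄ = trans (*-assoc (4 + k) ((3 + k) * ((2 + k) * ((1 + k) * 1))) (P 0)) (cong ((4 + k) *_)
      (trans (*-assoc (3 + k) ((2 + k) * ((1 + k) * 1)) (P 0)) (cong ((3 + k) *_)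
        (trans (*-assoc (2 + k) ((1 + k) * 1) (P 0)) (cong (λ x → (2 + k) * (x * P 0)) (*-identityʳ (1 + k)))))))

  -- By monotonicity in n, failure at m ∸ 1 excludes every n < m; this is applied in both
  -- directions.
  increasing-least : ∀ m n r → Increasing m r → ¬ Increasing (m ∸ 1) r → Increasing n r → ¬ Increasing (n ∸ 1) r → m ≡ n
  increasing-least m n r inc ¬inc inc′ ¬inc′ = ≤-antisym (bound m n inc′ ¬inc) (bound n m inc ¬inc′)
    where
    bound : ∀ m n → Increasing n r → ¬ Increasing (m ∸ 1) r → m ≤ n
    bound zero    n _   _    = z≤n
    bound (suc m) n inc ¬inc = ≰⇒> λ n≤m → ¬inc (increasing-mono r n≤m inc)

  alternating-by : ∀ n r → Increasing n (suc r) → ¬ Increasing (n ∸ 1) (suc r) → Dec (r < 84) → Alternating n (suc r)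
  alternating-by n r inc ¬inc (yes r<84) = from-small (small r<84)
    where
    from-small : Small (suc r) → Alternating n (suc r)
    from-small (inc₀ , ¬inc₀ , alt) = subst (λ m → Alternating m (suc r)) (increasing-least (threshold (suc r)) n (suc r) inc₀ ¬inc₀ inc ¬inc) alt
  alternating-by n r inc ¬inc (no r≮84) = from-large (m+[n∸m]≡n {85} {suc r} (s≤s (≮⇒≥ r≮84)))
    where
    from-large : ∀ {k} → 4 + (81 + k) ≡ suc r → Alternating n (suc r)
    from-large {k} eq = subst (Alternating n) eq (large n (81 + k) (m≤m+n 81 k) (subst (Increasing n) (sym eq) inc))

  alternating : ∀ n r → Increasing n (suc r) → ¬ Increasing (n ∸ 1) (suc r) → Alternating n (suc r)
  alternating n r inc ¬inc = alternating-by n r inc ¬inc (r <? 84)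

-- Consequences of the recurrence: unimodality, the convolution, the lower bound for the mode

module Triangle
  (a : ℕ → ℕ → ℕ)
  (a-zero-zero : a 0 0 ≡ 1)
  (a-zero-suc : ∀ k → a 0 (suc k) ≡ 0)
  (a-suc-zero : ∀ n → a (suc n) 0 ≡ 0)
  (a-suc-suc : ∀ n k → a (suc n) (suc k) ≡ suc k ℕ.* a n (suc k) ℕ.+ a n k)
  where

  open import Data.Sum.Base using (inj₁; inj₂)

  module _ where
    open import Data.Nat.Base using (_+_; _*_; _≤_; _<_; z≤n; s≤s)
    open import Data.Nat.Properties
    open import Data.Nat.Tactic.RingSolver using (solve-∀)
    open ≤-Reasoning

    -- Log-concavity is the case j = suc i, but the induction on n needs distant pairs. After
    -- expansion by the recurrence each product is compared with one whose indices are one step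
    -- closer. The coefficients permit this because (i + 1) (j + 2) ≤ (i + 2) (j + 1) for i ≤ j and
    -- (i + 1) + (j + 2) = (i + 2) + (j + 1).
    a-totallyPositive : ∀ n {i j} → i ≤ j → a n i * a n (suc j) ≤ a n (suc i) * a n j
    a-totallyPositive zero {i} {j} _ = begin
      a 0 i * a 0 (suc j)  ≡⟨ cong (a 0 i *_) (a-zero-suc j) ⟩
      a 0 i * 0            ≡⟨ *-zeroʳ (a 0 i) ⟩
      0                    ≤⟨ z≤n ⟩
      a 0 (suc i) * a 0 j  ∎
    a-totallyPositive (suc n) {zero} {j} _ = begin
      a (suc n) 0 * a (suc n) (suc j)  ≡⟨ cong (_* a (suc n) (suc j)) (a-suc-zero n) ⟩
      0                                ≤⟨ z≤n ⟩
      a (suc n) 1 * a (suc n) j        ∎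
    a-totallyPositive (suc n) {suc i} {suc j} (s≤s i≤j) with m≤n⇒m<n∨m≡n i≤j
    ... | inj₂ refl = ≤-reflexive (*-comm (a (suc n) (suc i)) (a (suc n) (suc (suc j))))
    ... | inj₁ i<j  = begin
      a (suc n) (suc i) * a (suc n) (suc (suc j))
        ≡⟨ cong₂ _*_ (a-suc-suc n i) (a-suc-suc n (suc j)) ⟩
      (suc i * B + A) * (suc (suc j) * F + E)
        ≡⟨ expandˡ i j A B E F ⟩
      suc i * suc (suc j) * (B * F) + (suc i * (B * E) + suc (suc j) * (A * F)) + A * E
        ≤⟨ +-mono-≤ (+-mono-≤ (*-mono-≤ coefficients (a-totallyPositive n (s≤s i≤j)))
             (+-monoʳ-≤ (suc i * (B * E)) (*-monoʳ-≤ (suc (suc j)) (a-totallyPositive n (m≤n⇒m≤1+n i≤j)))))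
             (a-totallyPositive n i≤j) ⟩
      suc (suc i) * suc j * (C * E) + (suc i * (B * E) + suc (suc j) * (B * E)) + B * D
        ≡⟨ cong (λ m → suc (suc i) * suc j * (C * E) + m + B * D) (regroup i j (B * E)) ⟩
      suc (suc i) * suc j * (C * E) + (suc (suc i) * (B * E) + suc j * (B * E)) + B * D
        ≤⟨ +-monoˡ-≤ (B * D) (+-monoʳ-≤ (suc (suc i) * suc j * (C * E))
             (+-monoˡ-≤ (suc j * (B * E)) (*-monoʳ-≤ (suc (suc i)) (a-totallyPositive n i<j)))) ⟩
      suc (suc i) * suc j * (C * E) + (suc (suc i) * (C * D) + suc j * (B * E)) + B * D
        ≡⟨ expandʳ i j B C D E ⟩
      (suc (suc i) * C + B) * (suc j * E + D)
        ≡⟨ sym (cong₂ _*_ (a-suc-suc n (suc i)) (a-suc-suc n j)) ⟩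
      a (suc n) (suc (suc i)) * a (suc n) (suc j) ∎
      where
      A = a n i
      B = a n (suc i)
      C = a n (suc (suc i))
      D = a n j
      E = a n (suc j)
      F = a n (suc (suc j))
      coefficients : suc i * suc (suc j) ≤ suc (suc i) * suc j
      coefficients = begin
        suc i * suc (suc j)    ≡⟨ lemma₁ i j ⟩
        i + suc i * suc j + 1  ≤⟨ +-monoˡ-≤ 1 (+-monoˡ-≤ (suc i * suc j) i≤j) ⟩
        j + suc i * suc j + 1  ≡⟨ lemma₂ i j ⟩
        suc (suc i) * suc j    ∎
        where
        lemma₁ : ∀ i j → suc i * suc (suc j) ≡ i + suc i * suc j + 1
        lemma₁ = solve-∀
        lemma₂ : ∀ i j → j + suc i * suc j + 1 ≡ suc (suc i) * suc j
        lemma₂ = solve-∀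
      expandˡ : ∀ i j A B E F → (suc i * B + A) * (suc (suc j) * F + E) ≡
        suc i * suc (suc j) * (B * F) + (suc i * (B * E) + suc (suc j) * (A * F)) + A * E
      expandˡ = solve-∀
      regroup : ∀ i j m → suc i * m + suc (suc j) * m ≡ suc (suc i) * m + suc j * m
      regroup = solve-∀
      expandʳ : ∀ i j B C D E →
        suc (suc i) * suc j * (C * E) + (suc (suc i) * (C * D) + suc j * (B * E)) + B * D ≡
        (suc (suc i) * C + B) * (suc j * E + D)
      expandʳ = solve-∀

    -- aᵢ aₖ₊₁ ≤ aᵢ₊₁ aₖ ≤ aᵢ₊₁ aₖ₊₁, and aₖ₊₁ is positive because it exceeds aₖ.
    a-unimodal : ∀ n {k} → a n k < a n (suc k) → ∀ {i} → i ≤ k → a n i ≤ a n (suc i)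
    a-unimodal n {k} aₖ<aₖ₊₁ {i} i≤k =
      *-cancelʳ-≤ (a n i) (a n (suc i)) (a n (suc k)) {{ℕ.>-nonZero (≤-<-trans z≤n aₖ<aₖ₊₁)}}
        (≤-trans (a-totallyPositive n i≤k) (*-monoʳ-≤ (a n (suc i)) (<⇒≤ aₖ<aₖ₊₁)))

  open FallingFactorial
  open import Data.Integer.Base using (ℤ; +_; -[1+_]; 0ℤ; 1ℤ; -1ℤ; _+_; _*_; _-_; -_; _≤_; _<_; +≤+; +<+; nonNegative)
  open import Data.Integer.Properties
  open import Data.Integer.Tactic.RingSolver using (solve-∀)
  open import Data.Nat.Base using (_∸_)
  open import Relation.Nullary.Decidable using (yes; no)
  open import Relation.Nullary.Negation using (contradiction)
  open Mode using (term; Alternating; Increasing; increasing?; increasing-pred; alternating)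

  module _ (n : ℕ) where
    A d : ℕ → ℤ
    A k = + a n k
    d k = A k - prev A k

  -- The convolution formula for c j, multiplied by j !. The upper limit r is free so that sums for
  -- different j can be combined termwise.
  power : ∀ n {r j} → j ℕ.≤ r → + (j ℕ.^ n) ≡ ∑≤ r (λ k → A n k * + (j ↓ k))
  power zero {r} {j} _ = sym (lemma r)
    where
    lemma : ∀ r → ∑≤ r (λ k → A 0 k * + (j ↓ k)) ≡ 1ℤ
    lemma zero    = cong (λ x → + x * 1ℤ) a-zero-zero
    lemma (suc r) = cong₂ _+_ (lemma r) (trans (cong (λ x → + x * + (j ↓ suc r)) (a-zero-suc r)) (*-zeroˡ (+ (j ↓ suc r))))
  power (suc n) {r} {j} j≤r = begin
    + (j ℕ.* j ℕ.^ n)                          ≡⟨ pos-* j (j ℕ.^ n) ⟩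
    + j * + (j ℕ.^ n)                          ≡⟨ cong (+ j *_) (power n j≤r) ⟩
    + j * ∑≤ r (λ k → A n k * + (j ↓ k))       ≡⟨ sym (∑≤-* (+ j) (λ k → A n k * + (j ↓ k)) r) ⟩
    ∑≤ r (λ k → + j * (A n k * + (j ↓ k)))     ≡⟨ ∑≤-cong split r ⟩
    ∑≤ r (λ k → A n k * + (j ↓ suc k) + + k * A n k * + (j ↓ k))
      ≡⟨ ∑≤-+ (λ k → A n k * + (j ↓ suc k)) (λ k → + k * A n k * + (j ↓ k)) r ⟩
    ∑≤ r (λ k → A n k * + (j ↓ suc k)) + ∑≤ r (λ k → + k * A n k * + (j ↓ k))
      ≡⟨ cong (_+ ∑≤ r (λ k → + k * A n k * + (j ↓ k))) (∑≤-shift (A n) (λ k → + (j ↓ k)) r (cong +_ (↓-zero (ℕ.s≤s j≤r)))) ⟩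
    ∑≤ r (λ k → prev (A n) k * + (j ↓ k)) + ∑≤ r (λ k → + k * A n k * + (j ↓ k))
      ≡⟨ sym (∑≤-+ (λ k → prev (A n) k * + (j ↓ k)) (λ k → + k * A n k * + (j ↓ k)) r) ⟩
    ∑≤ r (λ k → prev (A n) k * + (j ↓ k) + + k * A n k * + (j ↓ k))
      ≡⟨ ∑≤-cong (λ k → trans (sym (*-distribʳ-+ (+ (j ↓ k)) (prev (A n) k) (+ k * A n k))) (cong (_* + (j ↓ k)) (recurrence k))) r ⟩
    ∑≤ r (λ k → A (suc n) k * + (j ↓ k))       ∎
    where
    open ≡-Reasoning
    split : ∀ k → + j * (A n k * + (j ↓ k)) ≡ A n k * + (j ↓ suc k) + + k * A n k * + (j ↓ k)
    split k = begin
      + j * (A n k * + (j ↓ k))                       ≡⟨ lemma₁ (+ j) (A n k) (+ (j ↓ k)) ⟩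
      A n k * (+ j * + (j ↓ k))                       ≡⟨ cong (A n k *_) (trans (sym (pos-* j (j ↓ k))) (cong +_ (j*↓ j k))) ⟩
      A n k * + ((j ↓ suc k) ℕ.+ k ℕ.* (j ↓ k))       ≡⟨ cong (λ x → A n k * (+ (j ↓ suc k) + x)) (pos-* k (j ↓ k)) ⟩
      A n k * (+ (j ↓ suc k) + + k * + (j ↓ k))       ≡⟨ lemma₂ (A n k) (+ (j ↓ suc k)) (+ k) (+ (j ↓ k)) ⟩
      A n k * + (j ↓ suc k) + + k * A n k * + (j ↓ k) ∎
      where
      lemma₁ : ∀ x y z → x * (y * z) ≡ y * (x * z)
      lemma₁ = solve-∀
      lemma₂ : ∀ x y z w → x * (y + z * w) ≡ x * y + z * x * w
      lemma₂ = solve-∀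
    recurrence : ∀ k → prev (A n) k + + k * A n k ≡ A (suc n) k
    recurrence zero    = cong +_ (sym (a-suc-zero n))
    recurrence (suc k) = begin
      A n k + + suc k * A n (suc k)              ≡⟨ cong (_+_ (A n k)) (sym (pos-* (suc k) (a n (suc k)))) ⟩
      + (a n k ℕ.+ suc k ℕ.* a n (suc k))        ≡⟨ cong +_ (trans (ℕ.+-comm (a n k) _) (sym (a-suc-suc n k))) ⟩
      A (suc n) (suc k)                          ∎

  -- j ! times the difference δ j of c. At j = 0 the factor j annuls the truncated subtraction.
  Δ : ℕ → ℕ → ℤ
  Δ n j = + (j ℕ.^ n) - + (j ℕ.* (j ∸ 1) ℕ.^ n)

  -- As j ((j - 1) ↓ k) = j ↓ suc k, the subtracted sum is the first one with its coefficients
  -- shifted by one index, so differencing passes from c to a.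
  Δ-sum : ∀ n {r j} → j ℕ.≤ r → Δ n j ≡ ∑≤ r (λ k → d n k * + (j ↓ k))
  Δ-sum n {r} {j} j≤r = begin
    + (j ℕ.^ n) - + (j ℕ.* (j ∸ 1) ℕ.^ n)
      ≡⟨ cong₂ (λ x y → x - y) (power n j≤r) (lower j j≤r) ⟩
    ∑≤ r (λ k → A n k * + (j ↓ k)) - ∑≤ r (λ k → prev (A n) k * + (j ↓ k))
      ≡⟨ cong (_+_ (∑≤ r (λ k → A n k * + (j ↓ k)))) (trans (sym (-1*i≡-i _)) (sym (∑≤-* -1ℤ (λ k → prev (A n) k * + (j ↓ k)) r))) ⟩
    ∑≤ r (λ k → A n k * + (j ↓ k)) + ∑≤ r (λ k → -1ℤ * (prev (A n) k * + (j ↓ k)))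
      ≡⟨ sym (∑≤-+ (λ k → A n k * + (j ↓ k)) (λ k → -1ℤ * (prev (A n) k * + (j ↓ k))) r) ⟩
    ∑≤ r (λ k → A n k * + (j ↓ k) + -1ℤ * (prev (A n) k * + (j ↓ k)))
      ≡⟨ ∑≤-cong (λ k → lemma (A n k) (prev (A n) k) (+ (j ↓ k))) r ⟩
    ∑≤ r (λ k → d n k * + (j ↓ k)) ∎
    where
    open ≡-Reasoning
    lemma : ∀ x y z → x * z + -1ℤ * (y * z) ≡ (x - y) * z
    lemma = solve-∀
    lower : ∀ j → j ℕ.≤ r → + (j ℕ.* (j ∸ 1) ℕ.^ n) ≡ ∑≤ r (λ k → prev (A n) k * + (j ↓ k))
    lower zero    _   = sym (trans (∑≤-cong zeros r) (∑≤-zero r))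
      where
      zeros : ∀ k → prev (A n) k * + (zero ↓ k) ≡ 0ℤ
      zeros zero    = refl
      zeros (suc k) = *-zeroʳ (A n k)
    lower (suc j) 1+j≤r = begin
      + (suc j ℕ.* j ℕ.^ n)                              ≡⟨ pos-* (suc j) (j ℕ.^ n) ⟩
      + suc j * + (j ℕ.^ n)                              ≡⟨ cong (+ suc j *_) (power n (ℕ.≤-trans (ℕ.n≤1+n j) 1+j≤r)) ⟩
      + suc j * ∑≤ r (λ k → A n k * + (j ↓ k))           ≡⟨ sym (∑≤-* (+ suc j) (λ k → A n k * + (j ↓ k)) r) ⟩
      ∑≤ r (λ k → + suc j * (A n k * + (j ↓ k)))         ≡⟨ ∑≤-cong (λ k → trans (swap₁ (+ suc j) (A n k) (+ (j ↓ k)))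
                                                              (cong (A n k *_) (sym (pos-* (suc j) (j ↓ k))))) r ⟩
      ∑≤ r (λ k → A n k * + (suc j ↓ suc k))             ≡⟨ ∑≤-shift (A n) (λ k → + (suc j ↓ k)) r (cong +_ (↓-zero (ℕ.s≤s 1+j≤r))) ⟩
      ∑≤ r (λ k → prev (A n) k * + (suc j ↓ k))          ∎
      where
      swap₁ : ∀ x y z → x * (y * z) ≡ y * (x * z)
      swap₁ = solve-∀

  d-nonNeg : ∀ n k → a n k ℕ.≤ a n (suc k) → 0ℤ ≤ d n (suc k)
  d-nonNeg n k aₖ≤aₖ₊₁ = i≤j⇒0≤j-i (+≤+ aₖ≤aₖ₊₁)

  d-zero-nonNeg : ∀ n → 0ℤ ≤ d n 0
  d-zero-nonNeg n = subst (0ℤ ≤_) (sym (+-identityʳ (A n 0))) (+≤+ ℕ.z≤n)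

  -- All terms of `Δ-sum` are nonnegative: growth of a passes to kⁿ / k !, as the upper bound
  -- requires.
  a-increasing⇒power : ∀ n j → (∀ {k} → k ℕ.< j → a n k ℕ.≤ a n (suc k)) → j ℕ.* (j ∸ 1) ℕ.^ n ℕ.≤ j ℕ.^ n
  a-increasing⇒power n j increasing = drop‿+≤+ (0≤i-j⇒j≤i (subst (0ℤ ≤_) (sym (Δ-sum n {j} ℕ.≤-refl))
    (subst (_≤ ∑≤ j (λ k → d n k * + (j ↓ k))) (∑≤-zero j) (∑≤-mono j nonNeg))))
    where
    nonNeg : ∀ {k} → k ℕ.≤ j → 0ℤ ≤ d n k * + (j ↓ k)
    nonNeg {zero}  _   = *-monoʳ-≤-nonNeg (+ (j ↓ 0)) (d-zero-nonNeg n)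
    nonNeg {suc k} k<j = *-monoʳ-≤-nonNeg (+ (j ↓ suc k)) (d-nonNeg n k (increasing k<j))

  -- 6 r ! (δ r - δ (r - 1) + δ (r - 2) / 2 - δ (r - 3) / 6); the factors r ↓ l turn (r - l)! into r
  -- !.
  Φ : ℕ → ℕ → ℤ
  Φ n r = + 6 * Δ n r - + 6 * (+ (r ↓ 1) * Δ n (r ∸ 1)) + + 3 * (+ (r ↓ 2) * Δ n (r ∸ 2)) - + (r ↓ 3) * Δ n (r ∸ 3)

  -- 6 r ! times the coefficient of t^(r - k) in e^t (1 - t + t²/2 - t³/6).
  W : ℕ → ℕ → ℤ
  W r k = + 6 * + (r ↓ k) - + 6 * + (r ↓ (1 ℕ.+ k)) + + 3 * + (r ↓ (2 ℕ.+ k)) - + (r ↓ (3 ℕ.+ k))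

  Φ-sum : ∀ n r → Φ n r ≡ ∑≤ r (λ k → d n k * W r k)
  Φ-sum n r = begin
    Φ n r
      ≡⟨ cong₄ (Δ-sum n {r} ℕ.≤-refl) (T-term 1) (T-term 2) (T-term 3) ⟩
    + 6 * T 0 - + 6 * T 1 + + 3 * T 2 - T 3
      ≡⟨ lemma₁ (T 0) (T 1) (T 2) (T 3) ⟩
    (+ 6 * T 0 + -[1+ 5 ] * T 1) + (+ 3 * T 2 + -1ℤ * T 3)
      ≡⟨ cong₂ _+_ (combine (+ 6) -[1+ 5 ] 0 1) (combine (+ 3) -1ℤ 2 3) ⟩
    ∑≤ r (λ k → + 6 * t 0 k + -[1+ 5 ] * t 1 k) + ∑≤ r (λ k → + 3 * t 2 k + -1ℤ * t 3 k)
      ≡⟨ sym (∑≤-+ _ _ r) ⟩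
    ∑≤ r (λ k → (+ 6 * t 0 k + -[1+ 5 ] * t 1 k) + (+ 3 * t 2 k + -1ℤ * t 3 k))
      ≡⟨ ∑≤-cong (λ k → lemma₂ (d n k) (+ (r ↓ k)) (+ (r ↓ (1 ℕ.+ k))) (+ (r ↓ (2 ℕ.+ k))) (+ (r ↓ (3 ℕ.+ k)))) r ⟩
    ∑≤ r (λ k → d n k * W r k) ∎
    where
    open ≡-Reasoning
    t : ℕ → ℕ → ℤ
    t l k = d n k * + (r ↓ (l ℕ.+ k))
    T : ℕ → ℤ
    T l = ∑≤ r (t l)
    cong₄ : ∀ {x x′ y y′ z z′ w w′} → x ≡ x′ → y ≡ y′ → z ≡ z′ → w ≡ w′ →
      + 6 * x - + 6 * y + + 3 * z - w ≡ + 6 * x′ - + 6 * y′ + + 3 * z′ - w′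
    cong₄ refl refl refl refl = refl
    T-term : ∀ l → + (r ↓ l) * Δ n (r ∸ l) ≡ T l
    T-term l = begin
      + (r ↓ l) * Δ n (r ∸ l)                                    ≡⟨ cong (+ (r ↓ l) *_) (Δ-sum n (ℕ.m∸n≤m r l)) ⟩
      + (r ↓ l) * ∑≤ r (λ k → d n k * + ((r ∸ l) ↓ k))           ≡⟨ sym (∑≤-* (+ (r ↓ l)) _ r) ⟩
      ∑≤ r (λ k → + (r ↓ l) * (d n k * + ((r ∸ l) ↓ k)))         ≡⟨ ∑≤-cong (λ k → trans (lemma (+ (r ↓ l)) (d n k) _)
                                                                      (cong (d n k *_) (trans (sym (pos-* (r ↓ l) _)) (cong +_ (sym (↓-+ r l k)))))) r ⟩
      T l                                                        ∎
      where
      lemma : ∀ x y z → x * (y * z) ≡ y * (x * z)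
      lemma = solve-∀
    combine : ∀ x y l m → x * T l + y * T m ≡ ∑≤ r (λ k → x * t l k + y * t m k)
    combine x y l m = sym (trans (∑≤-+ _ _ r) (cong₂ _+_ (∑≤-* x (t l) r) (∑≤-* y (t m) r)))
    lemma₁ : ∀ x y z w → + 6 * x - + 6 * y + + 3 * z - w ≡ (+ 6 * x + -[1+ 5 ] * y) + (+ 3 * z + -1ℤ * w)
    lemma₁ = solve-∀
    lemma₂ : ∀ d x y z w → (+ 6 * (d * x) + -[1+ 5 ] * (d * y)) + (+ 3 * (d * z) + -1ℤ * (d * w)) ≡
      d * (+ 6 * x - + 6 * y + + 3 * z - w)
    lemma₂ = solve-∀

  -- For k = r − i the weight is (r ↓ k) (1 − i)(2 − i)(3 − i).
  W-≤0 : ∀ r k → k ℕ.< r → W r k ≤ 0ℤ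
  W-≤0 r k k<r with r ∸ suc k | ℕ.m∸n+n≡m k<r
  ... | i | refl = subst (_≤ 0ℤ) (sym eq) (nonPos i)
    where
    open ≡-Reasoning
    R = i ℕ.+ suc k
    p = + (R ↓ k)
    ↓₁ : + (R ↓ (1 ℕ.+ k)) ≡ + suc i * p
    ↓₁ = trans (cong +_ (subst (λ r → r ↓ suc k ≡ suc i ℕ.* (r ↓ k)) (sym (ℕ.+-suc i k)) (↓-suc (suc i) k))) (pos-* (suc i) (R ↓ k))
    ↓₂ : + (R ↓ (2 ℕ.+ k)) ≡ + i * (+ suc i * p)
    ↓₂ = trans (cong +_ (↓-suc i (suc k))) (trans (pos-* i (R ↓ suc k)) (cong (+ i *_) ↓₁))
    -- The factor i - 1 is formed in ℤ; at i = 0 both falling factorials vanish.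
    ↓₃ : ∀ i → + ((i ℕ.+ suc k) ↓ (3 ℕ.+ k)) ≡ (+ i - 1ℤ) * + ((i ℕ.+ suc k) ↓ (2 ℕ.+ k))
    ↓₃ zero    = trans (cong +_ (↓-zero {suc k} {3 ℕ.+ k} (ℕ.n≤1+n _))) (sym (trans (cong (λ x → -1ℤ * + x) (↓-zero {suc k} {2 ℕ.+ k} ℕ.≤-refl)) refl))
    ↓₃ (suc i) = trans (cong +_ (subst (λ r → r ↓ (3 ℕ.+ k) ≡ i ℕ.* (r ↓ (2 ℕ.+ k))) (ℕ.+-suc i (suc k)) (↓-suc i (suc (suc k)))))
      (trans (pos-* i _) (cong (_* + ((suc i ℕ.+ suc k) ↓ (2 ℕ.+ k))) (lemma (+ i))))
      where
      lemma : ∀ x → x ≡ (1ℤ + x) - 1ℤ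
      lemma = solve-∀
    eq : W R k ≡ p * ((1ℤ - + suc i) * ((+ 2 - + suc i) * (+ 3 - + suc i)))
    eq = begin
      W R k ≡⟨ cong₃ ↓₁ ↓₂ (trans (↓₃ i) (cong ((+ i - 1ℤ) *_) ↓₂)) ⟩
      + 6 * p - + 6 * (+ suc i * p) + + 3 * (+ i * (+ suc i * p)) - (+ i - 1ℤ) * (+ i * (+ suc i * p)) ≡⟨ lemma p (+ i) ⟩
      p * ((1ℤ - + suc i) * ((+ 2 - + suc i) * (+ 3 - + suc i))) ∎
      where
      cong₃ : ∀ {y y′ z z′ w w′} → y ≡ y′ → z ≡ z′ → w ≡ w′ →
        + 6 * p - + 6 * y + + 3 * z - w ≡ + 6 * p - + 6 * y′ + + 3 * z′ - w′
      cong₃ refl refl refl = refl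
      lemma : ∀ p i → + 6 * p - + 6 * ((1ℤ + i) * p) + + 3 * (i * ((1ℤ + i) * p)) - (i - 1ℤ) * (i * ((1ℤ + i) * p)) ≡
        p * ((1ℤ - (1ℤ + i)) * ((+ 2 - (1ℤ + i)) * (+ 3 - (1ℤ + i))))
      lemma = solve-∀
    nonPos : ∀ i → + ((i ℕ.+ suc k) ↓ k) * ((1ℤ - + suc i) * ((+ 2 - + suc i) * (+ 3 - + suc i))) ≤ 0ℤ
    nonPos i = subst (+ ((i ℕ.+ suc k) ↓ k) * _ ≤_) (*-zeroʳ (+ ((i ℕ.+ suc k) ↓ k)))
      (*-monoˡ-≤-nonNeg (+ ((i ℕ.+ suc k) ↓ k)) (cubic i))
      where
      cubic : ∀ i → (1ℤ - + suc i) * ((+ 2 - + suc i) * (+ 3 - + suc i)) ≤ 0ℤ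
      cubic 0 = ≤-refl
      cubic 1 = ≤-refl
      cubic (suc (suc i)) = subst (_≤ 0ℤ) (lemma (+ i)) (neg-mono-≤ {0ℤ} (subst (0ℤ ≤_)
          (trans (pos-* (suc (suc i)) (suc i ℕ.* i)) (cong (_*_ (+ suc (suc i))) (pos-* (suc i) i))) (+≤+ ℕ.z≤n)))
        where
        lemma : ∀ x → - ((+ 2 + x) * ((1ℤ + x) * x)) ≡ (1ℤ - (+ 3 + x)) * ((+ 2 - (+ 3 + x)) * (+ 3 - (+ 3 + x)))
        lemma = solve-∀

  W-diagonal-≥0 : ∀ r → 0ℤ ≤ W r r
  W-diagonal-≥0 r = subst (0ℤ ≤_) (sym eq) (*-monoˡ-≤-nonNeg (+ 6) {0ℤ} {+ (r ↓ r)} (+≤+ ℕ.z≤n))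
    where
    beyond : ∀ l → + (r ↓ (suc l ℕ.+ r)) ≡ 0ℤ
    beyond l = cong +_ (↓-zero (ℕ.s≤s (ℕ.m≤n+m r l)))
    lemma : ∀ x → + 6 * x - + 6 * 0ℤ + + 3 * 0ℤ - 0ℤ ≡ + 6 * x
    lemma = solve-∀
    eq : W r r ≡ + 6 * + (r ↓ r)
    eq = trans (cong₂ (λ x y → + 6 * + (r ↓ r) - + 6 * x + + 3 * y - + (r ↓ (3 ℕ.+ r))) (beyond 0) (beyond 1))
      (trans (cong (λ x → + 6 * + (r ↓ r) - + 6 * 0ℤ + + 3 * 0ℤ - x) (beyond 2)) (lemma (+ (r ↓ r))))

  -- If d r were ≤ 0, every term of `Φ-sum` would be nonpositive: the weights are ≤ 0 for k < r,
  -- where d k ≥ 0, and ≥ 0 at k = r.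
  Φ-positive⇒d-positive : ∀ n r → (∀ {k} → k ℕ.< r → 0ℤ ≤ d n k) → 0ℤ < Φ n r → 0ℤ < d n r
  Φ-positive⇒d-positive n r d≥0 Φ>0 = ≰⇒> λ dᵣ≤0 → <⇒≱ Φ>0
    (subst (_≤ 0ℤ) (sym (Φ-sum n r)) (subst (∑≤ r (λ k → d n k * W r k) ≤_) (∑≤-zero r) (∑≤-mono r (nonPos dᵣ≤0))))
    where
    nonPos : d n r ≤ 0ℤ → ∀ {k} → k ℕ.≤ r → d n k * W r k ≤ 0ℤ
    nonPos dᵣ≤0 {k} k≤r with ℕ.m≤n⇒m<n∨m≡n k≤r
    ... | inj₁ k<r  = subst (d n k * W r k ≤_) (*-zeroʳ (d n k)) (*-monoˡ-≤-nonNeg (d n k) {{nonNegative (d≥0 k<r)}} (W-≤0 r k k<r))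
    ... | inj₂ refl = *-monoʳ-≤-nonNeg (W r r) {{nonNegative (W-diagonal-≥0 r)}} dᵣ≤0

  d-positive⇒increasing : ∀ n k → 0ℤ < d n (suc k) → a n k ℕ.< a n (suc k)
  d-positive⇒increasing n k d>0 = ℕ.≰⇒> λ aₖ₊₁≤aₖ → <⇒≱ d>0 (i≤j⇒i-j≤0 (+≤+ aₖ₊₁≤aₖ))

  -- Compare (r + 1) aᵣ₊₁ + aᵣ with r aᵣ + aᵣ₋₁ term by term. The condition on r - 1 is phrased
  -- through suc k ≡ r to be vacuous at r = 0.
  a-increasing-suc : ∀ n r → a n r ℕ.< a n (suc r) → (∀ k → suc k ≡ r → a n k ℕ.≤ a n r) →
    a (suc n) r ℕ.< a (suc n) (suc r)
  a-increasing-suc n zero    a₀<a₁ _ = subst (ℕ._< a (suc n) 1) (sym (a-suc-zero n)) (subst (0 ℕ.<_) (sym (a-suc-suc n 0))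
    (ℕ.<-≤-trans (ℕ.≤-<-trans ℕ.z≤n a₀<a₁) (ℕ.≤-trans (ℕ.m≤m+n (a n 1) 0) (ℕ.m≤m+n (1 ℕ.* a n 1) (a n 0)))))
  a-increasing-suc n (suc r) aᵣ<aᵣ₊₁ below = subst₂ ℕ._<_ (sym (a-suc-suc n r)) (sym (a-suc-suc n (suc r)))
    (ℕ.+-mono-<-≤ (ℕ.≤-<-trans (ℕ.*-monoˡ-≤ (a n (suc r)) (ℕ.n≤1+n (suc r))) (ℕ.*-monoʳ-< (suc (suc r)) aᵣ<aᵣ₊₁)) (below r refl))

  alternating⇒Φ-positive : ∀ n r → Alternating n r → 0ℤ < Φ n r
  alternating⇒Φ-positive n r alt = subst (0ℤ <_) (sym eq) (subst (_< R - L) (+-inverseʳ L) (+-monoˡ-< (- L) (subst₂ _<_ left right (+<+ alt))))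
    where
    open ≡-Reasoning
    e : ℕ → ℤ
    e l = + term n r l
    L R : ℤ
    L = + 12 * e 1 + + 4 * e 3
    R = + 6 * e 0 + + 9 * e 2 + e 4
    left : + (12 ℕ.* term n r 1 ℕ.+ 4 ℕ.* term n r 3) ≡ L
    left = cong₂ _+_ (pos-* 12 (term n r 1)) (pos-* 4 (term n r 3))
    right : + (6 ℕ.* term n r 0 ℕ.+ 9 ℕ.* term n r 2 ℕ.+ term n r 4) ≡ R
    right = cong₂ (λ x y → x + y + e 4) (pos-* 6 (term n r 0)) (pos-* 9 (term n r 2))
    Δ-term : ∀ l → + (r ↓ l) * Δ n (r ∸ l) ≡ e l - e (suc l)
    Δ-term l = begin
      + (r ↓ l) * (+ ((r ∸ l) ℕ.^ n) - + ((r ∸ l) ℕ.* (r ∸ l ∸ 1) ℕ.^ n))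
        ≡⟨ lemma (+ (r ↓ l)) (+ ((r ∸ l) ℕ.^ n)) (+ ((r ∸ l) ℕ.* (r ∸ l ∸ 1) ℕ.^ n)) ⟩
      + (r ↓ l) * + ((r ∸ l) ℕ.^ n) - + (r ↓ l) * + ((r ∸ l) ℕ.* (r ∸ l ∸ 1) ℕ.^ n)
        ≡⟨ cong₂ _-_ (sym (pos-* (r ↓ l) _)) (trans (sym (pos-* (r ↓ l) _)) (cong +_ next)) ⟩
      e l - e (suc l) ∎
      where
      lemma : ∀ x y z → x * (y - z) ≡ x * y - x * z
      lemma = solve-∀
      ↓-sucʳ : (r ↓ l) ℕ.* (r ∸ l) ≡ r ↓ suc l
      ↓-sucʳ = trans (cong ((r ↓ l) ℕ.*_) (one (r ∸ l))) (trans (sym (↓-+ r l 1)) (cong (r ↓_) (ℕ.+-comm l 1)))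
        where
        one : ∀ j → j ≡ j ↓ 1
        one zero    = refl
        one (suc j) = sym (ℕ.*-identityʳ (suc j))
      next : (r ↓ l) ℕ.* ((r ∸ l) ℕ.* (r ∸ l ∸ 1) ℕ.^ n) ≡ term n r (suc l)
      next = trans (sym (ℕ.*-assoc (r ↓ l) (r ∸ l) _)) (cong₂ (λ x y → x ℕ.* y ℕ.^ n) ↓-sucʳ
        (trans (ℕ.∸-+-assoc r l 1) (cong (r ∸_) (ℕ.+-comm l 1))))
    eq : Φ n r ≡ R - L
    eq = begin
      Φ n r
        ≡⟨ cong₄ (trans (sym (*-identityˡ (Δ n r))) (Δ-term 0)) (Δ-term 1) (Δ-term 2) (Δ-term 3) ⟩
      + 6 * (e 0 - e 1) - + 6 * (e 1 - e 2) + + 3 * (e 2 - e 3) - (e 3 - e 4)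
        ≡⟨ lemma (e 0) (e 1) (e 2) (e 3) (e 4) ⟩
      R - L ∎
      where
      cong₄ : ∀ {x x′ y y′ z z′ w w′} → x ≡ x′ → y ≡ y′ → z ≡ z′ → w ≡ w′ →
        + 6 * x - + 6 * y + + 3 * z - w ≡ + 6 * x′ - + 6 * y′ + + 3 * z′ - w′
      cong₄ refl refl refl refl = refl
      lemma : ∀ x y z w v → + 6 * (x - y) - + 6 * (y - z) + + 3 * (z - w) - (w - v) ≡ + 6 * x + + 9 * z + v - (+ 12 * y + + 4 * w)
      lemma = solve-∀

  -- The r of the overview is `suc r` here. Recursion is on n, then r: k < r lowers r by
  -- log-concavity of kⁿ / k !. For k = r, either n can be lowered, or the exponent is the least
  -- possible and `alternating` applies. At exponent 0 the hypothesis reads 3 + r ≤ 1.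
  increasing⇒a-increasing : ∀ n r → Increasing n (suc r) → ∀ {k} → k ℕ.≤ r → a n k ℕ.< a n (suc k)
  increasing⇒a-increasing zero r inc = contradiction inc λ { (ℕ.s≤s ()) }
  increasing⇒a-increasing (suc n) r inc {k} k≤r with ℕ.m≤n⇒m<n∨m≡n k≤r
  increasing⇒a-increasing (suc n) (suc r) inc {k} _ | inj₁ k<1+r =
    increasing⇒a-increasing (suc n) r (increasing-pred (suc n) (suc r) inc) (ℕ.s≤s⁻¹ k<1+r)
  increasing⇒a-increasing (suc n) r inc _ | inj₂ refl with increasing? n (suc r)
  ... | yes inc′ = a-increasing-suc n r (increasing⇒a-increasing n r inc′ ℕ.≤-refl)
    λ { k refl → ℕ.<⇒≤ (increasing⇒a-increasing n r inc′ (ℕ.n≤1+n k)) }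
  ... | no ¬inc′ = d-positive⇒increasing (suc n) r
    (Φ-positive⇒d-positive (suc n) (suc r) (below r inc) (alternating⇒Φ-positive (suc n) (suc r) (alternating (suc n) r inc ¬inc′)))
    where
    below : ∀ r → Increasing (suc n) (suc r) → ∀ {k} → k ℕ.< suc r → 0ℤ ≤ d (suc n) k
    below r       inc {zero}  _ = d-zero-nonNeg (suc n)
    below (suc r) inc {suc k} (ℕ.s≤s k<1+r) = d-nonNeg (suc n) k
      (ℕ.<⇒≤ (increasing⇒a-increasing (suc n) r (increasing-pred (suc n) (suc r) inc) (ℕ.s≤s⁻¹ k<1+r)))

-- Partial sums of the exponential series, and the position of e^w

module Exponential where
  open Rationals
  open import Data.Integer.Base using (+_; -[1+_])
  open import Data.Rational.Base using (ℚ; 0ℚ; 1ℚ; ½; _+_; _*_; _-_; -_; _≤_; _<_; _/_; ∣_∣; positive; nonNegative)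
  open import Data.Rational.Properties
  open import Data.Rational.Solver using (module +-*-Solver)
  open import Data.Product.Base using (∃-syntax; proj₁; proj₂)
  open import Data.Sum.Base using (inj₁; inj₂)
  open import Relation.Nullary.Decidable using (decidable-stable)
  open import Relation.Nullary.Negation using (¬_)
  open import Algebra.Bundles using (CommutativeRing)
  open import Algebra.Properties.CommutativeSemiring.Exp (CommutativeRing.commutativeSemiring +-*-commutativeRing) using (_^_; ^-distrib-*)
  open +-*-Solver using (solve; con; _:+_; _:*_; _:-_; :-_; _:=_)
  import Data.Nat.Coprimality as Coprime

  -- Convexity of qⁱ⁺¹ / (i + 1)!: the graph lies above its tangent at p.
  expTerm-tangent : ∀ {p q} → 0ℚ ≤ p → 0ℚ ≤ q → ∀ i → expTerm p (suc i) + (q - p) * expTerm p i ≤ expTerm q (suc i)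
  expTerm-tangent {p} {q} 0≤p 0≤q zero =
    ≤-reflexive (solve 2 (λ p q → con 1ℚ :* (p :* con 1ℚ) :+ (q :- p) :* con 1ℚ := con 1ℚ :* (q :* con 1ℚ)) refl p q)
  expTerm-tangent {p} {q} 0≤p 0≤q (suc i) = begin
    t * (p * r) * (p * s) + (q - p) * (t * (p * r))
      ≡⟨ cong (λ z → t * (p * r) * (p * s) + (q - p) * (t * (p * z))) (recip-step i) ⟩
    t * (p * r) * (p * s) + (q - p) * (t * (p * (s + r * s)))
      ≤⟨ ≤-excess (0≤· (0≤· (expTerm-nonNeg 0≤p i) (0≤recip (suc i))) square-nonNeg)
           (solve 5 (λ t p q r s → (t :* (p :* r) :+ (q :- p) :* t) :* (q :* s) :=
             t :* (p :* r) :* (p :* s) :+ (q :- p) :* (t :* (p :* (s :+ r :* s))) :+ t :* s :* ((q :- p) :* (q :- p))) refl t p q r s) ⟩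
    (t * (p * r) + (q - p) * t) * (q * s)
      ≤⟨ *-monoʳ-≤-nonNeg (q * s) {{nonNegative (0≤· 0≤q (0≤recip (suc i)))}} (expTerm-tangent 0≤p 0≤q i) ⟩
    expTerm q (suc i) * (q * s) ∎
    where
    open ≤-Reasoning
    t = expTerm p i
    r = recip i
    s = recip (suc i)
    square-nonNeg : 0ℚ ≤ (q - p) * (q - p)
    square-nonNeg = subst (0ℚ ≤_) ∣∣² (0≤· (0≤∣p∣ (q - p)) (0≤∣p∣ (q - p)))
      where

      ∣∣² : ∣ q - p ∣ * ∣ q - p ∣ ≡ (q - p) * (q - p)
      ∣∣² with ∣p∣≡p∨∣p∣≡-p (q - p)
      ... | inj₁ eq = cong₂ _*_ eq eq
      ... | inj₂ eq = trans (cong₂ _*_ eq eq) (solve 1 (λ d → (:- d) :* (:- d) := d :* d) refl (q - p))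

  -- expSum p k is the derivative of expSum p (suc k), so this is convexity. It replaces the
  -- functional equation: with q = p + x it bounds growth from below by 1 + x, and read backwards it
  -- bounds it from above by 1 / (1 - x).
  expSum-tangent : ∀ {p q} → 0ℚ ≤ p → 0ℚ ≤ q → ∀ k → expSum p (suc k) + (q - p) * expSum p k ≤ expSum q (suc k)
  expSum-tangent {p} {q} 0≤p 0≤q zero = subst (_≤ 1ℚ + expTerm q 1) (sym (+-assoc 1ℚ (expTerm p 1) ((q - p) * 1ℚ)))
    (+-monoʳ-≤ 1ℚ (expTerm-tangent 0≤p 0≤q 0))
  expSum-tangent {p} {q} 0≤p 0≤q (suc k) = begin
    E + e + (q - p) * (F + f)               ≡⟨ solve 5 (λ E e F f d → E :+ e :+ d :* (F :+ f) := (E :+ d :* F) :+ (e :+ d :* f)) refl E e F f (q - p) ⟩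
    (E + (q - p) * F) + (e + (q - p) * f)   ≤⟨ +-mono-≤ (expSum-tangent 0≤p 0≤q k) (expTerm-tangent 0≤p 0≤q (suc k)) ⟩
    expSum q (suc (suc k))                  ∎
    where
    open ≤-Reasoning
    E = expSum p (suc k)
    F = expSum p k
    e = expTerm p (suc (suc k))
    f = expTerm p (suc k)

  expSum-nonNeg : ∀ {p} → 0ℚ ≤ p → ∀ k → 0ℚ ≤ expSum p k
  expSum-nonNeg 0≤p zero    = nonNegative⁻¹ 1ℚ
  expSum-nonNeg 0≤p (suc k) = +-nonNeg (expSum-nonNeg 0≤p k) (expTerm-nonNeg 0≤p (suc k))

  expSum-suc : ∀ {p} → 0ℚ ≤ p → ∀ k → expSum p k ≤ expSum p (suc k)
  expSum-suc 0≤p k = ≤-step (expTerm-nonNeg 0≤p (suc k))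

  expSum-mono-index : ∀ {p} → 0ℚ ≤ p → ∀ {m n} → m ℕ.≤ n → expSum p m ≤ expSum p n
  expSum-mono-index 0≤p {m} m≤n with k , refl ← ℕ.m≤n⇒∃[o]m+o≡n m≤n = go k
    where
    go : ∀ k → expSum _ m ≤ expSum _ (m ℕ.+ k)
    go zero    rewrite ℕ.+-identityʳ m = ≤-refl
    go (suc k) rewrite ℕ.+-suc m k = ≤-trans (go k) (expSum-suc 0≤p (m ℕ.+ k))

  1≤expSum : ∀ {p} → 0ℚ ≤ p → ∀ k → 1ℚ ≤ expSum p k
  1≤expSum 0≤p k = expSum-mono-index 0≤p {0} {k} ℕ.z≤n

  expSum-mono : ∀ {p q} → 0ℚ ≤ p → p ≤ q → ∀ k → expSum p k ≤ expSum q k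
  expSum-mono 0≤p p≤q zero    = ≤-refl
  expSum-mono 0≤p p≤q (suc k) = ≤-trans (≤-step (0≤· (≤⇒0≤- p≤q) (expSum-nonNeg 0≤p k))) (expSum-tangent 0≤p (≤-trans 0≤p p≤q) k)

  ι-suc-* : ∀ n x → ι (suc n) * x ≡ ι n * x + x
  ι-suc-* n x = trans (cong (λ z → z * x) (ι-suc n)) (solve 2 (λ m x → (con 1ℚ :+ m) :* x := m :* x :+ x) refl (ι n) x)

  -- (1 + y / n)ⁿ ≤ eʸ with y = n x
  ^≤expSum : ∀ {x} → 0ℚ ≤ x → ∀ n → (1ℚ + x) ^ n ≤ expSum (ι n * x) n
  ^≤expSum {x} 0≤x zero    = ≤-refl
  ^≤expSum {x} 0≤x (suc n) = begin
    (1ℚ + x) * (1ℚ + x) ^ n          ≤⟨ *-monoˡ-≤-nonNeg (1ℚ + x) {{nonNegative (+-nonNeg (nonNegative⁻¹ 1ℚ) 0≤x)}} (^≤expSum 0≤x n) ⟩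
    (1ℚ + x) * expSum p n            ≡⟨ solve 3 (λ x E p → (con 1ℚ :+ x) :* E := E :+ (p :+ x :- p) :* E) refl x (expSum p n) p ⟩
    expSum p n + (p + x - p) * expSum p n        ≤⟨ +-monoˡ-≤ _ (expSum-suc 0≤p n) ⟩
    expSum p (suc n) + (p + x - p) * expSum p n  ≤⟨ expSum-tangent 0≤p (+-nonNeg 0≤p 0≤x) n ⟩
    expSum (p + x) (suc n)           ≡⟨ cong (λ z → expSum z (suc n)) (sym (ι-suc-* n x)) ⟩
    expSum (ι (suc n) * x) (suc n)   ∎
    where
    open ≤-Reasoning
    p = ι n * x
    0≤p = 0≤· (0≤ι n) 0≤x

  expSum-zero : ∀ k → expSum 0ℚ k ≡ 1ℚ
  expSum-zero zero    = refl
  expSum-zero (suc k) = trans (cong₂ _+_ (expSum-zero k) (solve 2 (λ t r → t :* (con 0ℚ :* r) := con 0ℚ) refl (expTerm 0ℚ k) (recip k))) (+-identityʳ 1ℚ)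

  -- eʸ ≤ (1 − y / n)⁻ⁿ with y = n x
  expSum*^≤1 : ∀ {x} → 0ℚ ≤ x → x ≤ 1ℚ → ∀ n k → expSum (ι n * x) (suc k) * (1ℚ - x) ^ n ≤ 1ℚ
  expSum*^≤1 {x} 0≤x x≤1 zero    k = ≤-reflexive (trans (*-identityʳ _) (trans (cong (λ z → expSum z (suc k)) (*-zeroˡ x)) (expSum-zero (suc k))))
  expSum*^≤1 {x} 0≤x x≤1 (suc n) k = begin
    expSum (ι (suc n) * x) (suc k) * ((1ℚ - x) * (1ℚ - x) ^ n)   ≡⟨ cong (λ z → expSum z (suc k) * ((1ℚ - x) * (1ℚ - x) ^ n)) (ι-suc-* n x) ⟩
    E * ((1ℚ - x) * (1ℚ - x) ^ n)                      ≡⟨ solve 3 (λ E x p → E :* ((con 1ℚ :- x) :* p) := (E :- x :* E) :* p) refl E x ((1ℚ - x) ^ n) ⟩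
    (E - x * E) * (1ℚ - x) ^ n                         ≤⟨ *-monoʳ-≤-nonNeg ((1ℚ - x) ^ n) {{nonNegative (^-nonNeg (≤⇒0≤- x≤1) n)}} descend ⟩
    expSum p (suc k) * (1ℚ - x) ^ n                    ≤⟨ expSum*^≤1 0≤x x≤1 n k ⟩
    1ℚ                                                 ∎
    where
    open ≤-Reasoning
    p = ι n * x
    0≤p = 0≤· (0≤ι n) 0≤x
    0≤p+x = +-nonNeg 0≤p 0≤x
    E = expSum (p + x) (suc k)
    descend : E - x * E ≤ expSum p (suc k)
    descend = begin
      E - x * E                                    ≤⟨ +-monoʳ-≤ E (neg-antimono-≤ (*-monoˡ-≤-nonNeg x {{nonNegative 0≤x}} (expSum-suc 0≤p+x k))) ⟩
      E - x * expSum (p + x) k                     ≡⟨ solve 4 (λ E x F p → E :- x :* F := E :+ (p :- (p :+ x)) :* F) refl E x (expSum (p + x) k) p ⟩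
      E + (p - (p + x)) * expSum (p + x) k         ≤⟨ expSum-tangent 0≤p+x 0≤p k ⟩
      expSum p (suc k)                             ∎

  -- On [0, 1] the slope of uⁿ is at most n.
  bernoulli : ∀ {u δ} → 0ℚ ≤ δ → δ ≤ u → u ≤ 1ℚ → ∀ n → u ^ n - ι n * δ ≤ (u - δ) ^ n
  bernoulli {u} {δ} 0≤δ δ≤u u≤1 zero    = ≤-reflexive (solve 1 (λ δ → con 1ℚ :- con 0ℚ :* δ := con 1ℚ) refl δ)
  bernoulli {u} {δ} 0≤δ δ≤u u≤1 (suc n) = begin
    u * u ^ n - ι (suc n) * δ              ≡⟨ cong (λ z → u * u ^ n - z) (ι-suc-* n δ) ⟩
    u * u ^ n - (ι n * δ + δ)              ≤⟨ ≤-excess (+-nonNeg (0≤· (≤⇒0≤- u≤1) (0≤· (0≤ι n) 0≤δ)) (0≤· 0≤δ (≤⇒0≤- (^-≤1 0≤u-δ u-δ≤1 n))))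
                                                (solve 5 (λ u p m δ q → u :* (p :- m :* δ) :- δ :* q :=
                                                  (u :* p :- (m :* δ :+ δ)) :+ ((con 1ℚ :- u) :* (m :* δ) :+ δ :* (con 1ℚ :- q))) refl u (u ^ n) (ι n) δ ((u - δ) ^ n)) ⟩
    u * (u ^ n - ι n * δ) - δ * (u - δ) ^ n ≤⟨ +-monoˡ-≤ (- (δ * (u - δ) ^ n)) (*-monoˡ-≤-nonNeg u {{nonNegative (≤-trans 0≤δ δ≤u)}} (bernoulli 0≤δ δ≤u u≤1 n)) ⟩
    u * (u - δ) ^ n - δ * (u - δ) ^ n      ≡⟨ solve 3 (λ u δ q → u :* q :- δ :* q := (u :- δ) :* q) refl u δ ((u - δ) ^ n) ⟩
    (u - δ) * (u - δ) ^ n                  ∎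
    where
    open ≤-Reasoning
    0≤u-δ = ≤⇒0≤- δ≤u
    u-δ≤1 : u - δ ≤ 1ℚ
    u-δ≤1 = ≤-trans (≤-excess 0≤δ (solve 2 (λ u δ → u := (u :- δ) :+ δ) refl u δ)) u≤1

  /1≡ι : ∀ n → + n / 1 ≡ ι n
  /1≡ι n = normalize-coprime (Coprime.sym (Coprime.1-coprimeTo n))

  ∣p-q∣≤⇒p≤ : ∀ p q {ε} → ∣ p - q ∣ ≤ ε → p ≤ q + ε
  ∣p-q∣≤⇒p≤ p q {ε} h = subst (_≤ q + ε) (solve 2 (λ p q → q :+ (p :- q) := p) refl p q)
    (+-monoʳ-≤ q (≤-trans (p≤∣p∣ (p - q)) h))
    where
    p≤∣p∣ : ∀ p → p ≤ ∣ p ∣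
    p≤∣p∣ p with ≤-total 0ℚ p
    ... | inj₁ 0≤p = ≤-reflexive (sym (0≤p⇒∣p∣≡p 0≤p))
    ... | inj₂ p≤0 = ≤-trans p≤0 (0≤∣p∣ p)

  module _ (n : ℕ) (w : ℝ) (lambert : IsLambertW n w) where
    private
      ω = proj₁ (proj₁ lambert)
      0<ω = proj₁ (proj₂ (proj₁ lambert))

    -- ω is the rational gap that witnesses 0 < w. Bounding w below by a fixed positive number lets
    -- tolerances be scaled by w.
    eventually : ∀ ε → 0ℚ < ε → ∃[ N ] ∀ k → N ℕ.≤ k →
      ω ≤ seq w k × ∣ seq w k * expSum (seq w k) k - ι n ∣ ≤ ε
    eventually ε 0<ε =
      let _ , _ , N₁ , ω+0≤w = proj₁ lambert
          N₂ , close = proj₂ lambert ε 0<ε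
      in N₁ ℕ.+ N₂ , λ k N≤k →
        subst (_≤ seq w k) (+-identityˡ ω) (ω+0≤w k (ℕ.≤-trans (ℕ.m≤m+n N₁ N₂) N≤k)) ,
        subst (λ z → ∣ seq w k * expSum (seq w k) k - z ∣ ≤ ε) (/1≡ι n) (close k (ℕ.≤-trans (ℕ.m≤n+m N₂ N₁) N≤k))

    -- For B = M + 1, e^w < B and w e^w = n give n / B ≤ w, hence (1 + 1/B)ⁿ ≤ e^(n/B) ≤ e^w ≤ B;
    -- then multiply by Bⁿ.
    exp<⇒^≤ : ∀ M → exp w Defs.< fromℤ (+ suc M) → (2 ℕ.+ M) ℕ.^ n ℕ.≤ suc M ℕ.* suc M ℕ.^ n
    -- The tolerance ε ω ≤ ε v is absorbed by the gap ε between e^w and B: n ≤ v E + ε v = v (E + ε)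
    -- ≤ v B.
    exp<⇒^≤ M (ε , 0<ε , N , E+ε≤) with eventually (ε * ω) (0<· 0<ε 0<ω)
    ... | N′ , ev = ι-cancel-≤ (subst₂ _≤_ left (trans (cong (λ z → B * z) (sym (ι-^ (suc M) n))) (sym (ι-* (suc M) (suc M ℕ.^ n))))
      (≤-trans (*-monoˡ-≤-nonNeg (B ^ n) {{nonNegative (^-nonNeg (0≤ι (suc M)) n)}} bound) (≤-reflexive (*-comm (B ^ n) B))))
      where
      open ≤-Reasoning
      -- k ≥ n, so the partial sum E also dominates the one of index n that `^≤expSum` supplies.
      k = n ℕ.+ (N ℕ.+ N′)
      B = ι (suc M)
      y = recip M
      v = seq w k
      E = expSum v k
      ω≤v = proj₁ (ev k (ℕ.≤-trans (ℕ.m≤n+m N′ N) (ℕ.m≤n+m (N ℕ.+ N′) n)))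
      close = proj₂ (ev k (ℕ.≤-trans (ℕ.m≤n+m N′ N) (ℕ.m≤n+m (N ℕ.+ N′) n)))
      0≤v = ≤-trans (<⇒≤ 0<ω) ω≤v
      E+ε≤B : E + ε ≤ B
      E+ε≤B = subst (E + ε ≤_) (/1≡ι (suc M)) (E+ε≤ k (ℕ.≤-trans (ℕ.m≤m+n N N′) (ℕ.m≤n+m (N ℕ.+ N′) n)))
      By≡1 : B * y ≡ 1ℚ
      By≡1 = trans (*-comm B y) (recip-inverse M)
      n≤Bv : ι n ≤ B * v
      n≤Bv = begin
        ι n                          ≤⟨ ∣p-q∣≤⇒p≤ (ι n) (v * E) (subst (_≤ ε * ω) (∣p-q∣≡∣q-p∣ (v * E) (ι n)) close) ⟩
        v * E + ε * ω                ≤⟨ +-monoʳ-≤ (v * E) (*-monoˡ-≤-nonNeg ε {{nonNegative (<⇒≤ 0<ε)}} ω≤v) ⟩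
        v * E + ε * v                ≡⟨ solve 3 (λ v E ε → v :* E :+ ε :* v := v :* (E :+ ε)) refl v E ε ⟩
        v * (E + ε)                  ≤⟨ *-monoˡ-≤-nonNeg v {{nonNegative 0≤v}} E+ε≤B ⟩
        v * B                        ≡⟨ *-comm v B ⟩
        B * v                        ∎
      ny≤v : ι n * y ≤ v
      ny≤v = *-cancelˡ-≤-pos B (≤-trans (≤-reflexive (trans (solve 3 (λ B n y → B :* (n :* y) := n :* (B :* y)) refl B (ι n) y)
        (trans (cong (λ z → ι n * z) By≡1) (*-identityʳ (ι n))))) n≤Bv)
      bound : (1ℚ + y) ^ n ≤ B
      bound = begin
        (1ℚ + y) ^ n          ≤⟨ ^≤expSum (0≤recip M) n ⟩
        expSum (ι n * y) n    ≤⟨ expSum-mono-index (0≤· (0≤ι n) (0≤recip M)) (ℕ.m≤m+n n (N ℕ.+ N′)) ⟩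
        expSum (ι n * y) k    ≤⟨ expSum-mono (0≤· (0≤ι n) (0≤recip M)) ny≤v k ⟩
        E                     ≤⟨ ≤-step (<⇒≤ 0<ε) ⟩
        E + ε                 ≤⟨ E+ε≤B ⟩
        B                     ∎
      left : B ^ n * (1ℚ + y) ^ n ≡ ι ((2 ℕ.+ M) ℕ.^ n)
      left = trans (sym (^-distrib-* B (1ℚ + y) n)) (trans (cong (λ z → z ^ n)
        (trans (solve 2 (λ B y → B :* (con 1ℚ :+ y) := B :* y :+ B) refl B y) (trans (cong (λ z → z + B) By≡1) (sym (ι-suc (suc M))))))
        (sym (ι-^ (2 ℕ.+ M) n)))

    -- Contrapositive, allowed because the conclusion is decidable. Let B = r + 2 and B (1 - 1/B)ⁿ >
    -- 1. Were e^w ≥ B, then w ≤ n / B and e^w ≤ (1 - 1/B)⁻ⁿ < B. Since e^w < B must come with a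
    -- uniform gap, B and 1/B are perturbed.
    ≤exp⇒increasing : 1 ℕ.≤ n → ∀ r → fromℤ (+ (2 ℕ.+ r)) Defs.≤ exp w → (2 ℕ.+ r) ℕ.* (1 ℕ.+ r) ℕ.^ n ℕ.≤ (2 ℕ.+ r) ℕ.^ n
    ≤exp⇒increasing 1≤n r B≤exp = decidable-stable (_ ℕ.≤? _) λ ¬inc → B≤exp (below (1<Q ¬inc))
      where
      B = ι (2 ℕ.+ r)
      u = T (suc r)
      ρ = recip (suc r)
      Bρ≡1 : B * ρ ≡ 1ℚ
      Bρ≡1 = trans (*-comm B ρ) (recip-inverse (suc r))
      1≤B : 1ℚ ≤ B
      1≤B = ι-mono-≤ {1} {2 ℕ.+ r} (ℕ.s≤s ℕ.z≤n)
      1<Q : ¬ (2 ℕ.+ r) ℕ.* (1 ℕ.+ r) ℕ.^ n ℕ.≤ (2 ℕ.+ r) ℕ.^ n → 1ℚ < Q n (suc r)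
      1<Q ¬inc = *-cancelˡ-<-nonNeg (B ^ n) {{nonNegative (^-nonNeg (0≤ι (2 ℕ.+ r)) n)}} (subst₂ _<_
        (trans (ι-^ (2 ℕ.+ r) n) (sym (*-identityʳ (B ^ n))))
        (trans (ι-* (2 ℕ.+ r) ((1 ℕ.+ r) ℕ.^ n)) (trans (cong (λ z → B * z) (ι-^ (1 ℕ.+ r) n)) (sym (ι^*Q n (suc r)))))
        (ι-mono-< (ℕ.≰⇒> ¬inc)))
        where
        ι-mono-< : ∀ {m n} → m ℕ.< n → ι m < ι n
        ι-mono-< {m} {n} m<n = <-≤-trans (subst₂ _<_ (+-identityˡ (ι m)) (sym (ι-suc m)) (+-monoˡ-< (ι m) (positive⁻¹ 1ℚ))) (ι-mono-≤ m<n)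
      below : 1ℚ < Q n (suc r) → exp w Defs.< fromℤ (+ (2 ℕ.+ r))
      -- For δ = recip j, the excess Q - 1 covers B n δ, the loss in `bernoulli`, and B δ, which
      -- pays for lowering B to Y and for strictness.
      below 1<Q = let j , Cδ≤θ = shrink (B * (1ℚ + ι n)) (Q n (suc r) - 1ℚ) (<⇒0<- 1<Q) in below-by j Cδ≤θ
        where
        below-by : ∀ j → B * (1ℚ + ι n) * recip j ≤ Q n (suc r) - 1ℚ → exp w Defs.< fromℤ (+ (2 ℕ.+ r))
        below-by j Cδ≤θ = let N , ev = eventually (recip j * ½) (0<half (0<recip j)) in
          ε , 0<half (0<half 0<δ) , suc N , λ { (suc k) (ℕ.s≤s N≤k) →
            subst (expSum (seq w (suc k)) (suc k) + ε ≤_) (sym (/1≡ι (2 ℕ.+ r))) (main k (ev (suc k) (ℕ.m≤n⇒m≤1+n N≤k))) }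
          where
          -- Y lies slightly below B and x slightly above 1/B, so that n + δ/2 ≤ n x Y leaves room
          -- for the tolerance in w e^w ≈ n, while Y (1 - x)ⁿ stays above 1.
          δ ε Y x : ℚ
          δ = recip j
          ε = δ * ½ * ½
          Y = B - ε
          x = ρ + δ
          0<δ = 0<recip j
          0≤δ = 0≤recip j
          0≤ε = <⇒≤ (0<half (0<half 0<δ))
          0≤½ = nonNegative⁻¹ ½
          ε≤δ : ε ≤ δ
          ε≤δ = ≤-excess (0≤· 0≤δ (nonNegative⁻¹ (+ 3 / 4))) (solve 1 (λ δ → δ := δ :* con ½ :* con ½ :+ δ :* con (+ 3 / 4)) refl δ)
          δ≤u : δ ≤ u
          δ≤u = *-cancelˡ-≤-pos B (begin
            B * δ                        ≤⟨ ≤-excess (0≤· (0≤· (0≤ι (2 ℕ.+ r)) (0≤ι n)) 0≤δ) (solve 3 (λ B n δ → B :* (con 1ℚ :+ n) :* δ := B :* δ :+ B :* n :* δ) refl B (ι n) δ) ⟩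
            B * (1ℚ + ι n) * δ           ≤⟨ Cδ≤θ ⟩
            Q n (suc r) - 1ℚ             ≤⟨ ≤-excess (nonNegative⁻¹ 1ℚ) (solve 1 (λ q → q := (q :- con 1ℚ) :+ con 1ℚ) refl (Q n (suc r))) ⟩
            B * u ^ n                    ≤⟨ *-monoˡ-≤-nonNeg B (u^n≤u 1≤n) ⟩
            B * u                        ∎)
            where
            open ≤-Reasoning
            u^n≤u : ∀ {n} → 1 ℕ.≤ n → u ^ n ≤ u
            u^n≤u {suc n} _ = ≤-trans (*-monoˡ-≤-nonNeg u {{nonNegative (0≤T (suc r))}} (^-≤1 (0≤T (suc r)) (T≤1 (suc r)) n)) (≤-reflexive (*-identityʳ u))
          0<Y : 0ℚ < Y
          0<Y = <⇒0<- (≤-<-trans ε≤δ (≤-<-trans δ≤u (<-≤-trans (T<1 (suc r)) 1≤B)))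
          1-x≡ : 1ℚ - x ≡ u - δ
          1-x≡ = solve 2 (λ ρ δ → con 1ℚ :- (ρ :+ δ) := (con 1ℚ :- ρ) :- δ) refl ρ δ
          x≤1 : x ≤ 1ℚ
          x≤1 = ≤-excess (≤⇒0≤- δ≤u) (solve 2 (λ ρ δ → con 1ℚ := (ρ :+ δ) :+ ((con 1ℚ :- ρ) :- δ)) refl ρ δ)
          0≤x = +-nonNeg (0≤recip (suc r)) 0≤δ
          1<Y^ : 1ℚ < Y * (1ℚ - x) ^ n
          1<Y^ = begin-strict
            1ℚ                                    <⟨ subst₂ _<_ (+-identityʳ 1ℚ) refl (+-monoʳ-< 1ℚ (0<half 0<δ)) ⟩
            1ℚ + δ * ½                            ≤⟨ ≤-excess (+-nonNeg (+-nonNeg (≤⇒0≤- Cδ≤θ) (0≤· (≤⇒0≤- 1≤B) 0≤δ))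
                                                       (+-nonNeg (0≤· 0≤δ (nonNegative⁻¹ (+ 1 / 4))) (+-nonNeg (0≤· 0≤ε (≤⇒0≤- (^-≤1 (0≤T (suc r)) (T≤1 (suc r)) n))) (0≤· 0≤ε (0≤· (0≤ι n) 0≤δ)))))
                                                       (solve 4 (λ B p n δ → (B :- δ :* con ½ :* con ½) :* (p :- n :* δ) :=
                                                         con 1ℚ :+ δ :* con ½ :+ ((((B :* p :- con 1ℚ) :- B :* (con 1ℚ :+ n) :* δ) :+ (B :- con 1ℚ) :* δ) :+
                                                           (δ :* con (+ 1 / 4) :+ (δ :* con ½ :* con ½ :* (con 1ℚ :- p) :+ δ :* con ½ :* con ½ :* (n :* δ))))) refl B (u ^ n) (ι n) δ) ⟩
            Y * (u ^ n - ι n * δ)                 ≤⟨ *-monoˡ-≤-nonNeg Y {{nonNegative (<⇒≤ 0<Y)}} (bernoulli 0≤δ δ≤u (T≤1 (suc r)) n) ⟩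
            Y * (u - δ) ^ n                       ≡⟨ cong (λ z → Y * z ^ n) (sym 1-x≡) ⟩
            Y * (1ℚ - x) ^ n                      ∎
            where open ≤-Reasoning
          n+ε′≤ : ι n + δ * ½ ≤ ι n * x * Y
          n+ε′≤ = ≤-excess (+-nonNeg (+-nonNeg (0≤· (≤⇒0≤- 1≤ιn) (0≤· 0≤δ 0≤½)) (0≤· (0≤ι n) (0≤· 0≤δ (≤⇒0≤- 1≤B))))
              (0≤· (0≤ι n) (0≤· 0≤ε (+-nonNeg (≤⇒0≤- (recip≤1 (suc r))) (≤⇒0≤- (recip≤1 j))))))
            (trans (solve 4 (λ n ρ δ B → n :* (ρ :+ δ) :* (B :- δ :* con ½ :* con ½) :=
                n :* (B :* ρ) :+ n :* (δ :* B :- ρ :* (δ :* con ½ :* con ½) :- δ :* (δ :* con ½ :* con ½))) refl (ι n) ρ δ B)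
              (trans (cong (λ z → ι n * z + ι n * (δ * B - ρ * ε - δ * ε)) Bρ≡1)
                (solve 4 (λ n ρ δ B → n :* con 1ℚ :+ n :* (δ :* B :- ρ :* (δ :* con ½ :* con ½) :- δ :* (δ :* con ½ :* con ½)) :=
                  n :+ δ :* con ½ :+ (((n :- con 1ℚ) :* (δ :* con ½) :+ n :* (δ :* (B :- con 1ℚ))) :+
                    n :* (δ :* con ½ :* con ½ :* ((con 1ℚ :- ρ) :+ (con 1ℚ :- δ))))) refl (ι n) ρ δ B)))
            where
            1≤ιn : 1ℚ ≤ ι n
            1≤ιn = ι-mono-≤ {1} {n} 1≤n
          main : ∀ k → ω ≤ seq w (suc k) × ∣ seq w (suc k) * expSum (seq w (suc k)) (suc k) - ι n ∣ ≤ δ * ½ →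
            expSum (seq w (suc k)) (suc k) + ε ≤ B
          -- If Y ≤ E, then v Y ≤ v E ≤ n + δ/2 ≤ n x Y, so v ≤ n x; the upper bound for the
          -- exponential at n x then contradicts 1 < Y (1 - x)ⁿ.
          main k (ω≤v , close) = ≮⇒≥ λ B<E+ε → <-irrefl refl (begin-strict
            1ℚ                                         <⟨ 1<Y^ ⟩
            Y * (1ℚ - x) ^ n                           ≤⟨ *-monoʳ-≤-nonNeg ((1ℚ - x) ^ n) {{nonNegative (^-nonNeg (≤⇒0≤- x≤1) n)}} (Y≤E B<E+ε) ⟩
            E * (1ℚ - x) ^ n                           ≤⟨ *-monoʳ-≤-nonNeg ((1ℚ - x) ^ n) {{nonNegative (^-nonNeg (≤⇒0≤- x≤1) n)}} (expSum-mono 0≤v (v≤nx (Y≤E B<E+ε)) (suc k)) ⟩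
            expSum (ι n * x) (suc k) * (1ℚ - x) ^ n    ≤⟨ expSum*^≤1 0≤x x≤1 n k ⟩
            1ℚ                                         ∎)
            where
            open ≤-Reasoning
            v = seq w (suc k)
            E = expSum v (suc k)
            0≤v = ≤-trans (<⇒≤ 0<ω) ω≤v
            Y≤E : B < E + ε → Y ≤ E
            Y≤E B<E+ε = ≤-trans (+-monoˡ-≤ (- ε) (<⇒≤ B<E+ε)) (≤-reflexive (solve 2 (λ E ε → E :+ ε :- ε := E) refl E ε))
            v≤nx : Y ≤ E → v ≤ ι n * x
            v≤nx Y≤E = *-cancelʳ-≤-pos Y {{positive 0<Y}} (begin
              v * Y              ≤⟨ *-monoˡ-≤-nonNeg v {{nonNegative 0≤v}} Y≤E ⟩
              v * E              ≤⟨ ∣p-q∣≤⇒p≤ (v * E) (ι n) close ⟩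
              ι n + δ * ½        ≤⟨ n+ε′≤ ⟩
              ι n * x * Y        ∎)

    -- Excludes a negative floor: every partial sum at a nonnegative point is at least 1.
    exp≮0 : ∀ i → i ℤ.≤ + 0 → ¬ exp w Defs.< fromℤ i
    exp≮0 i i≤0 (ε , 0<ε , N , E+ε≤) with eventually 1ℚ (positive⁻¹ 1ℚ)
    ... | N′ , ev = <-irrefl refl (begin-strict
      0ℚ          <⟨ positive⁻¹ 1ℚ ⟩
      1ℚ          ≤⟨ 1≤expSum (≤-trans (<⇒≤ 0<ω) (proj₁ (ev k (ℕ.m≤n+m N′ N)))) k ⟩
      E           ≤⟨ ≤-step (<⇒≤ 0<ε) ⟩
      E + ε       ≤⟨ E+ε≤ k (ℕ.m≤m+n N N′) ⟩
      i / 1       ≤⟨ /1≤0 i≤0 ⟩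
      0ℚ          ∎)
      where
      open ≤-Reasoning
      k = N ℕ.+ N′
      E = expSum (seq w k) k
      /1≤0 : ∀ {i} → i ℤ.≤ + 0 → i / 1 ≤ 0ℚ
      /1≤0 (ℤ.+≤+ ℕ.z≤n) = ≤-refl
      /1≤0 { -[1+ n ] } ℤ.-≤+ = neg-antimono-≤ (subst (0ℚ ≤_) (sym (/1≡ι (suc n))) (0≤ι (suc n)))

-- The two bounds for the mode

open import Data.Integer.Base using (+_)

theorem1 : ∀ (n : ℕ) → 2 ℕ.≤ n →
    ∀ (K : ℕ) → IsK n K →
    ∀ (w : ℝ) → IsLambertW n w →
    ∀ (m : ℤ) → IsFloor (exp w) m →
    (m ℤ.- + 2 ℤ.≤ + K) × (+ K ℤ.≤ m ℤ.+ + 1)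
theorem1 n 2≤n K (1≤K , _ , S-below , S-above) w lambert m (m≤exp , exp<m+1) = lower m m≤exp , upper m exp<m+1
  where
  open Counting
  open Exponential
  open Triangle S refl S-zero-suc S-suc-zero S-suc-suc
  open import Data.Integer.Base using (-[1+_])
  open import Relation.Nullary.Decidable using (yes; no)
  open import Relation.Nullary.Negation using (contradiction)

  lower : ∀ m → fromℤ m Defs.≤ exp w → m ℤ.- + 2 ℤ.≤ + K
  lower -[1+ _ ] _ = ℤ.-≤+
  lower (+ M) M≤exp with M ℕ.≤? 2 ℕ.+ K
  ... | yes M≤2+K = ℤ.+-monoˡ-≤ (ℤ.- + 2) (ℤ.+≤+ M≤2+K)
  -- Here M = 3 + K + o ≤ e^w, so kⁿ / k ! does not decrease from M - 1 to M and S n still increases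
  -- strictly from K to K + 1, against the choice of K.
  ... | no M≰2+K with o , refl ← ℕ.m≤n⇒∃[o]m+o≡n (ℕ.≰⇒> M≰2+K) = contradiction
    (subst (λ k → S n k ℕ.≤ S n K) (ℕ.+-comm K 1) S-above)
    (ℕ.<⇒≱ (increasing⇒a-increasing n (K ℕ.+ o) (≤exp⇒increasing n w lambert (ℕ.<⇒≤ 2≤n) (suc (K ℕ.+ o)) M≤exp) (ℕ.m≤m+n K o)))

  S-increasing : ∀ {k} → k ℕ.< K → S n k ℕ.≤ S n (suc k)
  S-increasing = go 1≤K S-below
    where
    go : ∀ {K} → 1 ℕ.≤ K → S n (K ℕ.∸ 1) ℕ.< S n K → ∀ {k} → k ℕ.< K → S n k ℕ.≤ S n (suc k)
    go {suc K} _ S-below (ℕ.s≤s k≤K) = a-unimodal n S-below k≤K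

  upper : ∀ m → exp w Defs.< fromℤ (m ℤ.+ + 1) → + K ℤ.≤ m ℤ.+ + 1
  upper -[1+ j ] exp<m+1 = contradiction exp<m+1 (exp≮0 n w lambert (-[1+ j ] ℤ.+ + 1) (nonPositive j))
    where
    nonPositive : ∀ j → -[1+ j ] ℤ.+ + 1 ℤ.≤ + 0
    nonPositive zero    = ℤ.+≤+ ℕ.z≤n
    nonPositive (suc j) = ℤ.-≤+
  -- If K ≥ M + 2, growth of S n up to M + 2 gives (M + 2) (M + 1)ⁿ ≤ (M + 2)ⁿ, while e^w < M + 1
  -- gives (M + 2)ⁿ ≤ (M + 1) (M + 1)ⁿ.
  upper (+ M) exp<M+1 rewrite ℕ.+-comm M 1 = ℤ.+≤+ (ℕ.≮⇒≥ λ 1+M<K → ℕ.<⇒≱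
    (ℕ.*-monoˡ-< (suc M ℕ.^ n) {{ℕ.m^n≢0 (suc M) n}} (ℕ.n<1+n (suc M)))
    (ℕ.≤-trans (a-increasing⇒power n (2 ℕ.+ M) (λ k<2+M → S-increasing (ℕ.<-≤-trans k<2+M 1+M<K))) (exp<⇒^≤ n w lambert M exp<M+1)))
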